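{- Let $S$ be the antipode of the Hopf algebra $\Lambda$ of symmetric functions over $\mathbb{Z}$ and $\lambda$ a partition. Then (a) $S(\tilde j_\lambda)=(-1)^{|\lambda|}g_\lambda$, where $\tilde j_\lambda=(-1)^{|\lambda|}j_\lambda(-x_1,-x_2,\dots)$, and (b) $S(j_\lambda)=g_\lambda(-x_1,-x_2,\dots)$.
   Context: $\Lambda$ is the ring of symmetric functions over $\mathbb{Z}$ with its standard Hopf structure (coproduct $\Delta f=f(x_1,x_2,\dots,y_1,y_2,\dots)$, counit the constant term, antipode $S$ the convolution inverse of the identity). Young diagrams in English notation. A reverse plane partition of shape $\lambda$ is a filling of the cells with positive integers weakly increasing along rows and down columns; for such $T$, $x^T=\prod_r x_r^{c_r(T)}$ where $c_r(T)$ is the number of columns of $T$ containing $r$. The dual stable Grothendieck polynomial is $g_\lambda=\sum_T x^T$ over reverse plane partitions of shape $\lambda$. A valued-set tableau of shape $\lambda$ is a filling of the cells with positive integers strictly increasing along rows and weakly increasing down columns (its transpose is semistandard), together with a decomposition of the cells into disjoint groups $A_j$, each group a set of vertically consecutive cells in a single column all containing the same number. Its weight is $\prod_r x_r^{a_r}$, $a_r$ the number of groups whose cells contain $r$. $j_\lambda$ is the sum of the weights of all valued-set tableaux of shape $\lambda$. -}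

module Defs where

-- Concrete model of the ring Λ of symmetric functions over ℤ in the
-- monomial basis: an element is its coefficient function μ ↦ [m_μ] f
-- (= coefficient of the monomial x^μ), with a degree bound.

open import Data.Nat as ℕ using (ℕ; zero; suc; _≤_; _<_; _≤?_; _∸_; _⊔_; _⊓_)
open import Data.Nat.Properties using (<⇒≱; m≤m⊔n; m≤n⊔m; ≤-<-trans)
open import Data.Integer as ℤ using (ℤ; 0ℤ; 1ℤ; _+_; _*_; -_; +_)
open import Data.Integer.Properties using (+-identityʳ)
open import Data.Bool using (Bool; true; false; _∧_; _∨_; if_then_else_; not; T)
open import Data.List using (List; []; _∷_; map; concatMap; foldr; length; filter; zip; upTo; _++_; applyUpTo)
open import Data.Bool.ListAction using (all; any)
open import Data.Product using (_×_; _,_; proj₁; proj₂)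
open import Data.Maybe using (Maybe; just; nothing)
open import Relation.Nullary using (yes; no)
open import Relation.Nullary.Decidable using (⌊_⌋)
open import Relation.Binary.PropositionalEquality using (_≡_; refl)
open import Data.Empty using (⊥-elim)
import Data.List.Properties as LP

sumℕ : List ℕ → ℕ
sumℕ = foldr ℕ._+_ 0

sumℤ : List ℤ → ℤ
sumℤ = foldr _+_ 0ℤ

_==_ : ℕ → ℕ → Bool
m == n = ⌊ m ℕ.≟ n ⌋

_≤ᵇ_ : ℕ → ℕ → Bool
m ≤ᵇ n = ⌊ m ≤? n ⌋

_<ᵇ_ : ℕ → ℕ → Bool
m <ᵇ n = suc m ≤ᵇ n

countB : {A : Set} → (A → Bool) → List A → ℕ
countB p xs = length (filter (λ x → T? (p x)) xs)
  where
  open import Data.Bool.Properties using () renaming (T? to T?)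

at : List ℕ → ℕ → Maybe ℕ
at []       _       = nothing
at (x ∷ xs) zero    = just x
at (x ∷ xs) (suc j) = at xs j

atB : List Bool → ℕ → Bool
atB []       _       = false
atB (x ∷ xs) zero    = x
atB (x ∷ xs) (suc j) = atB xs j

oneTo : ℕ → List ℕ
oneTo k = applyUpTo suc k

pairs : {A : Set} → List A → List (A × A)
pairs []           = []
pairs (x ∷ [])     = []
pairs (x ∷ y ∷ xs) = (x , y) ∷ pairs (y ∷ xs)

choices : {A : Set} → List (List A) → List (List A)
choices []         = [] ∷ []
choices (xs ∷ xss) = concatMap (λ x → map (x ∷_) (choices xss)) xs

isPartB : List ℕ → Bool
isPartB []           = true
isPartB (x ∷ [])     = 1 ≤ᵇ x
isPartB (x ∷ y ∷ xs) = (y ≤ᵇ x) ∧ isPartB (y ∷ xs)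

IsPartition : List ℕ → Set
IsPartition μ = T (isPartB μ)

size : List ℕ → ℕ
size = sumℕ

-- all partitions of n with all parts ≤ m (fuel f ≥ n)
parsF : ℕ → ℕ → ℕ → List (List ℕ)
parsF _       zero    _ = [] ∷ []
parsF zero    (suc n) _ = []
parsF (suc f) (suc n) m =
  concatMap (λ k → map (k ∷_) (parsF f (suc n ∸ k) k)) (oneTo (suc n ⊓ m))

parsOf : ℕ → List (List ℕ)
parsOf n = parsF n n n

parsUpTo : ℕ → List (List ℕ)
parsUpTo B = concatMap parsOf (upTo (suc B))

insertDesc : ℕ → List ℕ → List ℕ
insertDesc x []       = x ∷ []
insertDesc x (y ∷ ys) = if y ≤ᵇ x then x ∷ y ∷ ys else y ∷ insertDesc x ys

sortDesc : List ℕ → List ℕ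
sortDesc []       = []
sortDesc (zero  ∷ xs) = sortDesc xs
sortDesc (suc x ∷ xs) = insertDesc (suc x) (sortDesc xs)

_∪ₚ_ : List ℕ → List ℕ → List ℕ
ν ∪ₚ ρ = sortDesc (ν ++ ρ)

record Λ : Set where
  field
    coeff  : List ℕ → ℤ           -- μ ↦ coefficient of x^μ (= of m_μ)
    bound  : ℕ
    vanish : ∀ μ → bound < size μ → coeff μ ≡ 0ℤ
open Λ public

_≈_ : Λ → Λ → Set
f ≈ g = ∀ μ → IsPartition μ → coeff f μ ≡ coeff g μ

infix 4 _≈_

-- build an element from coefficients known to vanish above degree B
-- (the cut-off is only used to record the degree bound)
trunc : ℕ → (List ℕ → ℤ) → List ℕ → ℤ
trunc B c μ with size μ ≤? B
... | yes _ = c μ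
... | no  _ = 0ℤ

trunc-vanish : ∀ B c μ → B < size μ → trunc B c μ ≡ 0ℤ
trunc-vanish B c μ lt with size μ ≤? B
... | yes p = ⊥-elim (<⇒≱ lt p)
... | no  _ = refl

fromCoeffs : ℕ → (List ℕ → ℤ) → Λ
fromCoeffs B c = record { coeff = trunc B c ; bound = B ; vanish = trunc-vanish B c }

_==ₗ_ : List ℕ → List ℕ → Bool
[]       ==ₗ []       = true
(x ∷ xs) ==ₗ (y ∷ ys) = (x == y) ∧ (xs ==ₗ ys)
_        ==ₗ _        = false

mono : List ℕ → Λ
mono ν = fromCoeffs (size ν) (λ μ → if μ ==ₗ ν then 1ℤ else 0ℤ)

scalar1 : ℤ → Λ
scalar1 c = fromCoeffs 0 (λ μ → if μ ==ₗ [] then c else 0ℤ)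

ε : Λ → ℤ
ε f = coeff f []

_+Λ_ : Λ → Λ → Λ
f +Λ g = fromCoeffs (bound f ⊔ bound g) (λ μ → coeff f μ + coeff g μ)

boxes : List ℕ → List (List ℕ)
boxes []      = [] ∷ []
boxes (m ∷ μ) = concatMap (λ i → map (i ∷_) (boxes μ)) (upTo (suc m))

_-ᵥ_ : List ℕ → List ℕ → List ℕ
(x ∷ xs) -ᵥ (y ∷ ys) = (x ∸ y) ∷ (xs -ᵥ ys)
xs       -ᵥ _        = xs

-- coefficient of x^μ in a product: Σ_{x^α x^β = x^μ} [x^α]a · [x^β]b,
-- using symmetry [x^α]a = a(sort α)
mulCoeff : (List ℕ → ℤ) → (List ℕ → ℤ) → List ℕ → ℤ
mulCoeff a b μ = sumℤ (map (λ α → a (sortDesc α) * b (sortDesc (μ -ᵥ α))) (boxes μ))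

sgn : ℕ → ℤ
sgn zero    = 1ℤ
sgn (suc n) = - sgn n

-- Convolutions with the identity, using
--   Δ f = f(x,y) = Σ_{ν,ρ} [x^ν y^ρ] f(x,y) · m_ν ⊗ m_ρ,
--   [x^ν y^ρ] f(x,y) = [m_{ν ∪ ρ}] f   (f symmetric),
-- and  (S ⊗ id), (id ⊗ S)  applied linearly on the basis m_ν ⊗ m_ρ.
-- Only pairs with |ν|+|ρ| ≤ bound f contribute; we sum over all pairs of
-- partitions of size ≤ bound f (the others have coefficient 0).

convSid : (Λ → Λ) → Λ → List ℕ → ℤ
convSid S f α =
  sumℤ (concatMap (λ ν → map (λ ρ →
      coeff f (ν ∪ₚ ρ) * mulCoeff (coeff (S (mono ν))) (coeff (mono ρ)) α)
    (parsUpTo (bound f))) (parsUpTo (bound f)))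

convidS : (Λ → Λ) → Λ → List ℕ → ℤ
convidS S f α =
  sumℤ (concatMap (λ ν → map (λ ρ →
      coeff f (ν ∪ₚ ρ) * mulCoeff (coeff (mono ν)) (coeff (S (mono ρ))) α)
    (parsUpTo (bound f))) (parsUpTo (bound f)))

record IsAntipode (S : Λ → Λ) : Set where
  field
    S-cong   : ∀ f g → f ≈ g → S f ≈ S g
    S-additive : ∀ f g → S (f +Λ g) ≈ (S f +Λ S g)
    S*id     : ∀ f α → IsPartition α → convSid S f α ≡ coeff (scalar1 (ε f)) α
    id*S     : ∀ f α → IsPartition α → convidS S f α ≡ coeff (scalar1 (ε f)) α

-- Fillings of a Young diagram λ (English notation): a filling is a list of
-- rows, row i having length λ_i.

Filling : Set
Filling = List (List ℕ)

words : ℕ → ℕ → List (List ℕ)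
words k zero    = [] ∷ []
words k (suc l) = concatMap (λ x → map (x ∷_) (words k l)) (oneTo k)

fillings : ℕ → List ℕ → List Filling
fillings k shp = choices (map (words k) shp)

rowWeak : List ℕ → Bool
rowWeak r = all (λ p → proj₁ p ≤ᵇ proj₂ p) (pairs r)

rowStrict : List ℕ → Bool
rowStrict r = all (λ p → proj₁ p <ᵇ proj₂ p) (pairs r)

-- weakly increasing down columns (rows of a partition shape get shorter,
-- so zip compares exactly the cells lying below one another)
colsWeak : Filling → Bool
colsWeak T = all (λ p → all (λ q → proj₁ q ≤ᵇ proj₂ q) (zip (proj₁ p) (proj₂ p))) (pairs T)

isRPP : Filling → Bool
isRPP T = all rowWeak T ∧ colsWeak T

-- transpose is semistandard: rows strict, columns weak
isVST : Filling → Bool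
isVST T = all rowStrict T ∧ colsWeak T

width : List ℕ → ℕ
width []      = 0
width (l ∷ _) = l

isJust= : ℕ → Maybe ℕ → Bool
isJust= r (just x) = x == r
isJust= r nothing  = false

colCount : List ℕ → Filling → ℕ → ℕ
colCount shp T r = countB (λ j → any (λ row → isJust= r (at row j)) T) (upTo (width shp))

weightIs : List ℕ → (ℕ → ℕ) → Bool
weightIs μ a = go 1 μ
  where
  go : ℕ → List ℕ → Bool
  go r []       = true
  go r (m ∷ ms) = (a r == m) ∧ go (suc r) ms

-- Dual stable Grothendieck polynomial g_λ.
-- [x^μ] g_λ = #{ RPP T of shape λ : x^T = x^μ }; such T have entries in
-- {1..ℓ(μ)}, and |x^T| ≤ |λ|.

gCoeff : List ℕ → List ℕ → ℤ
gCoeff shp μ = + countB (λ T → isRPP T ∧ weightIs μ (colCount shp T)) (fillings (length μ) shp)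

gλ : List ℕ → Λ
gλ shp = fromCoeffs (size shp) (gCoeff shp)

-- Valued-set tableaux and j_λ.
-- A decomposition of the cells into groups of vertically consecutive cells
-- of one column carrying the same number is encoded by a "join" flag on
-- each cell: the flag says the cell lies in the same group as the cell
-- directly above it (allowed only if that cell exists and has the same
-- entry).  Groups = maximal vertical runs of joined cells; this encoding is
-- a bijection with such decompositions.

flagsets : List ℕ → List (List (List Bool))
flagsets shp = choices (map (λ l → choices (applyUpTo (λ _ → true ∷ false ∷ []) l)) shp)

validFlags : Filling → List (List Bool) → Bool
validFlags T F = firstRow F ∧ rest T F
  where
  firstRow : List (List Bool) → Bool
  firstRow []      = true
  firstRow (f ∷ _) = all not f
  okRow : List ℕ → List ℕ → List Bool → Bool
  okRow above row fl = all (λ j → not (atB fl j) ∨ eqAt j) (upTo (length row))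
    where
    eqAt : ℕ → Bool
    eqAt j with at above j | at row j
    ... | just a | just b = a == b
    ... | _      | _      = false
  rest : Filling → List (List Bool) → Bool
  rest (a ∷ b ∷ T') (_ ∷ fb ∷ F') = okRow a b fb ∧ rest (b ∷ T') (fb ∷ F')
  rest _            _              = true

-- a_r = number of groups whose cells contain r = number of cells with entry r
-- that are the top cell of their group (flag false)
groupCount : Filling → List (List Bool) → ℕ → ℕ
groupCount T F r = sumℕ (map (λ p → countB (λ q → (proj₁ q == r) ∧ not (proj₂ q)) (zip (proj₁ p) (proj₂ p))) (zip T F))

jCoeff : List ℕ → List ℕ → ℤ
jCoeff shp μ = + sumℕ (map (λ T → countB (λ F → validFlags T F ∧ weightIs μ (groupCount T F)) (flagsets shp))
                       (filter (λ T → Data.Bool.Properties.T? (isVST T)) (fillings (length μ) shp)))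
  where import Data.Bool.Properties

jλ : List ℕ → Λ
jλ shp = fromCoeffs (size shp) (jCoeff shp)

j̃λ : List ℕ → Λ
j̃λ shp = fromCoeffs (size shp) (λ μ → sgn (size shp) * (sgn (size μ) * coeff (jλ shp) μ))

negx : Λ → Λ
negx f = fromCoeffs (bound f) (λ μ → sgn (size μ) * coeff f μ)

scale : ℤ → Λ → Λ
scale c f = fromCoeffs (bound f) (λ μ → c * coeff f μ)

{-# OPTIONS --safe #-}
-- S(f) has coefficient Σ_α (-1)^ℓ(α) [x^α] f at x^β, where α runs over the
-- refinements of β: this is proved on the monomial basis, where the convolution
-- identity determines the antipode recursively.  The coefficients of j_λ and g_λ
-- count chains of shapes from ∅ to λ, one step per letter, hence are products of
-- transfer matrices J(x) and G(x) indexed by pairs of shapes and polynomial in x.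
-- Entries of these matrices are products over rows, so that row by row one gets
--   J(x) J(y) = J(y) J(x),   so that j_λ is symmetric, and
--   J(x) G(-x) = 1,          so that Σ_α (-1)^ℓ(α) J_α₁ ⋯ J_αₗ = (-1)^n G_n over compositions α of n.
-- Summing over the refinements of β turns every J into G, which is the theorem.
-- Polynomial identities are checked at integer points; coefficients are recovered
-- because an integer polynomial vanishing at all positive integers is zero.
module Submission where

import Algebra.Properties.CommutativeSemigroup as CommutativeSemigroup
import Algebra.Properties.Group as Group
open import Algebra.Bundles using (AbelianGroup)
open import Defs
open import Data.Bool using (Bool; true; false; T; _∧_; _∨_; not; if_then_else_)
open import Data.Bool.ListAction using (all; any; and)
open import Data.Bool.Properties using (T?; ∧-identityʳ; ∧-zeroʳ; ∨-identityʳ)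
open import Data.Empty using (⊥; ⊥-elim)
open import Data.Integer as ℤ using (ℤ; 0ℤ; 1ℤ; _+_; _*_; -_)
import Data.Integer.Properties as ℤP
open import Data.Integer.Tactic.RingSolver using (solve-∀)
open import Data.List using (List; []; _∷_; _++_; _∷ʳ_; map; concatMap; filter; foldl; length; replicate; upTo; applyUpTo; zip)
import Data.List.Properties as LP
open import Data.List.Relation.Binary.Permutation.Propositional using (_↭_; prep; swap; ↭-refl; ↭-trans)
import Data.List.Relation.Binary.Permutation.Propositional as Perm
import Data.List.Relation.Binary.Permutation.Propositional.Properties as PermP
open import Data.List.Relation.Unary.All using (All; []; _∷_)
import Data.List.Relation.Unary.All as All
import Data.List.Relation.Unary.All.Properties as AllP
open import Data.Maybe using (just)
open import Data.Nat as ℕ using (ℕ; zero; suc; z≤n; s≤s; _≤_; _<_; _∸_; _⊔_; _⊓_)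
import Data.Nat.Properties as ℕP
open import Data.Product using (_×_; _,_; proj₁; proj₂; ∃)
open import Data.Sum using (_⊎_; inj₁; inj₂)
open import Data.Unit using (⊤; tt)
open import Function using (_∘_; id)
open import Relation.Binary.Definitions using (tri<; tri≈; tri>)
open import Relation.Binary.PropositionalEquality
open import Relation.Nullary using (¬_; Dec; yes; no)
open import Relation.Nullary.Decidable using (toWitness; fromWitness)
open ≡-Reasoning
open Group (AbelianGroup.group ℤP.+-0-abelianGroup) using () renaming (∙-cancelʳ to +-cancelʳ)
open CommutativeSemigroup ℤP.+-commutativeSemigroup using () renaming (interchange to +-interchange)
open CommutativeSemigroup ℤP.*-commutativeSemigroup using () renaming (interchange to *-interchange; x∙yz≈y∙xz to *-swapˡ)
open CommutativeSemigroup ℕP.+-commutativeSemigroup using () renaming (interchange to ℕ+-interchange)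

-- A row enters the factor of the row below it only through its old length. A product of two
-- matrices can therefore be computed from the bottom row up, with the old and the intermediate
-- length of the row above as state. Rows of valued-set tableaux are strict, so J lengthens a row by
-- at most one cell and the state has only two values for each old length. For J(x) G(-x) both
-- values give the same product, and exactly this makes the terms cancel. For J(x) J(y) the product
-- is symmetric when the row above is lengthened by neither letter or by both. When it is lengthened
-- once, only the sum over the two possible letters, each with its weight, is symmetric. Hence three
-- statements are proved together. Commutation is what connects the two halves: the antipode formula
-- reads coefficients of j at sorted exponents, while the matrices are multiplied in the order in
-- which the parts of a refinement occur. Sums over shapes run over all lists of bounded lengths; an
-- entry vanishes unless its smaller shape is decreasing, so only partitions contribute.

private variable
  A B : Set

-- Finite sums

∑ : List A → (A → ℤ) → ℤ
∑ xs f = sumℤ (map f xs)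

∑-cong : ∀ (xs : List A) {f g : A → ℤ} → (∀ x → f x ≡ g x) → ∑ xs f ≡ ∑ xs g
∑-cong []       h = refl
∑-cong (x ∷ xs) h = cong₂ _+_ (h x) (∑-cong xs h)

∑-congᴬ : ∀ {xs : List A} {f g : A → ℤ} → All (λ x → f x ≡ g x) xs → ∑ xs f ≡ ∑ xs g
∑-congᴬ []       = refl
∑-congᴬ (p ∷ ps) = cong₂ _+_ p (∑-congᴬ ps)

∑-++ : ∀ (xs ys : List A) (f : A → ℤ) → ∑ (xs ++ ys) f ≡ ∑ xs f + ∑ ys f
∑-++ []       ys f = sym (ℤP.+-identityˡ _)
∑-++ (x ∷ xs) ys f = trans (cong (f x +_) (∑-++ xs ys f)) (sym (ℤP.+-assoc (f x) (∑ xs f) (∑ ys f)))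

∑-map : ∀ (h : A → B) xs (f : B → ℤ) → ∑ (map h xs) f ≡ ∑ xs (λ x → f (h x))
∑-map h []       f = refl
∑-map h (x ∷ xs) f = cong (f (h x) +_) (∑-map h xs f)

∑-concatMap : ∀ (h : A → List B) xs (f : B → ℤ) → ∑ (concatMap h xs) f ≡ ∑ xs (λ x → ∑ (h x) f)
∑-concatMap h []       f = refl
∑-concatMap h (x ∷ xs) f = trans (∑-++ (h x) _ f) (cong (∑ (h x) f +_) (∑-concatMap h xs f))

∑-∷ : ∀ (h : A → List (List A)) xs (f : List A → ℤ) →
      ∑ (concatMap (λ x → map (x ∷_) (h x)) xs) f ≡ ∑ xs (λ x → ∑ (h x) (λ l → f (x ∷ l)))
∑-∷ h xs f = trans (∑-concatMap _ xs f) (∑-cong xs (λ x → ∑-map (x ∷_) (h x) f))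

∑-zero : ∀ (xs : List A) → ∑ xs (λ _ → 0ℤ) ≡ 0ℤ
∑-zero []       = refl
∑-zero (x ∷ xs) = trans (ℤP.+-identityˡ _) (∑-zero xs)

∑-≡0 : ∀ (xs : List A) {f : A → ℤ} → (∀ x → f x ≡ 0ℤ) → ∑ xs f ≡ 0ℤ
∑-≡0 xs h = trans (∑-cong xs h) (∑-zero xs)

∑-≡0ᴬ : ∀ {xs : List A} {f : A → ℤ} → All (λ x → f x ≡ 0ℤ) xs → ∑ xs f ≡ 0ℤ
∑-≡0ᴬ {xs = xs} h = trans (∑-congᴬ h) (∑-zero xs)

∑-+ : ∀ (xs : List A) (f g : A → ℤ) → ∑ xs (λ x → f x + g x) ≡ ∑ xs f + ∑ xs g
∑-+ []       f g = refl
∑-+ (x ∷ xs) f g = trans (cong ((f x + g x) +_) (∑-+ xs f g)) (+-interchange (f x) (g x) (∑ xs f) (∑ xs g))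

∑-*ˡ : ∀ c (xs : List A) (f : A → ℤ) → ∑ xs (λ x → c * f x) ≡ c * ∑ xs f
∑-*ˡ c []       f = sym (ℤP.*-zeroʳ c)
∑-*ˡ c (x ∷ xs) f = trans (cong (c * f x +_) (∑-*ˡ c xs f)) (sym (ℤP.*-distribˡ-+ c (f x) (∑ xs f)))

∑-*ʳ : ∀ c (xs : List A) (f : A → ℤ) → ∑ xs (λ x → f x * c) ≡ ∑ xs f * c
∑-*ʳ c []       f = refl
∑-*ʳ c (x ∷ xs) f = trans (cong (f x * c +_) (∑-*ʳ c xs f)) (sym (ℤP.*-distribʳ-+ c (f x) (∑ xs f)))

∑-single : ∀ z → 1ℤ * z + 0ℤ ≡ z
∑-single = solve-∀

∑-neg : ∀ (xs : List A) (f : A → ℤ) → ∑ xs (λ x → - f x) ≡ - ∑ xs f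
∑-neg []       f = refl
∑-neg (x ∷ xs) f = trans (cong (- f x +_) (∑-neg xs f)) (sym (ℤP.neg-distrib-+ (f x) (∑ xs f)))

∑-swap : ∀ (xs : List A) (ys : List B) (f : A → B → ℤ) →
         ∑ xs (λ x → ∑ ys (f x)) ≡ ∑ ys (λ y → ∑ xs (λ x → f x y))
∑-swap []       ys f = sym (∑-zero ys)
∑-swap (x ∷ xs) ys f = trans (cong (∑ ys (f x) +_) (∑-swap xs ys f)) (sym (∑-+ ys (f x) (λ y → ∑ xs (λ x₁ → f x₁ y))))

-- Associativity of a row vector `c`, a matrix `u` and a column vector `v`.
∑-pull : ∀ (xs : List A) (ys : List B) (c : A → ℤ) (u : A → B → ℤ) (v : B → ℤ) →
         ∑ ys (λ y → ∑ xs (λ x → c x * u x y) * v y) ≡ ∑ xs (λ x → c x * ∑ ys (λ y → u x y * v y))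
∑-pull xs ys c u v = begin
  ∑ ys (λ y → ∑ xs (λ x → c x * u x y) * v y)
    ≡⟨ ∑-cong ys (λ y → trans (sym (∑-*ʳ (v y) xs (λ x → c x * u x y))) (∑-cong xs (λ x → ℤP.*-assoc (c x) (u x y) (v y)))) ⟩
  ∑ ys (λ y → ∑ xs (λ x → c x * (u x y * v y))) ≡⟨ ∑-swap ys xs (λ y x → c x * (u x y * v y)) ⟩
  ∑ xs (λ x → ∑ ys (λ y → c x * (u x y * v y))) ≡⟨ ∑-cong xs (λ x → ∑-*ˡ (c x) ys (λ y → u x y * v y)) ⟩
  ∑ xs (λ x → c x * ∑ ys (λ y → u x y * v y)) ∎

∑-applyUpTo : ∀ (h : ℕ → A) n (f : A → ℤ) → ∑ (applyUpTo h n) f ≡ ∑ (upTo n) (λ i → f (h i))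
∑-applyUpTo h n f = trans (cong (λ l → ∑ l f) (sym (LP.map-upTo h n))) (∑-map h (upTo n) f)

∑-upTo-suc : ∀ n (f : ℕ → ℤ) → ∑ (upTo (suc n)) f ≡ f 0 + ∑ (upTo n) (λ i → f (suc i))
∑-upTo-suc n f = cong (f 0 +_) (∑-applyUpTo suc n f)

∑-upTo-∷ʳ : ∀ n (f : ℕ → ℤ) → ∑ (upTo (suc n)) f ≡ ∑ (upTo n) f + f n
∑-upTo-∷ʳ n f = begin
  ∑ (upTo (suc n)) f    ≡⟨ cong (λ l → ∑ l f) (sym (LP.upTo-∷ʳ n)) ⟩
  ∑ (upTo n ∷ʳ n) f     ≡⟨ ∑-++ (upTo n) (n ∷ []) f ⟩
  ∑ (upTo n) f + (f n + 0ℤ) ≡⟨ cong (∑ (upTo n) f +_) (ℤP.+-identityʳ (f n)) ⟩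
  ∑ (upTo n) f + f n ∎

∑-upTo-cong : ∀ n {f g : ℕ → ℤ} → (∀ i → i < n → f i ≡ g i) → ∑ (upTo n) f ≡ ∑ (upTo n) g
∑-upTo-cong zero    h = refl
∑-upTo-cong (suc n) {f} {g} h = begin
  ∑ (upTo (suc n)) f ≡⟨ ∑-upTo-suc n f ⟩
  _ ≡⟨ cong₂ _+_ (h 0 (s≤s z≤n)) (∑-upTo-cong n (λ i lt → h (suc i) (s≤s lt))) ⟩
  _ ≡⟨ sym (∑-upTo-suc n g) ⟩
  ∑ (upTo (suc n)) g ∎

∑-boxes-∷ : ∀ m μ (f : List ℕ → ℤ) →
            ∑ (boxes (m ∷ μ)) f ≡ ∑ (upTo (suc m)) (λ i → ∑ (boxes μ) (λ α → f (i ∷ α)))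
∑-boxes-∷ m μ f = ∑-∷ (λ _ → boxes μ) (upTo (suc m)) f

sumℤ-concatMap : ∀ (f : A → B → ℤ) xs ys →
  sumℤ (concatMap (λ x → map (f x) ys) xs) ≡ ∑ xs (λ x → ∑ ys (f x))
sumℤ-concatMap f []       ys = refl
sumℤ-concatMap f (x ∷ xs) ys = begin
  sumℤ (map (f x) ys ++ zs) ≡⟨ cong sumℤ (sym (LP.map-id (map (f x) ys ++ zs))) ⟩
  ∑ (map (f x) ys ++ zs) id ≡⟨ ∑-++ (map (f x) ys) zs id ⟩
  ∑ (map (f x) ys) id + ∑ zs id ≡⟨ cong₂ _+_ (∑-map (f x) ys id) (cong sumℤ (LP.map-id zs)) ⟩
  ∑ ys (f x) + sumℤ zs ≡⟨ cong (∑ ys (f x) +_) (sumℤ-concatMap f xs ys) ⟩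
  _ ∎
  where
  zs : List ℤ
  zs = concatMap (λ x → map (f x) ys) xs

-- Indicators

ind : Bool → ℤ
ind b = if b then 1ℤ else 0ℤ

ind-∧ : ∀ a b → ind (a ∧ b) ≡ ind a * ind b
ind-∧ true  b = sym (ℤP.*-identityˡ (ind b))
ind-∧ false b = refl

T⇒≡true : ∀ {b} → T b → b ≡ true
T⇒≡true {true} _ = refl

≡true⇒T : ∀ {b} → b ≡ true → T b
≡true⇒T refl = tt

¬T⇒≡false : ∀ {b} → ¬ T b → b ≡ false
¬T⇒≡false {true}  ¬t = ⊥-elim (¬t tt)
¬T⇒≡false {false} _  = refl

T-∧ : ∀ {a b} → T (a ∧ b) → T a × T b
T-∧ {true} t = tt , t

bool-ext : ∀ {a b} → (T a → T b) → (T b → T a) → a ≡ b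
bool-ext {true}  {true}  f g = refl
bool-ext {true}  {false} f g = ⊥-elim (f tt)
bool-ext {false} {true}  f g = ⊥-elim (g tt)
bool-ext {false} {false} f g = refl

==⇒≡ : ∀ {m n} → T (m == n) → m ≡ n
==⇒≡ t = toWitness t

==-true : ∀ {m n} → m ≡ n → (m == n) ≡ true
==-true {m} {n} p = T⇒≡true (fromWitness {a? = m ℕ.≟ n} p)

==-false : ∀ {m n} → m ≢ n → (m == n) ≡ false
==-false ne = ¬T⇒≡false (ne ∘ ==⇒≡)

==-refl : ∀ m → (m == m) ≡ true
==-refl m = ==-true {m} refl

==-suc : ∀ m n → (suc m == suc n) ≡ (m == n)
==-suc m n = bool-ext {suc m == suc n} {m == n}
  (λ t → ≡true⇒T (==-true (ℕP.suc-injective (==⇒≡ {suc m} t))))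
  (λ t → ≡true⇒T (==-true (cong suc (==⇒≡ {m} t))))

≤ᵇ⇒≤ : ∀ {m n} → T (m ≤ᵇ n) → m ≤ n
≤ᵇ⇒≤ t = toWitness t

≤ᵇ-true : ∀ {m n} → m ≤ n → (m ≤ᵇ n) ≡ true
≤ᵇ-true {m} {n} p = T⇒≡true (fromWitness {a? = m ℕ.≤? n} p)

≤ᵇ-false : ∀ {m n} → ¬ m ≤ n → (m ≤ᵇ n) ≡ false
≤ᵇ-false ¬p = ¬T⇒≡false (¬p ∘ ≤ᵇ⇒≤)

==ₗ⇒≡ : ∀ {xs ys} → T (xs ==ₗ ys) → xs ≡ ys
==ₗ⇒≡ {[]}     {[]}     _ = refl
==ₗ⇒≡ {x ∷ xs} {y ∷ ys} t with T-∧ {x == y} t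
... | p , q = cong₂ _∷_ (==⇒≡ p) (==ₗ⇒≡ q)

==ₗ-refl : ∀ xs → (xs ==ₗ xs) ≡ true
==ₗ-refl []       = refl
==ₗ-refl (x ∷ xs) = cong₂ _∧_ (==-refl x) (==ₗ-refl xs)

==ₗ-true : ∀ {xs ys} → xs ≡ ys → (xs ==ₗ ys) ≡ true
==ₗ-true {xs} refl = ==ₗ-refl xs

==ₗ-false : ∀ {xs ys} → xs ≢ ys → (xs ==ₗ ys) ≡ false
==ₗ-false ne = ¬T⇒≡false (ne ∘ ==ₗ⇒≡)

==ₗ-sym : ∀ xs ys → (xs ==ₗ ys) ≡ (ys ==ₗ xs)
==ₗ-sym xs ys = bool-ext {xs ==ₗ ys} {ys ==ₗ xs} (λ t → ≡true⇒T (==ₗ-true (sym (==ₗ⇒≡ {xs} t))))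
                                                 (λ t → ≡true⇒T (==ₗ-true (sym (==ₗ⇒≡ {ys} t))))

∑-ind-upTo : ∀ n k (f : ℕ → ℤ) → k < n → ∑ (upTo n) (λ i → ind (k == i) * f i) ≡ f k
∑-ind-upTo (suc n) zero    f lt = begin
  ∑ (upTo (suc n)) (λ i → ind (0 == i) * f i) ≡⟨ ∑-upTo-suc n (λ i → ind (0 == i) * f i) ⟩
  1ℤ * f 0 + ∑ (upTo n) (λ i → 0ℤ * f (suc i)) ≡⟨ cong₂ _+_ (ℤP.*-identityˡ (f 0)) (∑-≡0 (upTo n) (λ _ → refl)) ⟩
  f 0 + 0ℤ ≡⟨ ℤP.+-identityʳ (f 0) ⟩
  f 0 ∎
∑-ind-upTo (suc n) (suc k) f (s≤s lt) = begin
  ∑ (upTo (suc n)) (λ i → ind (suc k == i) * f i) ≡⟨ ∑-upTo-suc n (λ i → ind (suc k == i) * f i) ⟩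
  0ℤ * f 0 + ∑ (upTo n) (λ i → ind (suc k == suc i) * f (suc i)) ≡⟨ ℤP.+-identityˡ _ ⟩
  ∑ (upTo n) (λ i → ind (suc k == suc i) * f (suc i)) ≡⟨ ∑-cong (upTo n) (λ i → cong (λ b → ind b * f (suc i)) (==-suc k i)) ⟩
  ∑ (upTo n) (λ i → ind (k == i) * f (suc i)) ≡⟨ ∑-ind-upTo n k (f ∘ suc) lt ⟩
  f (suc k) ∎

-- Sorting and partitions

insertDesc-comm : ∀ x y l → insertDesc x (insertDesc y l) ≡ insertDesc y (insertDesc x l)
insertDesc-comm x y [] with y ℕ.≤? x | x ℕ.≤? y
... | yes p | yes q = cong₂ (λ a b → a ∷ b ∷ []) (ℕP.≤-antisym q p) (ℕP.≤-antisym p q)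
... | yes p | no  q = refl
... | no  p | yes q = refl
... | no  p | no  q = ⊥-elim (q (ℕP.<⇒≤ (ℕP.≰⇒> p)))
insertDesc-comm x y (z ∷ l) with z ℕ.≤? x in zx | z ℕ.≤? y in zy
... | yes p | yes q with y ℕ.≤? x | x ℕ.≤? y
...   | yes r | yes s = cong₂ (λ a b → a ∷ b ∷ z ∷ l) (ℕP.≤-antisym s r) (ℕP.≤-antisym r s)
...   | yes r | no  s rewrite zy = refl
...   | no  r | yes s rewrite zx = refl
...   | no  r | no  s = ⊥-elim (s (ℕP.<⇒≤ (ℕP.≰⇒> r)))
insertDesc-comm x y (z ∷ l) | yes p | no q with x ℕ.≤? y
... | yes r = ⊥-elim (q (ℕP.≤-trans p r))
... | no  r rewrite zx | zy = refl
insertDesc-comm x y (z ∷ l) | no p | yes q with y ℕ.≤? x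
... | yes r = ⊥-elim (p (ℕP.≤-trans q r))
... | no  r rewrite zx | zy = refl
insertDesc-comm x y (z ∷ l) | no p | no q rewrite zx | zy = cong (z ∷_) (insertDesc-comm x y l)

sortDesc-swap : ∀ x y l → sortDesc (x ∷ y ∷ l) ≡ sortDesc (y ∷ x ∷ l)
sortDesc-swap zero    zero    l = refl
sortDesc-swap zero    (suc y) l = refl
sortDesc-swap (suc x) zero    l = refl
sortDesc-swap (suc x) (suc y) l = insertDesc-comm (suc x) (suc y) (sortDesc l)

sortDesc-prep : ∀ x {l l′} → sortDesc l ≡ sortDesc l′ → sortDesc (x ∷ l) ≡ sortDesc (x ∷ l′)
sortDesc-prep zero    p = p
sortDesc-prep (suc x) p = cong (insertDesc (suc x)) p

sortDesc-↭ : ∀ {l l′} → l ↭ l′ → sortDesc l ≡ sortDesc l′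
sortDesc-↭ Perm.refl         = refl
sortDesc-↭ (prep x p)        = sortDesc-prep x (sortDesc-↭ p)
sortDesc-↭ (swap {xs} x y p) =
  trans (sortDesc-swap x y xs) (sortDesc-prep y (sortDesc-prep x (sortDesc-↭ p)))
sortDesc-↭ (Perm.trans p q)  = trans (sortDesc-↭ p) (sortDesc-↭ q)

insertDesc-↭ : ∀ x l → insertDesc x l ↭ x ∷ l
insertDesc-↭ x []      = ↭-refl
insertDesc-↭ x (y ∷ l) with y ℕ.≤? x
... | yes _ = ↭-refl
... | no  _ = ↭-trans (prep y (insertDesc-↭ x l)) (swap y x ↭-refl)

sortDesc-++ˡ : ∀ l l′ → sortDesc (sortDesc l ++ l′) ≡ sortDesc (l ++ l′)
sortDesc-++ˡ []          l′ = refl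
sortDesc-++ˡ (zero ∷ l)  l′ = sortDesc-++ˡ l l′
sortDesc-++ˡ (suc x ∷ l) l′ = trans
  (sortDesc-↭ (PermP.++⁺ʳ l′ (insertDesc-↭ (suc x) (sortDesc l))))
  (cong (insertDesc (suc x)) (sortDesc-++ˡ l l′))

sortDesc-++ʳ : ∀ l l′ → sortDesc (l ++ sortDesc l′) ≡ sortDesc (l ++ l′)
sortDesc-++ʳ l l′ = trans (sortDesc-↭ (PermP.++-comm l (sortDesc l′)))
  (trans (sortDesc-++ˡ l′ l) (sortDesc-↭ (PermP.++-comm l′ l)))

isPart-tail : ∀ {x} μ → IsPartition (x ∷ μ) → IsPartition μ
isPart-tail []      p = tt
isPart-tail {x} (y ∷ μ) p = proj₂ (T-∧ {y ≤ᵇ x} p)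

isPart-∷ : ∀ {x y} μ → y ≤ x → IsPartition (y ∷ μ) → IsPartition (x ∷ y ∷ μ)
isPart-∷ {x} {y} μ y≤x p = subst (λ b → T (b ∧ isPartB (y ∷ μ))) (sym (≤ᵇ-true y≤x)) p

isPart-head : ∀ {x} μ → IsPartition (x ∷ μ) → 1 ≤ x
isPart-head []          p = ≤ᵇ⇒≤ p
isPart-head {x} (y ∷ μ) p =
  ℕP.≤-trans (isPart-head μ (proj₂ (T-∧ {y ≤ᵇ x} p))) (≤ᵇ⇒≤ (proj₁ (T-∧ {y ≤ᵇ x} p)))

sortDesc-partition : ∀ μ → IsPartition μ → sortDesc μ ≡ μ
sortDesc-partition []              p = refl
sortDesc-partition (zero ∷ μ)      p with () ← isPart-head μ p
sortDesc-partition (suc x ∷ [])    p = refl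
sortDesc-partition (suc x ∷ y ∷ μ) p = begin
  insertDesc (suc x) (sortDesc (y ∷ μ)) ≡⟨ cong (insertDesc (suc x)) (sortDesc-partition (y ∷ μ) (proj₂ q)) ⟩
  insertDesc (suc x) (y ∷ μ) ≡⟨ cong (λ b → if b then suc x ∷ y ∷ μ else y ∷ insertDesc (suc x) μ) (T⇒≡true (proj₁ q)) ⟩
  suc x ∷ y ∷ μ ∎
  where
  q : T (y ≤ᵇ suc x) × IsPartition (y ∷ μ)
  q = T-∧ {y ≤ᵇ suc x} p

insertDesc-isPart : ∀ x l → 1 ≤ x → IsPartition l → IsPartition (insertDesc x l)
insertDesc-isPart x []          x≥1 p = ≡true⇒T (≤ᵇ-true x≥1)
insertDesc-isPart x (y ∷ [])    x≥1 p with y ℕ.≤? x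
... | yes y≤x = isPart-∷ [] y≤x p
... | no  y≰x = isPart-∷ [] (ℕP.<⇒≤ (ℕP.≰⇒> y≰x)) (≡true⇒T (≤ᵇ-true x≥1))
insertDesc-isPart x (y ∷ z ∷ l) x≥1 p
  with y ℕ.≤? x | z ℕ.≤? x | insertDesc-isPart x (z ∷ l) x≥1 (isPart-tail (z ∷ l) p)
... | yes y≤x | _       | _ = isPart-∷ (z ∷ l) y≤x p
... | no  y≰x | yes z≤x | r = isPart-∷ (z ∷ l) (ℕP.<⇒≤ (ℕP.≰⇒> y≰x)) r
... | no  y≰x | no  z≰x | r = isPart-∷ (insertDesc x l) (≤ᵇ⇒≤ (proj₁ (T-∧ {z ≤ᵇ y} p))) r

sortDesc-isPart : ∀ l → IsPartition (sortDesc l)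
sortDesc-isPart []          = tt
sortDesc-isPart (zero ∷ l)  = sortDesc-isPart l
sortDesc-isPart (suc x ∷ l) = insertDesc-isPart (suc x) (sortDesc l) (s≤s z≤n) (sortDesc-isPart l)

size-++ : ∀ l l′ → size (l ++ l′) ≡ size l ℕ.+ size l′
size-++ []      l′ = refl
size-++ (x ∷ l) l′ = trans (cong (x ℕ.+_) (size-++ l l′)) (sym (ℕP.+-assoc x (size l) (size l′)))

size-insertDesc : ∀ x l → size (insertDesc x l) ≡ x ℕ.+ size l
size-insertDesc x []      = refl
size-insertDesc x (y ∷ l) with y ℕ.≤? x
... | yes _ = refl
... | no  _ = trans (cong (y ℕ.+_) (size-insertDesc x l)) (trans (sym (ℕP.+-assoc y x (size l)))
  (trans (cong (ℕ._+ size l) (ℕP.+-comm y x)) (ℕP.+-assoc x y (size l))))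

size-sortDesc : ∀ l → size (sortDesc l) ≡ size l
size-sortDesc []          = refl
size-sortDesc (zero ∷ l)  = size-sortDesc l
size-sortDesc (suc x ∷ l) = trans (size-insertDesc (suc x) (sortDesc l)) (cong (suc x ℕ.+_) (size-sortDesc l))

size-∪ : ∀ ν ρ → size (ν ∪ₚ ρ) ≡ size ν ℕ.+ size ρ
size-∪ ν ρ = trans (size-sortDesc (ν ++ ρ)) (size-++ ν ρ)

-- The enumeration of partitions

isPart-width : ∀ {x} μ → IsPartition (x ∷ μ) → width μ ≤ x
isPart-width []          p = z≤n
isPart-width {x} (y ∷ μ) p = ≤ᵇ⇒≤ (proj₁ (T-∧ {y ≤ᵇ x} p))

isPart-cons : ∀ {x} μ → 1 ≤ x → width μ ≤ x → IsPartition μ → IsPartition (x ∷ μ)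
isPart-cons []      x≥1 le p = ≡true⇒T (≤ᵇ-true x≥1)
isPart-cons (y ∷ μ) x≥1 le p = isPart-∷ μ le p

All-concatMap : ∀ {P : B → Set} (h : A → List B) xs → All (λ x → All P (h x)) xs → All P (concatMap h xs)
All-concatMap h xs ps = AllP.concat⁺ (AllP.map⁺ ps)

parsF-sound : ∀ f n m → All (λ ν → IsPartition ν × size ν ≡ n × width ν ≤ m) (parsF f n m)
parsF-sound f       zero    m = (tt , refl , z≤n) ∷ []
parsF-sound zero    (suc n) m = []
parsF-sound (suc f) (suc n) m = All-concatMap _ (oneTo (suc n ⊓ m)) (AllP.applyUpTo⁺₁ suc (suc n ⊓ m) λ {i} lt →
  AllP.map⁺ (All.map (λ {ν} (p , s , b) →
      isPart-cons ν (s≤s z≤n) b p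
    , trans (cong (suc i ℕ.+_) s) (ℕP.m+[n∸m]≡n (ℕP.≤-trans lt (ℕP.m⊓n≤m (suc n) m)))
    , ℕP.≤-trans lt (ℕP.m⊓n≤n (suc n) m))
    (parsF-sound f (suc n ∸ suc i) (suc i))))

-- This says that `κ` is listed exactly once, in the form needed later: a sum over partitions
-- collapses against an indicator.
parsF-δ : ∀ f n m κ (h : List ℕ → ℤ) → IsPartition κ → size κ ≡ n → width κ ≤ m → n ≤ f →
          ∑ (parsF f n m) (λ ν → ind (κ ==ₗ ν) * h ν) ≡ h κ
parsF-δ f zero m [] h p s b le = ∑-single (h [])
parsF-δ f zero m (x ∷ κ) h p s b le
  with () ← ℕP.≤-trans (isPart-head κ p) (ℕP.≤-trans (ℕP.m≤m+n x (size κ)) (ℕP.≤-reflexive s))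
parsF-δ (suc f) (suc n) m (zero ∷ κ)  h p s b le with () ← isPart-head κ p
parsF-δ (suc f) (suc n) m (suc k ∷ κ) h p s b (s≤s le) = begin
  ∑ (parsF (suc f) (suc n) m) φ
    ≡⟨ ∑-∷ (λ j → parsF f (suc n ∸ j) j) (oneTo (suc n ⊓ m)) φ ⟩
  ∑ (oneTo (suc n ⊓ m)) (λ j → ∑ (parsF f (suc n ∸ j) j) (λ ν → φ (j ∷ ν)))
    ≡⟨ ∑-applyUpTo suc (suc n ⊓ m) _ ⟩
  ∑ (upTo (suc n ⊓ m)) (λ i → ∑ (parsF f (n ∸ i) (suc i)) (λ ν → φ (suc i ∷ ν)))
    ≡⟨ ∑-cong (upTo (suc n ⊓ m)) (λ i → trans (∑-cong (parsF f (n ∸ i) (suc i)) (factor i))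
         (∑-*ˡ (ind (k == i)) (parsF f (n ∸ i) (suc i)) (λ ν → ind (κ ==ₗ ν) * h (suc i ∷ ν)))) ⟩
  ∑ (upTo (suc n ⊓ m)) (λ i → ind (k == i) * ∑ (parsF f (n ∸ i) (suc i)) (λ ν → ind (κ ==ₗ ν) * h (suc i ∷ ν)))
    ≡⟨ ∑-ind-upTo (suc n ⊓ m) k _ (ℕP.⊓-glb k<n b) ⟩
  ∑ (parsF f (n ∸ k) (suc k)) (λ ν → ind (κ ==ₗ ν) * h (suc k ∷ ν))
    ≡⟨ parsF-δ f (n ∸ k) (suc k) κ (λ ν → h (suc k ∷ ν)) (isPart-tail κ p) s′ (isPart-width κ p)
         (ℕP.≤-trans (ℕP.m∸n≤m n k) le) ⟩
  h (suc k ∷ κ) ∎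
  where
  φ : List ℕ → ℤ
  φ ν = ind ((suc k ∷ κ) ==ₗ ν) * h ν
  factor : ∀ i ν → φ (suc i ∷ ν) ≡ ind (k == i) * (ind (κ ==ₗ ν) * h (suc i ∷ ν))
  factor i ν = begin
    ind ((suc k == suc i) ∧ (κ ==ₗ ν)) * h (suc i ∷ ν) ≡⟨ cong (λ b → ind (b ∧ (κ ==ₗ ν)) * h (suc i ∷ ν)) (==-suc k i) ⟩
    ind ((k == i) ∧ (κ ==ₗ ν)) * h (suc i ∷ ν) ≡⟨ cong (_* h (suc i ∷ ν)) (ind-∧ (k == i) (κ ==ₗ ν)) ⟩
    ind (k == i) * ind (κ ==ₗ ν) * h (suc i ∷ ν) ≡⟨ ℤP.*-assoc (ind (k == i)) _ _ ⟩
    ind (k == i) * (ind (κ ==ₗ ν) * h (suc i ∷ ν)) ∎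
  k<n : suc k ≤ suc n
  k<n = ℕP.≤-trans (ℕP.m≤m+n (suc k) (size κ)) (ℕP.≤-reflexive s)
  s′ : size κ ≡ n ∸ k
  s′ = trans (sym (ℕP.m+n∸m≡n k (size κ))) (cong (_∸ k) (ℕP.suc-injective s))

parsOf-δ : ∀ n κ (h : List ℕ → ℤ) → IsPartition κ →
           ∑ (parsOf n) (λ ν → ind (κ ==ₗ ν) * h ν) ≡ ind (size κ == n) * h κ
parsOf-δ n κ h p with size κ ℕ.≟ n
... | yes s = trans (parsF-δ n n n κ h p s (ℕP.≤-trans (max≤size κ) (ℕP.≤-reflexive s)) ℕP.≤-refl)
                    (sym (ℤP.*-identityˡ (h κ)))
  where
  max≤size : ∀ κ → width κ ≤ size κ
  max≤size []      = z≤n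
  max≤size (x ∷ κ) = ℕP.m≤m+n x (size κ)
... | no ¬s = ∑-≡0ᴬ (All.map (λ {ν} (_ , s , _) →
                cong (λ b → ind b * h ν) (==ₗ-false {κ} {ν} (λ κ≡ν → ¬s (trans (cong size κ≡ν) s))))
                (parsF-sound n n n))

parsUpTo-sound : ∀ b → All IsPartition (parsUpTo b)
parsUpTo-sound b = All-concatMap parsOf (upTo (suc b))
  (All.universal (λ n → All.map proj₁ (parsF-sound n n n)) (upTo (suc b)))

-- A `κ` larger than `b` is not listed and the sum is 0; the last hypothesis makes `h κ` agree with
-- that.
parsUpTo-δ : ∀ b κ (h : List ℕ → ℤ) → IsPartition κ → (b < size κ → h κ ≡ 0ℤ) →
             ∑ (parsUpTo b) (λ ν → ind (κ ==ₗ ν) * h ν) ≡ h κ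
parsUpTo-δ b κ h p v = begin
  ∑ (parsUpTo b) (λ ν → ind (κ ==ₗ ν) * h ν) ≡⟨ ∑-concatMap parsOf (upTo (suc b)) (λ ν → ind (κ ==ₗ ν) * h ν) ⟩
  ∑ (upTo (suc b)) (λ n → ∑ (parsOf n) (λ ν → ind (κ ==ₗ ν) * h ν))
    ≡⟨ ∑-cong (upTo (suc b)) (λ n → parsOf-δ n κ h p) ⟩
  ∑ (upTo (suc b)) (λ n → ind (size κ == n) * h κ) ≡⟨ last (size κ ℕ.≤? b) ⟩
  h κ ∎
  where
  last : Dec (size κ ≤ b) → ∑ (upTo (suc b)) (λ n → ind (size κ == n) * h κ) ≡ h κ
  last (yes s≤b) = ∑-ind-upTo (suc b) (size κ) (λ _ → h κ) (s≤s s≤b)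
  last (no  s≰b) = trans (∑-≡0 (upTo (suc b)) (λ n → trans (cong (ind (size κ == n) *_) hκ≡0) (ℤP.*-zeroʳ (ind (size κ == n))))) (sym hκ≡0)
    where
    hκ≡0 : h κ ≡ 0ℤ
    hκ≡0 = v (ℕP.≰⇒> s≰b)

-- Compositions

compsF : ℕ → ℕ → List (List ℕ)
compsF f       zero    = [] ∷ []
compsF zero    (suc n) = []
compsF (suc f) (suc n) = concatMap (λ i → map (suc i ∷_) (compsF f (n ∸ i))) (upTo (suc n))

comps : ℕ → List (List ℕ)
comps n = compsF n n

compsF-irr : ∀ f g n → n ≤ f → n ≤ g → compsF f n ≡ compsF g n
compsF-irr f       g       zero    p       q       = refl
compsF-irr (suc f) (suc g) (suc n) (s≤s p) (s≤s q) = LP.concatMap-cong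
  (λ i → cong (map (suc i ∷_)) (compsF-irr f g (n ∸ i) (ℕP.≤-trans (ℕP.m∸n≤m n i) p) (ℕP.≤-trans (ℕP.m∸n≤m n i) q)))
  (upTo (suc n))

∑-comps-suc : ∀ n (φ : List ℕ → ℤ) →
  ∑ (comps (suc n)) φ ≡ ∑ (upTo (suc n)) (λ i → ∑ (comps (n ∸ i)) (λ α → φ (suc i ∷ α)))
∑-comps-suc n φ = trans (∑-concatMap (λ i → map (suc i ∷_) (compsF n (n ∸ i))) (upTo (suc n)) φ) (∑-cong (upTo (suc n)) λ i →
  trans (∑-map (suc i ∷_) (compsF n (n ∸ i)) φ)
        (cong (λ l → ∑ l (λ α → φ (suc i ∷ α))) (compsF-irr n (n ∸ i) (n ∸ i) (ℕP.m∸n≤m n i) ℕP.≤-refl)))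

refinements : List ℕ → List (List ℕ)
refinements []      = [] ∷ []
refinements (b ∷ β) = concatMap (λ α → map (α ++_) (refinements β)) (comps b)

∑-refinements-∷ : ∀ b β (φ : List ℕ → ℤ) →
  ∑ (refinements (b ∷ β)) φ ≡ ∑ (comps b) (λ α → ∑ (refinements β) (λ α′ → φ (α ++ α′)))
∑-refinements-∷ b β φ = trans (∑-concatMap _ (comps b) φ)
  (∑-cong (comps b) (λ α → ∑-map (α ++_) (refinements β) φ))

Symmetric : (List ℕ → ℤ) → Set
Symmetric φ = ∀ {l l′} → l ↭ l′ → φ l ≡ φ l′

++-Symmetric : ∀ {φ} α → Symmetric φ → Symmetric (λ l → φ (α ++ l))
++-Symmetric α inv p = inv (PermP.++⁺ˡ α p)

∑-refinements-swap : ∀ x y β φ → Symmetric φ →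
  ∑ (refinements (x ∷ y ∷ β)) φ ≡ ∑ (refinements (y ∷ x ∷ β)) φ
∑-refinements-swap x y β φ inv = begin
  ∑ (refinements (x ∷ y ∷ β)) φ ≡⟨ expand x y ⟩
  ∑ (comps x) (λ α₁ → ∑ (comps y) (λ α₂ → ∑ (refinements β) (λ α₃ → φ (α₁ ++ α₂ ++ α₃))))
    ≡⟨ ∑-swap (comps x) (comps y) _ ⟩
  ∑ (comps y) (λ α₂ → ∑ (comps x) (λ α₁ → ∑ (refinements β) (λ α₃ → φ (α₁ ++ α₂ ++ α₃))))
    ≡⟨ ∑-cong (comps y) (λ α₂ → ∑-cong (comps x) (λ α₁ → ∑-cong (refinements β) (λ α₃ →
         inv (PermP.shifts α₁ α₂)))) ⟩
  ∑ (comps y) (λ α₂ → ∑ (comps x) (λ α₁ → ∑ (refinements β) (λ α₃ → φ (α₂ ++ α₁ ++ α₃))))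
    ≡⟨ sym (expand y x) ⟩
  ∑ (refinements (y ∷ x ∷ β)) φ ∎
  where
  expand : ∀ x y → ∑ (refinements (x ∷ y ∷ β)) φ ≡
    ∑ (comps x) (λ α₁ → ∑ (comps y) (λ α₂ → ∑ (refinements β) (λ α₃ → φ (α₁ ++ α₂ ++ α₃))))
  expand x y = trans (∑-refinements-∷ x (y ∷ β) φ)
    (∑-cong (comps x) (λ α₁ → ∑-refinements-∷ y β (λ l → φ (α₁ ++ l))))

∑-refinements-prep : ∀ x β β′ →
  (∀ φ → Symmetric φ → ∑ (refinements β) φ ≡ ∑ (refinements β′) φ) →
  ∀ φ → Symmetric φ → ∑ (refinements (x ∷ β)) φ ≡ ∑ (refinements (x ∷ β′)) φ
∑-refinements-prep x β β′ h φ inv = trans (∑-refinements-∷ x β φ) (trans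
  (∑-cong (comps x) (λ α → h (λ l → φ (α ++ l)) (++-Symmetric α inv)))
  (sym (∑-refinements-∷ x β′ φ)))

∑-refinements-insertDesc : ∀ x β φ → Symmetric φ →
  ∑ (refinements (insertDesc x β)) φ ≡ ∑ (refinements (x ∷ β)) φ
∑-refinements-insertDesc x []      φ inv = refl
∑-refinements-insertDesc x (y ∷ β) φ inv with y ℕ.≤? x
... | yes _ = refl
... | no  _ = trans
  (∑-refinements-prep y (insertDesc x β) (x ∷ β) (∑-refinements-insertDesc x β) φ inv)
  (∑-refinements-swap y x β φ inv)

-- Sorting `β` permutes the blocks of a refinement, which a symmetric `φ` does not notice, and a
-- part 0 contributes only the empty block.
∑-refinements-sortDesc : ∀ β φ → Symmetric φ →
  ∑ (refinements (sortDesc β)) φ ≡ ∑ (refinements β) φ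
∑-refinements-sortDesc []          φ inv = refl
∑-refinements-sortDesc (zero ∷ β)  φ inv = trans (∑-refinements-sortDesc β φ inv)
  (sym (trans (∑-refinements-∷ 0 β φ) (ℤP.+-identityʳ (∑ (refinements β) φ))))
∑-refinements-sortDesc (suc x ∷ β) φ inv = trans (∑-refinements-insertDesc (suc x) (sortDesc β) φ inv)
  (∑-refinements-prep (suc x) (sortDesc β) β (∑-refinements-sortDesc β) φ inv)

sign : List A → ℤ
sign l = sgn (length l)

sign-++ : ∀ (l l′ : List A) → sign (l ++ l′) ≡ sign l * sign l′
sign-++ []      l′ = sym (ℤP.*-identityˡ (sign l′))
sign-++ (x ∷ l) l′ = trans (cong -_ (sign-++ l l′)) (ℤP.neg-distribˡ-* (sign l) (sign l′))

sgn-Symmetric : ∀ {φ} → Symmetric φ → Symmetric (λ α → sign α * φ α)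
sgn-Symmetric inv p = cong₂ _*_ (cong sgn (PermP.↭-length p)) (inv p)

-- The sign-reversing cancellation behind the antipode: in the first nonzero
-- position b, either nothing is split off (i = 0) and α starts with suc i, or
-- suc i is split off.
∑-boxes-cancel : ∀ b β (F : List ℕ → ℤ) → Symmetric F → (∀ l → F (0 ∷ l) ≡ F l) →
  ∑ (boxes (suc b ∷ β)) (λ γ → ∑ (refinements ((suc b ∷ β) -ᵥ γ)) (λ α → sign α * F (γ ++ α))) ≡ 0ℤ
∑-boxes-cancel b β F inv F0 = begin
  ∑ (boxes (suc b ∷ β)) (λ γ → ∑ (refinements ((suc b ∷ β) -ᵥ γ)) (λ α → sign α * F (γ ++ α)))
    ≡⟨ ∑-boxes-∷ (suc b) β _ ⟩
  ∑ (upTo (suc (suc b))) (λ i → ∑ (boxes β) (λ γ → ∑ (refinements ((suc b ∸ i) ∷ (β -ᵥ γ))) (λ α → sign α * F (i ∷ γ ++ α))))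
    ≡⟨ ∑-cong (upTo (suc (suc b))) collect ⟩
  ∑ (upTo (suc (suc b))) (λ i → ∑ (comps (suc b ∸ i)) (λ α → sign α * H (i ∷ α)))
    ≡⟨ ∑-upTo-suc (suc b) (λ i → ∑ (comps (suc b ∸ i)) (λ α → sign α * H (i ∷ α))) ⟩
  ∑ (comps (suc b)) (λ α → sign α * H (0 ∷ α)) + X
    ≡⟨ cong (_+ X) (∑-cong (comps (suc b)) (λ α → cong (sign α *_) (H0 α))) ⟩
  ∑ (comps (suc b)) (λ α → sign α * H α) + X
    ≡⟨ cong (_+ X) (∑-comps-suc b (λ α → sign α * H α)) ⟩
  ∑ (upTo (suc b)) (λ i → ∑ (comps (b ∸ i)) (λ α → - sign α * H (suc i ∷ α))) + X
    ≡⟨ cong (_+ X) (∑-cong (upTo (suc b)) (λ i → trans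
         (∑-cong (comps (b ∸ i)) (λ α → sym (ℤP.neg-distribˡ-* (sign α) (H (suc i ∷ α)))))
         (∑-neg (comps (b ∸ i)) (λ α → sign α * H (suc i ∷ α))))) ⟩
  ∑ (upTo (suc b)) (λ i → - x i) + X
    ≡⟨ cong (_+ X) (∑-neg (upTo (suc b)) x) ⟩
  - X + X ≡⟨ ℤP.+-inverseˡ X ⟩
  0ℤ ∎
  where
  H : List ℕ → ℤ
  H l = ∑ (boxes β) (λ γ → ∑ (refinements (β -ᵥ γ)) (λ α → sign α * F (l ++ γ ++ α)))
  h : ℕ → List ℕ → List ℕ → ℤ
  h i γ α₁ = ∑ (refinements (β -ᵥ γ)) (λ α₂ → sign α₂ * F (i ∷ α₁ ++ γ ++ α₂))
  x : ℕ → ℤ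
  x i = ∑ (comps (b ∸ i)) (λ α → sign α * H (suc i ∷ α))
  X : ℤ
  X = ∑ (upTo (suc b)) x
  H0 : ∀ l → H (0 ∷ l) ≡ H l
  H0 l = ∑-cong (boxes β) (λ γ → ∑-cong (refinements (β -ᵥ γ)) (λ α → cong (sign α *_) (F0 (l ++ γ ++ α))))
  term : ∀ i γ α₁ α₂ → sign (α₁ ++ α₂) * F (i ∷ γ ++ α₁ ++ α₂) ≡
         sign α₁ * (sign α₂ * F (i ∷ α₁ ++ γ ++ α₂))
  term i γ α₁ α₂ = trans (cong₂ _*_ (sign-++ α₁ α₂) (inv (prep i (PermP.shifts γ α₁))))
    (ℤP.*-assoc (sign α₁) (sign α₂) (F (i ∷ α₁ ++ γ ++ α₂)))
  collect : ∀ i → ∑ (boxes β) (λ γ → ∑ (refinements ((suc b ∸ i) ∷ (β -ᵥ γ))) (λ α → sign α * F (i ∷ γ ++ α))) ≡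
            ∑ (comps (suc b ∸ i)) (λ α → sign α * H (i ∷ α))
  collect i = begin
    ∑ (boxes β) (λ γ → ∑ (refinements ((suc b ∸ i) ∷ (β -ᵥ γ))) (λ α → sign α * F (i ∷ γ ++ α)))
      ≡⟨ ∑-cong (boxes β) (λ γ → trans
           (∑-refinements-∷ (suc b ∸ i) (β -ᵥ γ) (λ α → sign α * F (i ∷ γ ++ α)))
           (∑-cong (comps (suc b ∸ i)) (λ α₁ → trans
             (∑-cong (refinements (β -ᵥ γ)) (term i γ α₁))
             (∑-*ˡ (sign α₁) (refinements (β -ᵥ γ)) (λ α₂ → sign α₂ * F (i ∷ α₁ ++ γ ++ α₂)))))) ⟩
    ∑ (boxes β) (λ γ → ∑ (comps (suc b ∸ i)) (λ α₁ → sign α₁ * h i γ α₁))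
      ≡⟨ ∑-swap (boxes β) (comps (suc b ∸ i)) (λ γ α₁ → sign α₁ * h i γ α₁) ⟩
    ∑ (comps (suc b ∸ i)) (λ α₁ → ∑ (boxes β) (λ γ → sign α₁ * h i γ α₁))
      ≡⟨ ∑-cong (comps (suc b ∸ i)) (λ α₁ → ∑-*ˡ (sign α₁) (boxes β) (λ γ → h i γ α₁)) ⟩
    ∑ (comps (suc b ∸ i)) (λ α → sign α * H (i ∷ α)) ∎

-- Coefficients of the basic elements of Λ

trunc-≡ : ∀ b c μ → (b < size μ → c μ ≡ 0ℤ) → trunc b c μ ≡ c μ
trunc-≡ b c μ v with size μ ℕ.≤? b
... | yes _ = refl
... | no ¬p = sym (v (ℕP.≰⇒> ¬p))

trunc-≤ : ∀ b c μ → size μ ≤ b → trunc b c μ ≡ c μ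
trunc-≤ b c μ s≤b = trunc-≡ b c μ (λ b<s → ⊥-elim (ℕP.<⇒≱ b<s s≤b))

mono-coeff : ∀ ν μ → coeff (mono ν) μ ≡ ind (μ ==ₗ ν)
mono-coeff ν μ = trunc-≡ (size ν) (λ μ → ind (μ ==ₗ ν)) μ
  (λ lt → cong ind (==ₗ-false {μ} {ν} (λ μ≡ν → ℕP.<⇒≢ lt (cong size (sym μ≡ν)))))

+Λ-coeff : ∀ f g μ → coeff (f +Λ g) μ ≡ coeff f μ + coeff g μ
+Λ-coeff f g μ = trunc-≡ (bound f ⊔ bound g) _ μ (λ lt → cong₂ _+_
  (vanish f μ (ℕP.≤-<-trans (ℕP.m≤m⊔n (bound f) (bound g)) lt))
  (vanish g μ (ℕP.≤-<-trans (ℕP.m≤n⊔m (bound f) (bound g)) lt)))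

scale-coeff : ∀ c f μ → coeff (scale c f) μ ≡ c * coeff f μ
scale-coeff c f μ = trunc-≡ (bound f) _ μ (λ lt → trans (cong (c *_) (vanish f μ lt)) (ℤP.*-zeroʳ c))

-- The antipode in the monomial basis

-- The antipode of quasisymmetric functions sends M_α to (-1)^ℓ(α) times the sum of M_β over all
-- coarsenings β of the reversal of α. Summed over the rearrangements α of `ρ` this gives the image
-- of m_ρ, and the reversal disappears.
antipodeMono : List ℕ → List ℕ → ℤ
antipodeMono ρ β = ∑ (refinements β) (λ α → sign α * ind (sortDesc α ==ₗ ρ))

-- An arbitrary family `s ρ` takes the place of the images of the m_ρ, so that a given antipode and
-- `antipodeMono` can be compared through one and the same recursion.
convolve : Λ → (List ℕ → List ℕ → ℤ) → List ℕ → ℤ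
convolve f s β = ∑ (parsUpTo (bound f)) (λ ν → ∑ (parsUpTo (bound f)) (λ ρ →
  coeff f (ν ∪ₚ ρ) * mulCoeff (coeff (mono ν)) (s ρ) β))

convidS-convolve : ∀ S f β → convidS S f β ≡ convolve f (λ ρ → coeff (S (mono ρ))) β
convidS-convolve S f β = sumℤ-concatMap
  (λ ν ρ → coeff f (ν ∪ₚ ρ) * mulCoeff (coeff (mono ν)) (coeff (S (mono ρ))) β) (parsUpTo (bound f)) (parsUpTo (bound f))

vanish-sum : ∀ f κ α → bound f < size κ → coeff f (κ ∪ₚ α) ≡ 0ℤ
vanish-sum f κ α lt = vanish f (κ ∪ₚ α) (ℕP.<-≤-trans lt
  (ℕP.≤-trans (ℕP.m≤m+n (size κ) (size α)) (ℕP.≤-reflexive (sym (size-∪ κ α)))))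

∑-antipodeMono : ∀ f κ β →
  ∑ (parsUpTo (bound f)) (λ ρ → coeff f (κ ∪ₚ ρ) * antipodeMono ρ β) ≡
  ∑ (refinements β) (λ α → sign α * coeff f (sortDesc (κ ++ α)))
∑-antipodeMono f κ β = begin
  ∑ P (λ ρ → coeff f (κ ∪ₚ ρ) * antipodeMono ρ β) ≡⟨ ∑-cong P (λ ρ → ℤP.*-comm (coeff f (κ ∪ₚ ρ)) (antipodeMono ρ β)) ⟩
  ∑ P (λ ρ → ∑ R (λ α → sign α * ind (sortDesc α ==ₗ ρ)) * coeff f (κ ∪ₚ ρ))
    ≡⟨ ∑-pull R P (λ α → sign α) (λ α ρ → ind (sortDesc α ==ₗ ρ)) (λ ρ → coeff f (κ ∪ₚ ρ)) ⟩
  ∑ R (λ α → sign α * ∑ P (λ ρ → ind (sortDesc α ==ₗ ρ) * coeff f (κ ∪ₚ ρ)))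
    ≡⟨ ∑-cong R (λ α → cong (sign α *_) (trans
         (parsUpTo-δ (bound f) (sortDesc α) (λ ρ → coeff f (κ ∪ₚ ρ)) (sortDesc-isPart α) (v α))
         (cong (coeff f) (sortDesc-++ʳ κ α)))) ⟩
  ∑ R (λ α → sign α * coeff f (sortDesc (κ ++ α))) ∎
  where
  P R : List (List ℕ)
  P = parsUpTo (bound f)
  R = refinements β
  v : ∀ α → bound f < size (sortDesc α) → coeff f (κ ∪ₚ sortDesc α) ≡ 0ℤ
  v α lt = trans (cong (coeff f) (sortDesc-↭ (PermP.++-comm κ (sortDesc α)))) (vanish-sum f (sortDesc α) κ lt)

-- The indicators leave only ν = `sortDesc γ` and ρ = `sortDesc α`, and `∪ₚ` forgets the inner
-- sorting. What remains is a signed sum of one symmetric function of `γ ++ α`, the form to which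
-- `∑-boxes-cancel` applies.
convolve-antipodeMono-∑ : ∀ f β → convolve f antipodeMono β ≡
  ∑ (boxes β) (λ γ → ∑ (refinements (β -ᵥ γ)) (λ α → sign α * coeff f (sortDesc (γ ++ α))))
convolve-antipodeMono-∑ f β = begin
  ∑ P (λ ν → ∑ P (λ ρ → coeff f (ν ∪ₚ ρ) * ∑ Γ (λ γ → coeff (mono ν) (sortDesc γ) * a ρ γ)))
    ≡⟨ ∑-cong P (λ ν → trans
         (∑-cong P (λ ρ → ℤP.*-comm (coeff f (ν ∪ₚ ρ)) (∑ Γ (λ γ → coeff (mono ν) (sortDesc γ) * a ρ γ))))
         (∑-pull Γ P (λ γ → coeff (mono ν) (sortDesc γ)) (λ γ ρ → a ρ γ) (λ ρ → coeff f (ν ∪ₚ ρ)))) ⟩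
  ∑ P (λ ν → ∑ Γ (λ γ → coeff (mono ν) (sortDesc γ) * ∑ P (λ ρ → a ρ γ * coeff f (ν ∪ₚ ρ))))
    ≡⟨ ∑-cong P (λ ν → ∑-cong Γ (λ γ → cong₂ _*_ (mono-coeff ν (sortDesc γ))
         (∑-cong P (λ ρ → ℤP.*-comm (a ρ γ) (coeff f (ν ∪ₚ ρ)))))) ⟩
  ∑ P (λ ν → ∑ Γ (λ γ → ind (sortDesc γ ==ₗ ν) * inner ν γ))
    ≡⟨ ∑-swap P Γ (λ ν γ → ind (sortDesc γ ==ₗ ν) * inner ν γ) ⟩
  ∑ Γ (λ γ → ∑ P (λ ν → ind (sortDesc γ ==ₗ ν) * inner ν γ))
    ≡⟨ ∑-cong Γ (λ γ → parsUpTo-δ (bound f) (sortDesc γ) (λ ν → inner ν γ) (sortDesc-isPart γ) (v γ)) ⟩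
  ∑ Γ (λ γ → inner (sortDesc γ) γ)
    ≡⟨ ∑-cong Γ (λ γ → ∑-antipodeMono f (sortDesc γ) (sortDesc (β -ᵥ γ))) ⟩
  ∑ Γ (λ γ → ∑ (refinements (sortDesc (β -ᵥ γ))) (λ α → sign α * coeff f (sortDesc (sortDesc γ ++ α))))
    ≡⟨ ∑-cong Γ (λ γ → ∑-cong (refinements (sortDesc (β -ᵥ γ))) (λ α →
         cong (λ l → sign α * coeff f l) (sortDesc-++ˡ γ α))) ⟩
  ∑ Γ (λ γ → ∑ (refinements (sortDesc (β -ᵥ γ))) (λ α → sign α * coeff f (sortDesc (γ ++ α))))
    ≡⟨ ∑-cong Γ (λ γ → ∑-refinements-sortDesc (β -ᵥ γ) (λ α → sign α * coeff f (sortDesc (γ ++ α)))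
         (sgn-Symmetric (λ p → cong (coeff f) (sortDesc-↭ (PermP.++⁺ˡ γ p))))) ⟩
  ∑ Γ (λ γ → ∑ (refinements (β -ᵥ γ)) (λ α → sign α * coeff f (sortDesc (γ ++ α)))) ∎
  where
  P Γ : List (List ℕ)
  P = parsUpTo (bound f)
  Γ = boxes β
  a : List ℕ → List ℕ → ℤ
  a ρ γ = antipodeMono ρ (sortDesc (β -ᵥ γ))
  inner : List ℕ → List ℕ → ℤ
  inner ν γ = ∑ P (λ ρ → coeff f (ν ∪ₚ ρ) * a ρ γ)
  v : ∀ γ → bound f < size (sortDesc γ) → inner (sortDesc γ) γ ≡ 0ℤ
  v γ lt = ∑-≡0 P (λ ρ → cong (_* a ρ γ) (vanish-sum f (sortDesc γ) ρ lt))

convolve-antipodeMono : ∀ f β → IsPartition β → convolve f antipodeMono β ≡ coeff (scalar1 (ε f)) β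
convolve-antipodeMono f []          p = trans (convolve-antipodeMono-∑ f []) (single (coeff f []))
  where
  single : ∀ c → (1ℤ * c + 0ℤ) + 0ℤ ≡ c
  single = solve-∀
convolve-antipodeMono f (zero ∷ β)  p with () ← isPart-head β p
convolve-antipodeMono f (suc b ∷ β) p = trans (convolve-antipodeMono-∑ f (suc b ∷ β))
  (∑-boxes-cancel b β (λ l → coeff f (sortDesc l)) (λ q → cong (coeff f) (sortDesc-↭ q)) (λ l → refl))

mulCoeff-mono-[] : ∀ d β → IsPartition β → mulCoeff (coeff (mono [])) d β ≡ d β
mulCoeff-mono-[] d β p = begin
  ∑ (boxes β) (λ γ → coeff (mono []) (sortDesc γ) * d (sortDesc (β -ᵥ γ)))
    ≡⟨ ∑-cong (boxes β) (λ γ → cong (_* d (sortDesc (β -ᵥ γ))) (mono-coeff [] (sortDesc γ))) ⟩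
  ∑ (boxes β) (λ γ → ind (sortDesc γ ==ₗ []) * d (sortDesc (β -ᵥ γ)))
    ≡⟨ concentrated β (λ l → d (sortDesc l)) ⟩
  d (sortDesc β) ≡⟨ cong d (sortDesc-partition β p) ⟩
  d β ∎
  where
  insertDesc-≢[] : ∀ x l → (insertDesc x l ==ₗ []) ≡ false
  insertDesc-≢[] x []      = refl
  insertDesc-≢[] x (y ∷ l) with y ℕ.≤? x
  ... | yes _ = refl
  ... | no  _ = refl
  concentrated : ∀ β (h : List ℕ → ℤ) → ∑ (boxes β) (λ γ → ind (sortDesc γ ==ₗ []) * h (β -ᵥ γ)) ≡ h β
  concentrated []      h = ∑-single (h [])
  concentrated (b ∷ β) h = begin
    ∑ (boxes (b ∷ β)) (λ γ → ind (sortDesc γ ==ₗ []) * h ((b ∷ β) -ᵥ γ))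
      ≡⟨ ∑-boxes-∷ b β (λ γ → ind (sortDesc γ ==ₗ []) * h ((b ∷ β) -ᵥ γ)) ⟩
    ∑ (upTo (suc b)) term ≡⟨ ∑-upTo-suc b term ⟩
    term 0 + ∑ (upTo b) (λ i → term (suc i))
      ≡⟨ cong₂ _+_ (concentrated β (λ l → h (b ∷ l))) (∑-≡0 (upTo b) (λ i → ∑-≡0 (boxes β) (λ γ →
           cong (λ z → ind z * h ((b ∸ suc i) ∷ (β -ᵥ γ))) (insertDesc-≢[] (suc i) (sortDesc γ))))) ⟩
    h (b ∷ β) + 0ℤ ≡⟨ ℤP.+-identityʳ (h (b ∷ β)) ⟩
    h (b ∷ β) ∎
    where
    term : ℕ → ℤ
    term i = ∑ (boxes β) (λ γ → ind (sortDesc (i ∷ γ) ==ₗ []) * h ((b ∸ i) ∷ (β -ᵥ γ)))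

-- Only the term ν = [] involves s in the degree of τ.
module ConvolveMono (τ : List ℕ) (pτ : IsPartition τ) (β : List ℕ) (pβ : IsPartition β) where

  private
    P : List (List ℕ)
    P = parsUpTo (size τ)

    term : (List ℕ → List ℕ → ℤ) → List ℕ → List ℕ → ℤ
    term s ν ρ = coeff (mono τ) (ν ∪ₚ ρ) * mulCoeff (coeff (mono ν)) (s ρ) β

  lowerPart : (List ℕ → List ℕ → ℤ) → ℤ
  lowerPart s = ∑ P (λ ν → ind (not ([] ==ₗ ν)) * ∑ P (term s ν))

  convolve-mono : ∀ s → convolve (mono τ) s β ≡ s τ β + lowerPart s
  convolve-mono s = begin
    ∑ P (λ ν → ∑ P (term s ν)) ≡⟨ ∑-cong P (λ ν → split ([] ==ₗ ν) (∑ P (term s ν))) ⟩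
    ∑ P (λ ν → ind ([] ==ₗ ν) * ∑ P (term s ν) + ind (not ([] ==ₗ ν)) * ∑ P (term s ν))
      ≡⟨ ∑-+ P (λ ν → ind ([] ==ₗ ν) * ∑ P (term s ν)) (λ ν → ind (not ([] ==ₗ ν)) * ∑ P (term s ν)) ⟩
    ∑ P (λ ν → ind ([] ==ₗ ν) * ∑ P (term s ν)) + lowerPart s
      ≡⟨ cong (_+ lowerPart s) (parsUpTo-δ (size τ) [] (λ ν → ∑ P (term s ν)) tt (λ ())) ⟩
    ∑ P (term s []) + lowerPart s
      ≡⟨ cong (_+ lowerPart s) (∑-congᴬ (All.map (λ {ρ} → diagonal ρ) (parsUpTo-sound (size τ)))) ⟩
    ∑ P (λ ρ → ind (τ ==ₗ ρ) * s ρ β) + lowerPart s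
      ≡⟨ cong (_+ lowerPart s) (parsUpTo-δ (size τ) τ (λ ρ → s ρ β) pτ (λ lt → ⊥-elim (ℕP.<-irrefl refl lt))) ⟩
    s τ β + lowerPart s ∎
    where
    split : ∀ b z → z ≡ ind b * z + ind (not b) * z
    split true  z = sym (trans (ℤP.+-identityʳ (1ℤ * z)) (ℤP.*-identityˡ z))
    split false z = sym (trans (ℤP.+-identityˡ (1ℤ * z)) (ℤP.*-identityˡ z))
    diagonal : ∀ ρ → IsPartition ρ → term s [] ρ ≡ ind (τ ==ₗ ρ) * s ρ β
    diagonal ρ pρ = cong₂ _*_
      (trans (mono-coeff τ (sortDesc ρ)) (cong ind (trans (cong (_==ₗ τ) (sortDesc-partition ρ pρ)) (==ₗ-sym ρ τ))))
      (mulCoeff-mono-[] (s ρ) β pβ)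

  -- A nonzero coefficient of `mono τ` at `ν ∪ₚ ρ` forces |ν| + |ρ| = |τ|, and a nonempty partition
  -- ν has positive size.
  lowerPart-cong : ∀ s t → (∀ ρ → IsPartition ρ → size ρ < size τ → ∀ α → IsPartition α → s ρ α ≡ t ρ α) →
    lowerPart s ≡ lowerPart t
  lowerPart-cong s t h = ∑-congᴬ (All.map (λ {ν} → each ν) (parsUpTo-sound (size τ)))
    where
    each : ∀ ν → IsPartition ν → ind (not ([] ==ₗ ν)) * ∑ P (term s ν) ≡ ind (not ([] ==ₗ ν)) * ∑ P (term t ν)
    each []      p = refl
    each (x ∷ ν) p = cong (1ℤ *_) (∑-congᴬ (All.map (λ {ρ} → inner ρ) (parsUpTo-sound (size τ))))
      where
      inner : ∀ ρ → IsPartition ρ → term s (x ∷ ν) ρ ≡ term t (x ∷ ν) ρ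
      inner ρ pρ with LP.≡-dec ℕ._≟_ ((x ∷ ν) ∪ₚ ρ) τ
      ... | no  ≢τ = trans (cong (_* mulCoeff (coeff (mono (x ∷ ν))) (s ρ) β) zero-coeff)
                       (sym (cong (_* mulCoeff (coeff (mono (x ∷ ν))) (t ρ) β) zero-coeff))
        where
        zero-coeff : coeff (mono τ) ((x ∷ ν) ∪ₚ ρ) ≡ 0ℤ
        zero-coeff = trans (mono-coeff τ ((x ∷ ν) ∪ₚ ρ)) (cong ind (==ₗ-false ≢τ))
      ... | yes ≡τ = cong (coeff (mono τ) ((x ∷ ν) ∪ₚ ρ) *_) (∑-cong (boxes β) (λ γ →
                       cong (coeff (mono (x ∷ ν)) (sortDesc γ) *_) (h ρ pρ smaller (sortDesc (β -ᵥ γ)) (sortDesc-isPart (β -ᵥ γ)))))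
        where
        smaller : size ρ < size τ
        smaller = ℕP.≤-trans (ℕP.+-monoˡ-≤ (size ρ) (ℕP.≤-trans (isPart-head ν p) (ℕP.m≤m+n x (size ν))))
          (ℕP.≤-reflexive (trans (sym (size-∪ (x ∷ ν) ρ)) (cong size ≡τ)))

module Antipode (S : Λ → Λ) (isAntipode : IsAntipode S) where
  open IsAntipode isAntipode

  -- `S` and `antipodeMono` satisfy the same convolution equation at m_τ, and it expresses the value
  -- at `τ` through smaller partitions. The number `n` bounds the size for the induction.
  S-mono : ∀ n τ → size τ < n → IsPartition τ → ∀ β → IsPartition β → coeff (S (mono τ)) β ≡ antipodeMono τ β
  S-mono (suc n) τ (s≤s s≤n) pτ β pβ = +-cancelʳ (lowerPart antipodeMono) (s τ β) (antipodeMono τ β) (begin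
    s τ β + lowerPart antipodeMono ≡⟨ cong (s τ β +_) (sym (lowerPart-cong s antipodeMono
        (λ ρ pρ lt → S-mono n ρ (ℕP.<-≤-trans lt s≤n) pρ))) ⟩
    s τ β + lowerPart s ≡⟨ sym (convolve-mono s) ⟩
    convolve (mono τ) s β ≡⟨ trans (sym (convidS-convolve S (mono τ) β)) (id*S (mono τ) β pβ) ⟩
    coeff (scalar1 (ε (mono τ))) β ≡⟨ sym (convolve-antipodeMono (mono τ) β pβ) ⟩
    convolve (mono τ) antipodeMono β ≡⟨ convolve-mono antipodeMono ⟩
    antipodeMono τ β + lowerPart antipodeMono ∎)
    where
    open ConvolveMono τ pτ β pβ
    s : List ℕ → List ℕ → ℤ
    s ρ = coeff (S (mono ρ))

  module _ (β : List ℕ) (pβ : IsPartition β) where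

    private
      L : Λ → ℤ
      L f = coeff (S f) β

      L-+ : ∀ f g → L (f +Λ g) ≡ L f + L g
      L-+ f g = trans (S-additive f g β pβ) (+Λ-coeff (S f) (S g) β)

    L-0 : ∀ f → (∀ μ → IsPartition μ → coeff f μ ≡ 0ℤ) → L f ≡ 0ℤ
    L-0 f f≈0 = begin
      L f ≡⟨ sym (cancel (L f)) ⟩
      (L f + L f) + - L f ≡⟨ cong (_+ - L f) (trans (sym (L-+ f f)) (S-cong (f +Λ f) f f+f≈f β pβ)) ⟩
      L f + - L f ≡⟨ ℤP.+-inverseʳ (L f) ⟩
      0ℤ ∎
      where
      cancel : ∀ x → (x + x) + - x ≡ x
      cancel = solve-∀
      f+f≈f : (f +Λ f) ≈ f
      f+f≈f μ pμ = trans (+Λ-coeff f f μ) (trans (cong (_+ coeff f μ) (f≈0 μ pμ)) (ℤP.+-identityˡ (coeff f μ)))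

    L-scale-+ : ∀ n f → L (scale (ℤ.+ n) f) ≡ ℤ.+ n * L f
    L-scale-+ zero    f = L-0 (scale 0ℤ f) (λ μ _ → scale-coeff 0ℤ f μ)
    L-scale-+ (suc n) f = begin
      L (scale (ℤ.+ suc n) f) ≡⟨ S-cong (scale (ℤ.+ suc n) f) (f +Λ scale (ℤ.+ n) f) step β pβ ⟩
      L (f +Λ scale (ℤ.+ n) f) ≡⟨ L-+ f (scale (ℤ.+ n) f) ⟩
      L f + L (scale (ℤ.+ n) f) ≡⟨ cong (L f +_) (L-scale-+ n f) ⟩
      L f + ℤ.+ n * L f ≡⟨ sym (ℤP.suc-* (ℤ.+ n) (L f)) ⟩
      ℤ.+ suc n * L f ∎
      where
      step : scale (ℤ.+ suc n) f ≈ (f +Λ scale (ℤ.+ n) f)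
      step μ _ = begin
        coeff (scale (ℤ.+ suc n) f) μ ≡⟨ scale-coeff (ℤ.+ suc n) f μ ⟩
        ℤ.+ suc n * coeff f μ ≡⟨ ℤP.suc-* (ℤ.+ n) (coeff f μ) ⟩
        coeff f μ + ℤ.+ n * coeff f μ ≡⟨ cong (coeff f μ +_) (sym (scale-coeff (ℤ.+ n) f μ)) ⟩
        coeff f μ + coeff (scale (ℤ.+ n) f) μ ≡⟨ sym (+Λ-coeff f (scale (ℤ.+ n) f) μ) ⟩
        coeff (f +Λ scale (ℤ.+ n) f) μ ∎

    -- `S` is assumed to be additive only. Linearity over ℤ comes from repeated addition and, for
    -- negative `c`, from the cancellation of `f₋` against `f₊`.
    L-scale : ∀ c f → L (scale c f) ≡ c * L f
    L-scale (ℤ.+ n)    f = L-scale-+ n f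
    L-scale (ℤ.-[1+ n ]) f = begin
      L f₋ ≡⟨ sym (cancel (L f₋) (L f₊)) ⟩
      (L f₋ + L f₊) + - L f₊ ≡⟨ cong₂ (λ x y → x + - y) (trans (sym (L-+ f₋ f₊)) (L-0 (f₋ +Λ f₊) sum≈0)) (L-scale-+ (suc n) f) ⟩
      0ℤ + - (ℤ.+ suc n * L f) ≡⟨ ℤP.+-identityˡ (- (ℤ.+ suc n * L f)) ⟩
      - (ℤ.+ suc n * L f) ≡⟨ ℤP.neg-distribˡ-* (ℤ.+ suc n) (L f) ⟩
      ℤ.-[1+ n ] * L f ∎
      where
      f₋ f₊ : Λ
      f₋ = scale ℤ.-[1+ n ] f
      f₊ = scale (ℤ.+ suc n) f
      cancel : ∀ x y → (x + y) + - y ≡ x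
      cancel = solve-∀
      sum≈0 : ∀ μ → IsPartition μ → coeff (f₋ +Λ f₊) μ ≡ 0ℤ
      sum≈0 μ _ = begin
        coeff (f₋ +Λ f₊) μ ≡⟨ +Λ-coeff f₋ f₊ μ ⟩
        coeff f₋ μ + coeff f₊ μ ≡⟨ cong₂ _+_ (scale-coeff ℤ.-[1+ n ] f μ) (scale-coeff (ℤ.+ suc n) f μ) ⟩
        ℤ.-[1+ n ] * coeff f μ + ℤ.+ suc n * coeff f μ ≡⟨ sym (ℤP.*-distribʳ-+ (coeff f μ) ℤ.-[1+ n ] (ℤ.+ suc n)) ⟩
        (ℤ.-[1+ n ] + ℤ.+ suc n) * coeff f μ ≡⟨ cong (_* coeff f μ) (ℤP.+-inverseˡ (ℤ.+ suc n)) ⟩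
        0ℤ ∎

    monoSum : (List ℕ → ℤ) → List (List ℕ) → Λ
    monoSum c []       = fromCoeffs 0 (λ _ → 0ℤ)
    monoSum c (ν ∷ νs) = scale (c ν) (mono ν) +Λ monoSum c νs

    monoSum-coeff : ∀ c νs μ → coeff (monoSum c νs) μ ≡ ∑ νs (λ ν → c ν * coeff (mono ν) μ)
    monoSum-coeff c []       μ = trunc-≡ 0 (λ _ → 0ℤ) μ (λ _ → refl)
    monoSum-coeff c (ν ∷ νs) μ = trans (+Λ-coeff (scale (c ν) (mono ν)) (monoSum c νs) μ)
      (cong₂ _+_ (scale-coeff (c ν) (mono ν) μ) (monoSum-coeff c νs μ))

    L-monoSum : ∀ c νs → L (monoSum c νs) ≡ ∑ νs (λ ν → c ν * L (mono ν))
    L-monoSum c []       = L-0 (monoSum c []) (λ μ _ → monoSum-coeff c [] μ)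
    L-monoSum c (ν ∷ νs) = trans (L-+ (scale (c ν) (mono ν)) (monoSum c νs))
      (cong₂ _+_ (L-scale (c ν) (mono ν)) (L-monoSum c νs))

    antipode-coeff : ∀ f → coeff (S f) β ≡ ∑ (refinements β) (λ α → sign α * coeff f (sortDesc α))
    antipode-coeff f = begin
      L f ≡⟨ S-cong f (monoSum (coeff f) P) expand β pβ ⟩
      L (monoSum (coeff f) P) ≡⟨ L-monoSum (coeff f) P ⟩
      -- A partition is its own sorting, so `ν` may be written as `[] ∪ₚ ν`; this matches
      -- `∑-antipodeMono` with `κ` empty.
      ∑ P (λ ν → coeff f ν * L (mono ν)) ≡⟨ ∑-congᴬ (All.map (λ {ν} pν → cong₂ _*_
          (cong (coeff f) (sym (sortDesc-partition ν pν))) (S-mono (suc (size ν)) ν ℕP.≤-refl pν β pβ)) (parsUpTo-sound (bound f))) ⟩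
      ∑ P (λ ν → coeff f ([] ∪ₚ ν) * antipodeMono ν β) ≡⟨ ∑-antipodeMono f [] β ⟩
      ∑ (refinements β) (λ α → sign α * coeff f (sortDesc α)) ∎
      where
      P : List (List ℕ)
      P = parsUpTo (bound f)
      expand : f ≈ monoSum (coeff f) P
      expand μ pμ = sym (begin
        coeff (monoSum (coeff f) P) μ ≡⟨ monoSum-coeff (coeff f) P μ ⟩
        ∑ P (λ ν → coeff f ν * coeff (mono ν) μ)
          ≡⟨ ∑-cong P (λ ν → trans (cong (coeff f ν *_) (mono-coeff ν μ)) (ℤP.*-comm (coeff f ν) (ind (μ ==ₗ ν)))) ⟩
        ∑ P (λ ν → ind (μ ==ₗ ν) * coeff f ν) ≡⟨ parsUpTo-δ (bound f) μ (coeff f) pμ (vanish f μ) ⟩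
        coeff f μ ∎)

-- Polynomials in one variable

Poly : Set
Poly = List ℤ

eval : Poly → ℤ → ℤ
eval []      x = 0ℤ
eval (a ∷ p) x = a + x * eval p x

coef : Poly → ℕ → ℤ
coef []      n       = 0ℤ
coef (a ∷ p) zero    = a
coef (a ∷ p) (suc n) = coef p n

addP : Poly → Poly → Poly
addP []      q       = q
addP (a ∷ p) []      = a ∷ p
addP (a ∷ p) (b ∷ q) = a + b ∷ addP p q

scaleP : ℤ → Poly → Poly
scaleP c = map (c *_)

mulP : Poly → Poly → Poly
mulP []      q = []
mulP (a ∷ p) q = addP (scaleP a q) (0ℤ ∷ mulP p q)

negVar : Poly → Poly
negVar []      = []
negVar (a ∷ p) = a ∷ scaleP (- 1ℤ) (negVar p)

sumP : List A → (A → Poly) → Poly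
sumP []       f = []
sumP (x ∷ xs) f = addP (f x) (sumP xs f)

eval-addP : ∀ p q x → eval (addP p q) x ≡ eval p x + eval q x
eval-addP []      q       x = sym (ℤP.+-identityˡ (eval q x))
eval-addP (a ∷ p) []      x = sym (ℤP.+-identityʳ (a + x * eval p x))
eval-addP (a ∷ p) (b ∷ q) x = trans (cong (λ z → a + b + x * z) (eval-addP p q x)) (lemma a b x (eval p x) (eval q x))
  where
  lemma : ∀ a b x y z → a + b + x * (y + z) ≡ (a + x * y) + (b + x * z)
  lemma = solve-∀

eval-scaleP : ∀ c p x → eval (scaleP c p) x ≡ c * eval p x
eval-scaleP c []      x = sym (ℤP.*-zeroʳ c)
eval-scaleP c (a ∷ p) x = trans (cong (λ z → c * a + x * z) (eval-scaleP c p x)) (lemma c a x (eval p x))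
  where
  lemma : ∀ c a x y → c * a + x * (c * y) ≡ c * (a + x * y)
  lemma = solve-∀

eval-mulP : ∀ p q x → eval (mulP p q) x ≡ eval p x * eval q x
eval-mulP []      q x = refl
eval-mulP (a ∷ p) q x = begin
  eval (addP (scaleP a q) (0ℤ ∷ mulP p q)) x ≡⟨ eval-addP (scaleP a q) (0ℤ ∷ mulP p q) x ⟩
  eval (scaleP a q) x + (0ℤ + x * eval (mulP p q) x)
    ≡⟨ cong₂ (λ y z → y + (0ℤ + x * z)) (eval-scaleP a q x) (eval-mulP p q x) ⟩
  a * eval q x + (0ℤ + x * (eval p x * eval q x)) ≡⟨ lemma a x (eval p x) (eval q x) ⟩
  (a + x * eval p x) * eval q x ∎
  where
  lemma : ∀ a x y z → a * z + (0ℤ + x * (y * z)) ≡ (a + x * y) * z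
  lemma = solve-∀

eval-negVar : ∀ p x → eval (negVar p) x ≡ eval p (- x)
eval-negVar []      x = refl
eval-negVar (a ∷ p) x = begin
  a + x * eval (scaleP (- 1ℤ) (negVar p)) x ≡⟨ cong (λ z → a + x * z) (eval-scaleP (- 1ℤ) (negVar p) x) ⟩
  a + x * (- 1ℤ * eval (negVar p) x) ≡⟨ cong (λ z → a + x * (- 1ℤ * z)) (eval-negVar p x) ⟩
  a + x * (- 1ℤ * eval p (- x)) ≡⟨ lemma a x (eval p (- x)) ⟩
  a + - x * eval p (- x) ∎
  where
  lemma : ∀ a x y → a + x * (- 1ℤ * y) ≡ a + - x * y
  lemma = solve-∀

eval-sumP : ∀ (xs : List A) f x → eval (sumP xs f) x ≡ ∑ xs (λ a → eval (f a) x)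
eval-sumP []       f x = refl
eval-sumP (a ∷ xs) f x = trans (eval-addP (f a) (sumP xs f) x) (cong (eval (f a) x +_) (eval-sumP xs f x))

coef-addP : ∀ p q n → coef (addP p q) n ≡ coef p n + coef q n
coef-addP []      q       n       = sym (ℤP.+-identityˡ (coef q n))
coef-addP (a ∷ p) []      n       = sym (ℤP.+-identityʳ (coef (a ∷ p) n))
coef-addP (a ∷ p) (b ∷ q) zero    = refl
coef-addP (a ∷ p) (b ∷ q) (suc n) = coef-addP p q n

coef-scaleP : ∀ c p n → coef (scaleP c p) n ≡ c * coef p n
coef-scaleP c []      n       = sym (ℤP.*-zeroʳ c)
coef-scaleP c (a ∷ p) zero    = refl
coef-scaleP c (a ∷ p) (suc n) = coef-scaleP c p n

coef-negVar : ∀ p n → coef (negVar p) n ≡ sgn n * coef p n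
coef-negVar []      n       = sym (ℤP.*-zeroʳ (sgn n))
coef-negVar (a ∷ p) zero    = sym (ℤP.*-identityˡ a)
coef-negVar (a ∷ p) (suc n) = begin
  coef (scaleP (- 1ℤ) (negVar p)) n ≡⟨ coef-scaleP (- 1ℤ) (negVar p) n ⟩
  - 1ℤ * coef (negVar p) n ≡⟨ cong (- 1ℤ *_) (coef-negVar p n) ⟩
  - 1ℤ * (sgn n * coef p n) ≡⟨ lemma (sgn n) (coef p n) ⟩
  - sgn n * coef p n ∎
  where
  lemma : ∀ a b → - 1ℤ * (a * b) ≡ - a * b
  lemma = solve-∀

coef-sumP : ∀ (xs : List A) f n → coef (sumP xs f) n ≡ ∑ xs (λ a → coef (f a) n)
coef-sumP []       f n = refl
coef-sumP (a ∷ xs) f n = trans (coef-addP (f a) (sumP xs f) n) (cong (coef (f a) n +_) (coef-sumP xs f n))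

coef-mulP : ∀ p q n → coef (mulP p q) n ≡ ∑ (upTo (suc n)) (λ i → coef p i * coef q (n ∸ i))
coef-mulP []      q n       = sym (∑-≡0 (upTo (suc n)) (λ i → refl))
coef-mulP (a ∷ p) q zero    = trans (coef-addP (scaleP a q) (0ℤ ∷ mulP p q) 0) (cong (_+ 0ℤ) (coef-scaleP a q 0))
coef-mulP (a ∷ p) q (suc n) = begin
  coef (addP (scaleP a q) (0ℤ ∷ mulP p q)) (suc n) ≡⟨ coef-addP (scaleP a q) (0ℤ ∷ mulP p q) (suc n) ⟩
  coef (scaleP a q) (suc n) + coef (mulP p q) n ≡⟨ cong₂ _+_ (coef-scaleP a q (suc n)) (coef-mulP p q n) ⟩
  a * coef q (suc n) + ∑ (upTo (suc n)) (λ i → coef p i * coef q (n ∸ i))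
    ≡⟨ sym (∑-upTo-suc (suc n) (λ i → coef (a ∷ p) i * coef q (suc n ∸ i))) ⟩
  ∑ (upTo (suc (suc n))) (λ i → coef (a ∷ p) i * coef q (suc n ∸ i)) ∎

combP : List A → (A → ℤ) → (A → Poly) → Poly
combP xs c f = sumP xs (λ a → scaleP (c a) (f a))

eval-combP : ∀ (xs : List A) c f x → eval (combP xs c f) x ≡ ∑ xs (λ a → c a * eval (f a) x)
eval-combP xs c f x = trans (eval-sumP xs (λ a → scaleP (c a) (f a)) x) (∑-cong xs (λ a → eval-scaleP (c a) (f a) x))

coef-combP : ∀ (xs : List A) c f n → coef (combP xs c f) n ≡ ∑ xs (λ a → c a * coef (f a) n)
coef-combP xs c f n = trans (coef-sumP xs (λ a → scaleP (c a) (f a)) n) (∑-cong xs (λ a → coef-scaleP (c a) (f a) n))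

eval-0 : ∀ p → eval p 0ℤ ≡ coef p 0
eval-0 []      = refl
eval-0 (a ∷ p) = ℤP.+-identityʳ a

eval-∑ : ∀ d p x → length p ≤ suc d → eval p x ≡ ∑ (upTo (suc d)) (λ n → coef p n * x ℤ.^ n)
eval-∑ d       []      x le = sym (∑-≡0 (upTo (suc d)) (λ n → refl))
eval-∑ zero    (a ∷ []) x le = lemma a x
  where
  lemma : ∀ a x → a + x * 0ℤ ≡ a * 1ℤ + 0ℤ
  lemma = solve-∀
eval-∑ zero    (a ∷ b ∷ p) x (s≤s ())
eval-∑ (suc d) (a ∷ p) x (s≤s le) = begin
  a + x * eval p x ≡⟨ cong (λ z → a + x * z) (eval-∑ d p x le) ⟩
  a + x * ∑ (upTo (suc d)) (λ n → coef p n * x ℤ.^ n)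
    ≡⟨ cong₂ _+_ (sym (ℤP.*-identityʳ a)) (sym (∑-*ˡ x (upTo (suc d)) (λ n → coef p n * x ℤ.^ n))) ⟩
  a * 1ℤ + ∑ (upTo (suc d)) (λ n → x * (coef p n * x ℤ.^ n))
    ≡⟨ cong (a * 1ℤ +_) (∑-cong (upTo (suc d)) (λ n → *-swapˡ x (coef p n) (x ℤ.^ n))) ⟩
  a * 1ℤ + ∑ (upTo (suc d)) (λ n → coef p n * x ℤ.^ suc n)
    ≡⟨ sym (∑-upTo-suc (suc d) (λ n → coef (a ∷ p) n * x ℤ.^ n)) ⟩
  ∑ (upTo (suc (suc d))) (λ n → coef (a ∷ p) n * x ℤ.^ n) ∎

private
  positive-≢0 : ∀ n {y} → ℤ.+ suc n * y ≡ 0ℤ → y ≡ 0ℤ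
  positive-≢0 n {y} e with ℤP.i*j≡0⇒i≡0∨j≡0 (ℤ.+ suc n) {y} e
  ... | inj₁ ()
  ... | inj₂ y≡0 = y≡0

-- A constant term divisible by every positive integer vanishes.
eval-zero : ∀ p → (∀ n → eval p (ℤ.+ suc n) ≡ 0ℤ) → ∀ i → coef p i ≡ 0ℤ
eval-zero []      h i = refl
eval-zero (a ∷ p) h = λ { zero → a≡0 ; (suc i) → eval-zero p rest i }
  where
  N : ℕ
  N = ℤ.∣ a ∣
  divides : ∀ n → ℤ.∣ a ∣ ≡ suc n ℕ.* ℤ.∣ eval p (ℤ.+ suc n) ∣
  divides n = begin
    ℤ.∣ a ∣ ≡⟨ cong ℤ.∣_∣ (ℤP.i-j≡0⇒i≡j a (- (ℤ.+ suc n * e)) (trans (cong (a +_) (ℤP.neg-involutive (ℤ.+ suc n * e))) (h n))) ⟩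
    ℤ.∣ - (ℤ.+ suc n * e) ∣ ≡⟨ ℤP.∣-i∣≡∣i∣ (ℤ.+ suc n * e) ⟩
    ℤ.∣ ℤ.+ suc n * e ∣ ≡⟨ ℤP.abs-* (ℤ.+ suc n) e ⟩
    suc n ℕ.* ℤ.∣ e ∣ ∎
    where
    e : ℤ
    e = eval p (ℤ.+ suc n)
  small : ∀ {k m} → k ≡ suc k ℕ.* m → k ≡ 0
  small {k} {zero}  e = trans e (ℕP.*-zeroʳ (suc k))
  small {k} {suc m} e = ⊥-elim (ℕP.<-irrefl refl (subst (suc k ≤_) (sym e) (ℕP.m≤m*n (suc k) (suc m))))
  a≡0 : a ≡ 0ℤ
  -- At the point |a| + 1 the number |a| would be a multiple of |a| + 1, hence it is 0.
  a≡0 = ℤP.∣i∣≡0⇒i≡0 (small (divides N))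
  rest : ∀ n → eval p (ℤ.+ suc n) ≡ 0ℤ
  rest n = positive-≢0 n (trans (sym (ℤP.+-identityˡ (ℤ.+ suc n * eval p (ℤ.+ suc n))))
    (trans (cong (_+ ℤ.+ suc n * eval p (ℤ.+ suc n)) (sym a≡0)) (h n)))

eval-injective : ∀ p q → (∀ n → eval p (ℤ.+ suc n) ≡ eval q (ℤ.+ suc n)) → ∀ i → coef p i ≡ coef q i
eval-injective p q h i = ℤP.i-j≡0⇒i≡j (coef p i) (coef q i) (begin
  coef p i + - coef q i ≡⟨ cong (coef p i +_) (neg (coef q i)) ⟩
  coef p i + - 1ℤ * coef q i ≡⟨ cong (coef p i +_) (sym (coef-scaleP (- 1ℤ) q i)) ⟩
  coef p i + coef (scaleP (- 1ℤ) q) i ≡⟨ sym (coef-addP p (scaleP (- 1ℤ) q) i) ⟩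
  coef (addP p (scaleP (- 1ℤ) q)) i ≡⟨ eval-zero (addP p (scaleP (- 1ℤ) q)) diff i ⟩
  0ℤ ∎)
  where
  neg : ∀ y → - y ≡ - 1ℤ * y
  neg = solve-∀
  diff : ∀ n → eval (addP p (scaleP (- 1ℤ) q)) (ℤ.+ suc n) ≡ 0ℤ
  diff n = begin
    eval (addP p (scaleP (- 1ℤ) q)) x ≡⟨ eval-addP p (scaleP (- 1ℤ) q) x ⟩
    eval p x + eval (scaleP (- 1ℤ) q) x ≡⟨ cong₂ _+_ (h n) (trans (eval-scaleP (- 1ℤ) q x) (sym (neg (eval q x)))) ⟩
    eval q x + - eval q x ≡⟨ ℤP.+-inverseʳ (eval q x) ⟩
    0ℤ ∎
    where
    x : ℤ
    x = ℤ.+ suc n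

length-addP : ∀ p q d → length p ≤ d → length q ≤ d → length (addP p q) ≤ d
length-addP []      q       d       a       b       = b
length-addP (x ∷ p) []      d       a       b       = a
length-addP (x ∷ p) (y ∷ q) (suc d) (s≤s a) (s≤s b) = s≤s (length-addP p q d a b)

length-mulP : ∀ p q d e → length p ≤ suc d → length q ≤ suc e → length (mulP p q) ≤ suc (d ℕ.+ e)
length-mulP []          q d       e a       b = z≤n
length-mulP (x ∷ [])    q d       e a       b = length-addP (scaleP x q) (0ℤ ∷ []) (suc (d ℕ.+ e))
  (ℕP.≤-trans (ℕP.≤-reflexive (LP.length-map (x *_) q)) (ℕP.≤-trans b (s≤s (ℕP.m≤n+m e d)))) (s≤s z≤n)
length-mulP (x ∷ y ∷ p) q (suc d) e (s≤s a) b = length-addP (scaleP x q) (0ℤ ∷ mulP (y ∷ p) q) (suc (suc d ℕ.+ e))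
  (ℕP.≤-trans (ℕP.≤-reflexive (LP.length-map (x *_) q)) (ℕP.≤-trans b (s≤s (ℕP.m≤n+m e (suc d)))))
  (s≤s (length-mulP (y ∷ p) q d e a b))

-- Transfer matrices

data Mode : Set where
  rpp vst : Mode

-- c is the number of columns, from that of the cell rightwards, in which the
-- row above is not new; for c = 0 the cell above carries the same letter.
newCell : Mode → ℤ → ℕ → ℤ
newCell md  x (suc c) = x
newCell rpp x zero    = 1ℤ
newCell vst x zero    = 1ℤ + x

newCells : Mode → ℤ → ℕ → ℕ → ℤ
newCells md  x c zero          = 1ℤ
newCells rpp x c (suc l)       = newCell rpp x c * newCells rpp x (ℕ.pred c) l
newCells vst x c (suc zero)    = newCell vst x c
newCells vst x c (suc (suc l)) = 0ℤ

-- One row grows from length b to length a by cells containing the new letter,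
-- below a row whose part with the earlier letters has length c.
step : Mode → ℤ → ℕ → ℕ → ℕ → ℤ
step md x c       zero    a       = newCells md x c a
step md x (suc c) (suc b) (suc a) = step md x c b a
step md x zero    (suc b) a       = 0ℤ
step md x (suc c) (suc b) zero    = 0ℤ

step-diag : ∀ md x {c b} → b ≤ c → step md x c b b ≡ 1ℤ
step-diag rpp x z≤n     = refl
step-diag vst x z≤n     = refl
step-diag md  x (s≤s p) = step-diag md x p

step-above : ∀ md x {c b} a → c < b → step md x c b a ≡ 0ℤ
step-above md x {zero}  a       (s≤s p) = refl
step-above md x {suc c} zero    (s≤s p) = refl
step-above md x {suc c} (suc a) (s≤s p) = step-above md x a p

step-shrink : ∀ md x c {b a} → a < b → step md x c b a ≡ 0ℤ
step-shrink md x zero    {suc b} {a}     (s≤s p) = refl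
step-shrink md x (suc c) {suc b} {zero}  (s≤s p) = refl
step-shrink md x (suc c) {suc b} {suc a} (s≤s p) = step-shrink md x c p

step-vst-free : ∀ x {c b} → b < c → step vst x c b (suc b) ≡ x
step-vst-free x {suc c} {zero}  (s≤s p) = refl
step-vst-free x {suc c} {suc b} (s≤s p) = step-vst-free x p

step-vst-under : ∀ x b → step vst x b b (suc b) ≡ 1ℤ + x
step-vst-under x zero    = refl
step-vst-under x (suc b) = step-vst-under x b

step-vst-two : ∀ x c {b a} → 2 ℕ.+ b ≤ a → step vst x c b a ≡ 0ℤ
step-vst-two x c       {zero}  {suc (suc a)} _       = refl
step-vst-two x c       {zero}  {suc zero}    (s≤s ())
step-vst-two x zero    {suc b} {suc a}       _       = refl
step-vst-two x (suc c) {suc b} {suc a}       (s≤s p) = step-vst-two x c p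

step-rpp-free : ∀ x {c b a} → b < c → b < a → step rpp x c b a ≡ x * step rpp x c (suc b) a
step-rpp-free x {suc c} {zero}  {suc a} (s≤s p) (s≤s q) = refl
step-rpp-free x {suc c} {suc b} {suc a} (s≤s p) (s≤s q) = step-rpp-free x p q

step-rpp-under : ∀ x {b a} → b ≤ a → step rpp x b b a ≡ 1ℤ
step-rpp-under x {a = zero}  z≤n     = refl
step-rpp-under x {a = suc a} z≤n     = trans (ℤP.*-identityˡ (step rpp x 0 0 a)) (step-rpp-under x {a = a} z≤n)
step-rpp-under x             (s≤s p) = step-rpp-under x p

-- With `a ≤ c` every new cell lies under an old one and weighs x = 0. Without the bound, cells
-- under the same letter would still have weight 1.
step-0 : ∀ md {c} b {a} → a ≤ c → step md 0ℤ c b a ≡ ind (b == a)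
step-0 rpp zero    z≤n           = refl
step-0 vst zero    z≤n           = refl
step-0 rpp zero    (s≤s p)       = refl
step-0 vst zero    {suc zero}    (s≤s p) = refl
step-0 vst zero    {suc (suc a)} (s≤s p) = refl
step-0 md  {zero}  (suc b) z≤n   = refl
step-0 md  {suc c} (suc b) z≤n   = refl
step-0 md  (suc b) {suc a} (s≤s p) = trans (step-0 md b p) (cong ind (sym (==-suc b a)))

-- Strict rows contain each letter at most once.
step-vst-split : ∀ x c b a → step vst x c b a ≡
  ind (b == a) * step vst x c b b + ind (suc b == a) * step vst x c b (suc b)
step-vst-split x c       zero    zero          = refl
step-vst-split x c       zero    (suc zero)    = lemma (newCell vst x c)
  where
  lemma : ∀ y → y ≡ 0ℤ * 1ℤ + 1ℤ * y
  lemma = solve-∀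
step-vst-split x c       zero    (suc (suc a)) = refl
step-vst-split x zero    (suc b) a             = lemma (ind (suc b == a)) (ind (suc (suc b) == a))
  where
  lemma : ∀ y z → 0ℤ ≡ y * 0ℤ + z * 0ℤ
  lemma = solve-∀
step-vst-split x (suc c) (suc b) zero          = refl
step-vst-split x (suc c) (suc b) (suc a)       = trans (step-vst-split x c b a)
  (cong₂ (λ p q → ind p * step vst x c b b + ind q * step vst x c b (suc b)) (sym (==-suc b a)) (sym (==-suc (suc b) a)))

∑-step-vst : ∀ w x c b (h : ℕ → ℤ) → b ≤ w →
  ∑ (upTo (suc (suc w))) (λ a → step vst x c b a * h a) ≡ step vst x c b b * h b + step vst x c b (suc b) * h (suc b)
∑-step-vst w x c b h b≤w = begin
  ∑ U (λ a → step vst x c b a * h a)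
    ≡⟨ ∑-cong U (λ a → trans (cong (_* h a) (step-vst-split x c b a))
         (lemma (ind (b == a)) s₀ (ind (suc b == a)) s₁ (h a))) ⟩
  ∑ U (λ a → ind (b == a) * (s₀ * h a) + ind (suc b == a) * (s₁ * h a))
    ≡⟨ ∑-+ U (λ a → ind (b == a) * (s₀ * h a)) (λ a → ind (suc b == a) * (s₁ * h a)) ⟩
  ∑ U (λ a → ind (b == a) * (s₀ * h a)) + ∑ U (λ a → ind (suc b == a) * (s₁ * h a))
    ≡⟨ cong₂ _+_ (∑-ind-upTo (suc (suc w)) b (λ a → s₀ * h a) (s≤s (ℕP.m≤n⇒m≤1+n b≤w)))
                 (∑-ind-upTo (suc (suc w)) (suc b) (λ a → s₁ * h a) (s≤s (s≤s b≤w))) ⟩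
  s₀ * h b + s₁ * h (suc b) ∎
  where
  U : List ℕ
  U = upTo (suc (suc w))
  s₀ s₁ : ℤ
  s₀ = step vst x c b b
  s₁ = step vst x c b (suc b)
  lemma : ∀ i s j t h → (i * s + j * t) * h ≡ i * (s * h) + j * (t * h)
  lemma = solve-∀

entry : Mode → ℤ → ℕ → List ℕ → List ℕ → ℤ
entry md x c []       []       = 1ℤ
entry md x c (b ∷ bs) (a ∷ as) = step md x c b a * entry md x b bs as
entry md x c _        _        = 0ℤ

Decreasing : ℕ → List ℕ → Set
Decreasing c []       = ⊤
Decreasing c (a ∷ as) = a ≤ c × Decreasing a as

decreasing? : ∀ c as → Dec (Decreasing c as)
decreasing? c []       = yes tt
decreasing? c (a ∷ as) with a ℕ.≤? c | decreasing? a as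
... | yes p | yes q = yes (p , q)
... | no ¬p | _     = no (¬p ∘ proj₁)
... | yes _ | no ¬q = no (¬q ∘ proj₂)

-- A row of the smaller shape that is longer than the one above makes its `step` vanish. This allows
-- sums over arbitrary lists of lengths: an intermediate shape is the smaller shape of the second
-- factor.
entry-¬decreasing : ∀ md x c bs as → ¬ Decreasing c bs → entry md x c bs as ≡ 0ℤ
entry-¬decreasing md x c []       as       ¬d = ⊥-elim (¬d tt)
entry-¬decreasing md x c (b ∷ bs) []       ¬d = refl
entry-¬decreasing md x c (b ∷ bs) (a ∷ as) ¬d with b ℕ.≤? c
... | no  b≰c = cong (_* entry md x b bs as) (step-above md x a (ℕP.≰⇒> b≰c))
... | yes b≤c = trans (cong (step md x c b a *_) (entry-¬decreasing md x b bs as (λ d → ¬d (b≤c , d))))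
                      (ℤP.*-zeroʳ (step md x c b a))

entry-0 : ∀ md c bs as → Decreasing c as → length bs ≡ length as → entry md 0ℤ c bs as ≡ ind (bs ==ₗ as)
entry-0 md c []       []       d         l = refl
entry-0 md c (b ∷ bs) (a ∷ as) (a≤c , d) l = trans (cong (_* entry md 0ℤ b bs as) (step-0 md b a≤c)) (tail (b ℕ.≟ a))
  where
  tail : Dec (b ≡ a) → ind (b == a) * entry md 0ℤ b bs as ≡ ind ((b == a) ∧ (bs ==ₗ as))
  tail (yes refl) = trans (cong (ind (b == a) *_) (entry-0 md b bs as d (ℕP.suc-injective l))) (sym (ind-∧ (b == a) (bs ==ₗ as)))
  tail (no  b≢a)  = trans (cong (λ z → ind z * entry md 0ℤ b bs as) (==-false b≢a)) (cong (λ z → ind (z ∧ (bs ==ₗ as))) (sym (==-false b≢a)))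

decreasing-suc : ∀ {c} as → Decreasing c as → Decreasing (suc c) as
decreasing-suc []       d       = tt
decreasing-suc (a ∷ as) (p , d) = ℕP.m≤n⇒m≤1+n p , d

-- Commutation and inversion of transfer matrices

module Product (w : ℕ) where

  -- Shapes have rows of length at most `w`, but a row of length `w` can still be lengthened once by
  -- `vst`; the range up to `suc w` keeps both possible intermediate lengths in the sum.
  states : ℕ → List (List ℕ)
  states m = boxes (replicate m (suc w))

  -- The product of two transfer matrices, with separate bounds c and b above
  -- the first row of the smallest and of the intermediate shape.
  product : Mode → ℤ → ℤ → ℕ → ℕ → List ℕ → List ℕ → ℤ
  product md x y c b cs as = ∑ (states (length as)) (λ bs → entry vst x c cs bs * entry md y b bs as)

  product-∷ : ∀ md x y c′ b′ c cs a as → product md x y c′ b′ (c ∷ cs) (a ∷ as) ≡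
    ∑ (upTo (suc (suc w))) (λ b → step vst x c′ c b * (step md y b′ b a * product md x y c b cs as))
  product-∷ md x y c′ b′ c cs a as = begin
    product md x y c′ b′ (c ∷ cs) (a ∷ as)
      ≡⟨ ∑-boxes-∷ (suc w) (replicate (length as) (suc w)) (λ bs → entry vst x c′ (c ∷ cs) bs * entry md y b′ bs (a ∷ as)) ⟩
    ∑ (upTo (suc (suc w))) (λ b → ∑ (states (length as)) (λ bs →
      (step vst x c′ c b * entry vst x c cs bs) * (step md y b′ b a * entry md y b bs as)))
      ≡⟨ ∑-cong (upTo (suc (suc w))) (λ b → begin
           ∑ (states (length as)) (λ bs → (step vst x c′ c b * entry vst x c cs bs) * (step md y b′ b a * entry md y b bs as))
             ≡⟨ ∑-cong (states (length as)) (λ bs → *-interchange (step vst x c′ c b) (entry vst x c cs bs) (step md y b′ b a) (entry md y b bs as)) ⟩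
           ∑ (states (length as)) (λ bs → (step vst x c′ c b * step md y b′ b a) * (entry vst x c cs bs * entry md y b bs as))
             ≡⟨ ∑-*ˡ (step vst x c′ c b * step md y b′ b a) (states (length as)) (λ bs → entry vst x c cs bs * entry md y b bs as) ⟩
           (step vst x c′ c b * step md y b′ b a) * product md x y c b cs as
             ≡⟨ ℤP.*-assoc (step vst x c′ c b) (step md y b′ b a) (product md x y c b cs as) ⟩
           step vst x c′ c b * (step md y b′ b a * product md x y c b cs as) ∎) ⟩
    ∑ (upTo (suc (suc w))) (λ b → step vst x c′ c b * (step md y b′ b a * product md x y c b cs as)) ∎

  product-above : ∀ md x y c′ b′ c cs a as → c′ < c → product md x y c′ b′ (c ∷ cs) (a ∷ as) ≡ 0ℤ
  product-above md x y c′ b′ c cs a as lt = trans (product-∷ md x y c′ b′ c cs a as)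
    (∑-≡0 (upTo (suc (suc w))) (λ b → cong (_* (step md y b′ b a * product md x y c b cs as)) (step-above vst x b lt)))

  -- Only the intermediate lengths `c` and `suc c` survive in `product-∷`. The three factors are
  -- passed with their values, so that each case of the row names only what it needs.
  product-step : ∀ md x y c′ b′ c cs a as {p q r} → c ≤ c′ → c′ ≤ w →
    step md y b′ c a ≡ p → step vst x c′ c (suc c) ≡ q → step md y b′ (suc c) a ≡ r →
    product md x y c′ b′ (c ∷ cs) (a ∷ as) ≡ p * product md x y c c cs as + q * (r * product md x y c (suc c) cs as)
  product-step md x y c′ b′ c cs a as {p} {q} {r} c≤c′ c′≤w ep eq er = begin
    product md x y c′ b′ (c ∷ cs) (a ∷ as) ≡⟨ product-∷ md x y c′ b′ c cs a as ⟩
    ∑ (upTo (suc (suc w))) (λ b → step vst x c′ c b * (step md y b′ b a * product md x y c b cs as))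
      ≡⟨ ∑-step-vst w x c′ c (λ b → step md y b′ b a * product md x y c b cs as) (ℕP.≤-trans c≤c′ c′≤w) ⟩
    step vst x c′ c c * (step md y b′ c a * V₀) + step vst x c′ c (suc c) * (step md y b′ (suc c) a * V₁)
      ≡⟨ cong₂ _+_ (cong₂ (λ i j → i * (j * V₀)) (step-diag vst x c≤c′) ep) (cong₂ (λ i j → i * (j * V₁)) eq er) ⟩
    1ℤ * (p * V₀) + q * (r * V₁) ≡⟨ cong (_+ q * (r * V₁)) (ℤP.*-identityˡ (p * V₀)) ⟩
    p * V₀ + q * (r * V₁) ∎
    where
    V₀ V₁ : ℤ
    V₀ = product md x y c c cs as
    V₁ = product md x y c (suc c) cs as

  product-vanish : ∀ md x y c′ b′ c cs a as → c ≤ c′ → c′ ≤ w →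
    step md y b′ c a ≡ 0ℤ → step md y b′ (suc c) a ≡ 0ℤ → product md x y c′ b′ (c ∷ cs) (a ∷ as) ≡ 0ℤ
  product-vanish md x y c′ b′ c cs a as c≤c′ c′≤w e₀ e₁ = trans
    (product-step md x y c′ b′ c cs a as c≤c′ c′≤w e₀ refl e₁)
    (lemma (product md x y c c cs as) (step vst x c′ c (suc c)) (product md x y c (suc c) cs as))
    where
    lemma : ∀ p q r → 0ℤ * p + q * (0ℤ * r) ≡ 0ℤ
    lemma = solve-∀

  product-still : ∀ md x y c′ b′ c cs as → c ≤ c′ → c′ ≤ w → c ≤ b′ →
    product md x y c′ b′ (c ∷ cs) (c ∷ as) ≡ product md x y c c cs as
  product-still md x y c′ b′ c cs as c≤c′ c′≤w c≤b′ = trans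
    (product-step md x y c′ b′ c cs c as c≤c′ c′≤w (step-diag md y c≤b′) refl (step-shrink md y b′ (ℕP.n<1+n c)))
    (lemma (product md x y c c cs as) (step vst x c′ c (suc c)) (product md x y c (suc c) cs as))
    where
    lemma : ∀ p q r → 1ℤ * p + q * (0ℤ * r) ≡ p
    lemma = solve-∀

  -- How a row grows from c to a in two steps, below a row of original length c′.
  data Row (c′ : ℕ) : ℕ → ℕ → Set where
    dead      : ∀ {c a} → c′ < c ⊎ a < c ⊎ 3 ℕ.+ c ≤ a → Row c′ c a
    still     : ∀ {c} → c ≤ c′ → Row c′ c c
    one       : ∀ {c} → c < c′ → Row c′ c (suc c)
    one-under : Row c′ c′ (suc c′)
    two       : ∀ {c} → suc c < c′ → Row c′ c (2 ℕ.+ c)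
    two-half  : ∀ {c} → c′ ≡ suc c → Row c′ c (2 ℕ.+ c)
    two-under : Row c′ c′ (2 ℕ.+ c′)

  row : ∀ c′ c a → Row c′ c a
  row zero           (suc c) a                   = dead (inj₁ (s≤s z≤n))
  row (suc c′)       (suc c) zero                = dead (inj₂ (inj₁ (s≤s z≤n)))
  row c′             zero    zero                = still z≤n
  row zero           zero    (suc zero)          = one-under
  row (suc c′)       zero    (suc zero)          = one (s≤s z≤n)
  row zero           zero    (suc (suc zero))    = two-under
  row (suc zero)     zero    (suc (suc zero))    = two-half refl
  row (suc (suc c′)) zero    (suc (suc zero))    = two (s≤s (s≤s z≤n))
  row c′             zero    (suc (suc (suc a))) = dead (inj₂ (inj₂ (s≤s (s≤s (s≤s z≤n)))))
  row (suc c′)       (suc c) (suc a) with row c′ c a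
  ... | dead (inj₁ p)        = dead (inj₁ (s≤s p))
  ... | dead (inj₂ (inj₁ p)) = dead (inj₂ (inj₁ (s≤s p)))
  ... | dead (inj₂ (inj₂ p)) = dead (inj₂ (inj₂ (s≤s p)))
  ... | still p              = still (s≤s p)
  ... | one p                = one (s≤s p)
  ... | one-under            = one-under
  ... | two p                = two (s≤s p)
  ... | two-half e           = two-half (cong suc e)
  ... | two-under            = two-under

  product-dead : ∀ x y c′ b′ c cs a as → c′ ≤ w → c′ < c ⊎ a < c ⊎ 3 ℕ.+ c ≤ a →
                 product vst x y c′ b′ (c ∷ cs) (a ∷ as) ≡ 0ℤ
  product-dead x y c′ b′ c cs a as c′≤w q with c ℕ.≤? c′ | q
  ... | no  c≰c′ | _               = product-above vst x y c′ b′ c cs a as (ℕP.≰⇒> c≰c′)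
  ... | yes c≤c′ | inj₁ c′<c       = ⊥-elim (ℕP.<⇒≱ c′<c c≤c′)
  ... | yes c≤c′ | inj₂ (inj₁ a<c) = product-vanish vst x y c′ b′ c cs a as c≤c′ c′≤w
    (step-shrink vst y b′ a<c) (step-shrink vst y b′ (ℕP.m≤n⇒m≤1+n a<c))
  ... | yes c≤c′ | inj₂ (inj₂ big) = product-vanish vst x y c′ b′ c cs a as c≤c′ c′≤w
    (step-vst-two y b′ (ℕP.≤-trans (ℕP.n≤1+n _) big)) (step-vst-two y b′ big)

  module _ (c : ℕ) (cs as : List ℕ) where

    private
      V₀ V₁ : ℤ → ℤ → ℤ
      V₀ x y = product vst x y c c cs as
      V₁ x y = product vst x y c (suc c) cs as

    -- Contribution of a row that gains one or two cells under old ones. In `grow₁` the cell carries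
    -- the second letter (intermediate length `c`) or the first (`suc c`); in `grow₂` there is one
    -- cell of each letter.
    grow₁ grow₂ : ℤ → ℤ → ℤ
    grow₁ x y = y * V₀ x y + x * V₁ x y
    grow₂ x y = x * y * V₁ x y

    product-one : ∀ x y c′ b′ → c < c′ → c < b′ → c′ ≤ w →
      product vst x y c′ b′ (c ∷ cs) (suc c ∷ as) ≡ grow₁ x y
    product-one x y c′ b′ c<c′ c<b′ c′≤w = trans
      (product-step vst x y c′ b′ c cs (suc c) as (ℕP.<⇒≤ c<c′) c′≤w
        (step-vst-free y c<b′) (step-vst-free x c<c′) (step-diag vst y c<b′))
      (cong (λ z → y * V₀ x y + x * z) (ℤP.*-identityˡ (V₁ x y)))

    product-one-under : ∀ x y → c ≤ w → product vst x y c (suc c) (c ∷ cs) (suc c ∷ as) ≡ grow₁ x y + V₁ x y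
    product-one-under x y c≤w = trans
      (product-step vst x y c (suc c) c cs (suc c) as ℕP.≤-refl c≤w
        (step-vst-free y (ℕP.≤-refl {suc c})) (step-vst-under x c) (step-diag vst y (ℕP.≤-refl {suc c})))
      (lemma x y (V₀ x y) (V₁ x y))
      where
      lemma : ∀ x y v₀ v₁ → y * v₀ + (1ℤ + x) * (1ℤ * v₁) ≡ (y * v₀ + x * v₁) + v₁
      lemma = solve-∀

    product-one-under₂ : ∀ x y → c ≤ w → product vst x y c c (c ∷ cs) (suc c ∷ as) ≡ (1ℤ + y) * V₀ x y
    product-one-under₂ x y c≤w = trans
      (product-step vst x y c c c cs (suc c) as ℕP.≤-refl c≤w
        (step-vst-under y c) (step-vst-under x c) (step-above vst y (suc c) (ℕP.≤-refl {suc c})))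
      (lemma x y (V₀ x y) (V₁ x y))
      where
      lemma : ∀ x y v₀ v₁ → (1ℤ + y) * v₀ + (1ℤ + x) * (0ℤ * v₁) ≡ (1ℤ + y) * v₀
      lemma = solve-∀

    private
      product-two-step : ∀ x y c′ b′ {q r} → c ≤ c′ → c′ ≤ w →
        step vst x c′ c (suc c) ≡ q → step vst y b′ (suc c) (2 ℕ.+ c) ≡ r →
        product vst x y c′ b′ (c ∷ cs) (2 ℕ.+ c ∷ as) ≡ q * r * V₁ x y
      product-two-step x y c′ b′ {q} {r} c≤c′ c′≤w eq er = trans
        (product-step vst x y c′ b′ c cs (2 ℕ.+ c) as c≤c′ c′≤w (step-vst-two y b′ (ℕP.≤-refl {2 ℕ.+ c})) eq er)
        (lemma (V₀ x y) q r (V₁ x y))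
        where
        lemma : ∀ v₀ q r v₁ → 0ℤ * v₀ + q * (r * v₁) ≡ q * r * v₁
        lemma = solve-∀

    product-two : ∀ x y c′ b′ → c < c′ → suc c < b′ → c′ ≤ w →
      product vst x y c′ b′ (c ∷ cs) (2 ℕ.+ c ∷ as) ≡ grow₂ x y
    product-two x y c′ b′ c<c′ c<b′ c′≤w =
      product-two-step x y c′ b′ (ℕP.<⇒≤ c<c′) c′≤w (step-vst-free x c<c′) (step-vst-free y c<b′)

    product-two-half : ∀ x y → suc c ≤ w →
      product vst x y (suc c) (suc c) (c ∷ cs) (2 ℕ.+ c ∷ as) ≡ x * (1ℤ + y) * V₁ x y
    product-two-half x y c≤w =
      product-two-step x y (suc c) (suc c) (ℕP.n≤1+n c) c≤w (step-vst-free x (ℕP.≤-refl {suc c})) (step-vst-under y (suc c))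

    product-two-under : ∀ x y → c ≤ w →
      product vst x y c (suc c) (c ∷ cs) (2 ℕ.+ c ∷ as) ≡ (1ℤ + x) * (1ℤ + y) * V₁ x y
    product-two-under x y c≤w =
      product-two-step x y c (suc c) ℕP.≤-refl c≤w (step-vst-under x c) (step-vst-under y (suc c))

    grow₂-sym : ∀ x y → V₁ x y ≡ V₁ y x → grow₂ x y ≡ grow₂ y x
    grow₂-sym x y e = cong₂ _*_ (ℤP.*-comm x y) e

    -- Both sides have the form (1 + x + y) `grow₁` - x y `V₁`, a combination with symmetric
    -- coefficients of two quantities that are symmetric by hypothesis.
    run-sym : ∀ x y → grow₁ x y ≡ grow₁ y x → V₁ x y ≡ V₁ y x →
      y * ((1ℤ + y) * V₀ x y) + x * (grow₁ x y + V₁ x y) ≡ x * ((1ℤ + x) * V₀ y x) + y * (grow₁ y x + V₁ y x)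
    run-sym x y e e₁ = trans (lemma x y (V₀ x y) (V₁ x y)) (trans
      (cong₂ (λ p q → (1ℤ + x + y) * p + - (x * y * q)) e e₁) (sym (trans (lemma y x (V₀ y x) (V₁ y x)) (lemma′ x y (grow₁ y x) (V₁ y x)))))
      where
      lemma : ∀ x y v₀ v₁ → y * ((1ℤ + y) * v₀) + x * ((y * v₀ + x * v₁) + v₁) ≡
              (1ℤ + x + y) * (y * v₀ + x * v₁) + - (x * y * v₁)
      lemma = solve-∀
      lemma′ : ∀ x y p q → (1ℤ + y + x) * p + - (y * x * q) ≡ (1ℤ + x + y) * p + - (x * y * q)
      lemma′ = solve-∀

    -- Both sides equal x y (1 + x + y) `V₁`.
    half-sym : ∀ x y → V₁ x y ≡ V₁ y x →
      y * (x * (1ℤ + y) * V₁ x y) + x * grow₂ x y ≡ x * (y * (1ℤ + x) * V₁ y x) + y * grow₂ y x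
    half-sym x y e = trans (cong (λ v → y * (x * (1ℤ + y) * v) + x * (x * y * v)) e) (lemma x y (V₁ y x))
      where
      lemma : ∀ x y v → y * (x * (1ℤ + y) * v) + x * (x * y * v) ≡ x * (y * (1ℤ + x) * v) + y * (y * x * v)
      lemma = solve-∀

  private
    -- If the rows below do not feel which letter lengthened the row above, then `grow₁` is just (x
    -- + y) times their common value.
    same-value : ∀ c′ x y cs as (f : ℤ → ℤ → ℤ) →
      (∀ x y b → c′ ≤ b → product vst x y c′ b cs as ≡ f x y) → f x y ≡ f y x → grow₁ c′ cs as x y ≡ grow₁ c′ cs as y x
    same-value c′ x y cs as f h e = trans
      (cong₂ (λ p q → y * p + x * q) (h x y c′ ℕP.≤-refl) (h x y (suc c′) (ℕP.n≤1+n c′)))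
      (trans (trans (cong (λ z → y * z + x * z) e) (ℤP.+-comm (y * f y x) (x * f y x)))
      (sym (cong₂ (λ p q → x * p + y * q) (h y x c′ ℕP.≤-refl) (h y x (suc c′) (ℕP.n≤1+n c′)))))

  -- Symmetry in the two letters, by induction on the rows from the bottom.
  -- Under a row growing by one cell, with the first letter (b = c + 1) or the
  -- second (b = c), the product is symmetric for b = c + 1; for b = c only the
  -- combination grow₁ is.
  exchange₀ : ∀ x y c cs as → c ≤ w → length cs ≡ length as → Decreasing c as →
    product vst x y c c cs as ≡ product vst y x c c cs as
  exchange₁ : ∀ x y c cs as → c ≤ w → length cs ≡ length as → Decreasing (2 ℕ.+ c) as →
    product vst x y c (suc c) cs as ≡ product vst y x c (suc c) cs as
  exchange₂ : ∀ x y c cs as → c ≤ w → length cs ≡ length as → Decreasing (suc c) as →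
    grow₁ c cs as x y ≡ grow₁ c cs as y x

  exchange₀ x y c′ []       []       _    _ _ = refl
  exchange₀ x y c′ (c ∷ cs) (a ∷ as) c′≤w l (a≤ , d) with ℕP.suc-injective l | row c′ c a
  ... | l′ | dead q       = trans (product-dead x y c′ c′ c cs a as c′≤w q) (sym (product-dead y x c′ c′ c cs a as c′≤w q))
  ... | l′ | still p      = trans (product-still vst x y c′ c′ c cs as p c′≤w p)
    (trans (exchange₀ x y c cs as (ℕP.≤-trans p c′≤w) l′ d) (sym (product-still vst y x c′ c′ c cs as p c′≤w p)))
  ... | l′ | one p        = trans (product-one c cs as x y c′ c′ p p c′≤w)
    (trans (exchange₂ x y c cs as (ℕP.≤-trans (ℕP.<⇒≤ p) c′≤w) l′ d) (sym (product-one c cs as y x c′ c′ p p c′≤w)))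
  ... | l′ | two p        = trans (product-two c cs as x y c′ c′ c<c′ p c′≤w)
    (trans (grow₂-sym c cs as x y (exchange₁ x y c cs as (ℕP.≤-trans (ℕP.<⇒≤ c<c′) c′≤w) l′ d)) (sym (product-two c cs as y x c′ c′ c<c′ p c′≤w)))
    where
    c<c′ : c < c′
    c<c′ = ℕP.<⇒≤ p
  ... | l′ | one-under     = ⊥-elim (ℕP.<-irrefl refl a≤)
  ... | l′ | two-half refl = ⊥-elim (ℕP.<-irrefl refl a≤)
  ... | l′ | two-under     = ⊥-elim (ℕP.<-irrefl refl (ℕP.<⇒≤ a≤))

  exchange₁ x y c′ []       []       _    _ _ = refl
  exchange₁ x y c′ (c ∷ cs) (a ∷ as) c′≤w l (a≤ , d) with ℕP.suc-injective l | row c′ c a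
  ... | l′ | dead q        = trans (product-dead x y c′ (suc c′) c cs a as c′≤w q) (sym (product-dead y x c′ (suc c′) c cs a as c′≤w q))
  ... | l′ | still p       = trans (product-still vst x y c′ (suc c′) c cs as p c′≤w (ℕP.m≤n⇒m≤1+n p))
    (trans (exchange₀ x y c cs as (ℕP.≤-trans p c′≤w) l′ d) (sym (product-still vst y x c′ (suc c′) c cs as p c′≤w (ℕP.m≤n⇒m≤1+n p))))
  ... | l′ | one p         = trans (product-one c cs as x y c′ (suc c′) p (ℕP.m≤n⇒m≤1+n p) c′≤w)
    (trans (exchange₂ x y c cs as (ℕP.≤-trans (ℕP.<⇒≤ p) c′≤w) l′ d) (sym (product-one c cs as y x c′ (suc c′) p (ℕP.m≤n⇒m≤1+n p) c′≤w)))
  ... | l′ | two p         = trans (product-two c cs as x y c′ (suc c′) (ℕP.<⇒≤ p) (ℕP.m≤n⇒m≤1+n p) c′≤w)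
    (trans (grow₂-sym c cs as x y (exchange₁ x y c cs as (ℕP.≤-trans (ℕP.<⇒≤ (ℕP.<⇒≤ p)) c′≤w) l′ d))
           (sym (product-two c cs as y x c′ (suc c′) (ℕP.<⇒≤ p) (ℕP.m≤n⇒m≤1+n p) c′≤w)))
  ... | l′ | two-half refl = trans (product-two c cs as x y c′ (suc c′) ℕP.≤-refl ℕP.≤-refl c′≤w)
    (trans (grow₂-sym c cs as x y (exchange₁ x y c cs as (ℕP.<⇒≤ c′≤w) l′ d)) (sym (product-two c cs as y x c′ (suc c′) ℕP.≤-refl ℕP.≤-refl c′≤w)))
  ... | l′ | one-under     = trans (product-one-under c cs as x y c′≤w)
    (trans (cong₂ _+_ (exchange₂ x y c cs as c′≤w l′ d) (exchange₁ x y c cs as c′≤w l′ (decreasing-suc as d)))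
           (sym (product-one-under c cs as y x c′≤w)))
  ... | l′ | two-under     = trans (product-two-under c cs as x y c′≤w)
    (trans (cong₂ _*_ (ℤP.*-comm (1ℤ + x) (1ℤ + y)) (exchange₁ x y c cs as c′≤w l′ d)) (sym (product-two-under c cs as y x c′≤w)))

  exchange₂ x y c′ []       []       _    _ _ = ℤP.+-comm (y * 1ℤ) (x * 1ℤ)
  exchange₂ x y c′ (c ∷ cs) (a ∷ as) c′≤w l (a≤ , d) with ℕP.suc-injective l | row c′ c a
  ... | l′ | dead q        = same-value c′ x y (c ∷ cs) (a ∷ as) (λ _ _ → 0ℤ) (λ x y b _ → product-dead x y c′ b c cs a as c′≤w q) refl
  ... | l′ | still p       = same-value c′ x y (c ∷ cs) (a ∷ as) (λ x y → product vst x y c c cs as)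
    (λ x y b q → product-still vst x y c′ b c cs as p c′≤w (ℕP.≤-trans p q)) (exchange₀ x y c cs as (ℕP.≤-trans p c′≤w) l′ d)
  ... | l′ | one p         = same-value c′ x y (c ∷ cs) (a ∷ as) (grow₁ c cs as)
    (λ x y b q → product-one c cs as x y c′ b p (ℕP.≤-trans p q) c′≤w) (exchange₂ x y c cs as (ℕP.≤-trans (ℕP.<⇒≤ p) c′≤w) l′ d)
  ... | l′ | two p         = same-value c′ x y (c ∷ cs) (a ∷ as) (grow₂ c cs as)
    (λ x y b q → product-two c cs as x y c′ b (ℕP.<⇒≤ p) (ℕP.≤-trans p q) c′≤w)
    (grow₂-sym c cs as x y (exchange₁ x y c cs as (ℕP.≤-trans (ℕP.<⇒≤ (ℕP.<⇒≤ p)) c′≤w) l′ d))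
  -- The second cell lies under the cell gained by the row above. If that one carries the second
  -- letter, the weight is 1 + y; if it carries the first, the weight is y.
  ... | l′ | two-half refl = trans
    (cong₂ (λ p q → y * p + x * q) (product-two-half c cs as x y c′≤w) (product-two c cs as x y c′ (suc c′) ℕP.≤-refl ℕP.≤-refl c′≤w))
    (trans (half-sym c cs as x y (exchange₁ x y c cs as (ℕP.<⇒≤ c′≤w) l′ d))
    (sym (cong₂ (λ p q → x * p + y * q) (product-two-half c cs as y x c′≤w) (product-two c cs as y x c′ (suc c′) ℕP.≤-refl ℕP.≤-refl c′≤w))))
  -- The row gains its cell directly under the one gained above. If the upper cell carries the
  -- second letter, the lower one cannot carry the smaller first letter, which leaves (1 + y) `V₀`.
  ... | l′ | one-under     = trans
    (cong₂ (λ p q → y * p + x * q) (product-one-under₂ c cs as x y c′≤w) (product-one-under c cs as x y c′≤w))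
    (trans (run-sym c cs as x y (exchange₂ x y c cs as c′≤w l′ d) (exchange₁ x y c cs as c′≤w l′ (decreasing-suc as d)))
    (sym (cong₂ (λ p q → x * p + y * q) (product-one-under₂ c cs as y x c′≤w) (product-one-under c cs as y x c′≤w))))
  ... | l′ | two-under     = ⊥-elim (ℕP.<-irrefl refl a≤)

  -- The value is the same for both states `b′`, which is what the induction needs to cancel terms.
  -- It is stated as G(0) because no monotonicity of `as` is assumed: G(0) is the identity only
  -- towards decreasing shapes.
  product-inverse : ∀ x c′ b′ cs as → c′ ≤ w → (b′ ≡ c′ ⊎ b′ ≡ suc c′) → length cs ≡ length as →
    product rpp x (- x) c′ b′ cs as ≡ entry rpp 0ℤ c′ cs as
  product-inverse x c′ b′ []       []       _ _ _ = refl
  product-inverse x c′ b′ (c ∷ cs) (a ∷ as) c′≤w b′≡ l with ℕP.suc-injective l | c ℕ.≤? c′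
  ... | l′ | no c≰c′ = trans (product-above rpp x (- x) c′ b′ c cs a as (ℕP.≰⇒> c≰c′))
                             (sym (cong (_* entry rpp 0ℤ c cs as) (step-above rpp 0ℤ a (ℕP.≰⇒> c≰c′))))
  ... | l′ | yes c≤c′ with ℕP.≤-trans c≤c′ c′≤w | ℕP.<-cmp c a
  ...   | c≤w | tri> _ _ c>a = trans
    (product-vanish rpp x (- x) c′ b′ c cs a as c≤c′ c′≤w (step-shrink rpp (- x) b′ c>a) (step-shrink rpp (- x) b′ (ℕP.m≤n⇒m≤1+n c>a)))
    (sym (cong (_* entry rpp 0ℤ c cs as) (step-shrink rpp 0ℤ c′ c>a)))
  ...   | c≤w | tri≈ _ refl _ = trans
    (product-still rpp x (- x) c′ b′ c cs as c≤c′ c′≤w (c≤b′ b′≡))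
    (trans (product-inverse x c c cs as c≤w (inj₁ refl) l′)
    (trans (sym (ℤP.*-identityˡ (entry rpp 0ℤ c cs as))) (sym (cong (_* entry rpp 0ℤ c cs as) (step-diag rpp 0ℤ c≤c′)))))
    where
    c≤b′ : (b′ ≡ c′ ⊎ b′ ≡ suc c′) → c ≤ b′
    c≤b′ (inj₁ refl) = c≤c′
    c≤b′ (inj₂ refl) = ℕP.m≤n⇒m≤1+n c≤c′
  ...   | c≤w | tri< c<a _ _ with ℕP.m≤n⇒m<n∨m≡n c≤c′ | b′≡
  -- The first new cell weighs -x if it comes from G and x if it comes from J. The rest of the row
  -- is the same, and by induction so are the rows below, so the two terms cancel.
  ...     | inj₁ c<c′ | _ = trans
    (product-step rpp x (- x) c′ b′ c cs a as c≤c′ c′≤w (step-rpp-free (- x) (c<b′ b′≡) c<a) (step-vst-free x c<c′) refl)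
    (trans (lemma x (step rpp (- x) b′ (suc c) a) _ _ (trans (product-inverse x c c cs as c≤w (inj₁ refl) l′)
                                             (sym (product-inverse x c (suc c) cs as c≤w (inj₂ refl) l′))))
    (sym (cong (_* entry rpp 0ℤ c cs as) (step-rpp-free 0ℤ c<c′ c<a))))
    where
    c<b′ : (b′ ≡ c′ ⊎ b′ ≡ suc c′) → c < b′
    c<b′ (inj₁ refl) = c<c′
    c<b′ (inj₂ refl) = ℕP.m≤n⇒m≤1+n c<c′
    lemma : ∀ x s u v → u ≡ v → - x * s * u + x * (s * v) ≡ 0ℤ
    lemma x s u .u refl = cancel x s u
      where
      cancel : ∀ x s u → - x * s * u + x * (s * u) ≡ 0ℤ
      cancel = solve-∀
  ...     | inj₂ refl | inj₁ refl = trans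
    (product-step rpp x (- x) c c c cs a as ℕP.≤-refl c≤w (step-rpp-under (- x) (ℕP.<⇒≤ c<a)) (step-vst-under x c)
       (step-above rpp (- x) a (ℕP.≤-refl {suc c})))
    (trans (lemma x (product rpp x (- x) c c cs as) (product rpp x (- x) c (suc c) cs as))
    (cong₂ _*_ (sym (step-rpp-under 0ℤ (ℕP.<⇒≤ c<a))) (product-inverse x c c cs as c≤w (inj₁ refl) l′)))
    where
    lemma : ∀ x u v → 1ℤ * u + (1ℤ + x) * (0ℤ * v) ≡ 1ℤ * u
    lemma = solve-∀
  -- The first new cell lies under a cell of J, so it weighs -x from G and 1 + x from J, in total 1.
  -- The further cells lie under cells of G and weigh 1.
  ...     | inj₂ refl | inj₂ refl = trans
    (product-step rpp x (- x) c (suc c) c cs a as ℕP.≤-refl c≤w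
       (trans (step-rpp-free (- x) (ℕP.≤-refl {suc c}) c<a) (cong (- x *_) (step-rpp-under (- x) c<a)))
       (step-vst-under x c) (step-rpp-under (- x) c<a))
    (trans (lemma x _ _ (product-inverse x c c cs as c≤w (inj₁ refl) l′) (product-inverse x c (suc c) cs as c≤w (inj₂ refl) l′))
           (sym (cong (_* entry rpp 0ℤ c cs as) (step-rpp-under 0ℤ (ℕP.<⇒≤ c<a)))))
    where
    lemma : ∀ x u v {e} → u ≡ e → v ≡ e → - x * 1ℤ * u + (1ℤ + x) * (1ℤ * v) ≡ 1ℤ * e
    lemma x u v {e} refl refl = collapse x e
      where
      collapse : ∀ x e → - x * 1ℤ * e + (1ℤ + x) * (1ℤ * e) ≡ 1ℤ * e
      collapse = solve-∀

-- Coefficients of the transfer matrices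

newCellP : Mode → ℕ → Poly
newCellP md  (suc c) = 0ℤ ∷ 1ℤ ∷ []
newCellP rpp zero    = 1ℤ ∷ []
newCellP vst zero    = 1ℤ ∷ 1ℤ ∷ []

newCellsP : Mode → ℕ → ℕ → Poly
newCellsP md  c zero          = 1ℤ ∷ []
newCellsP rpp c (suc l)       = mulP (newCellP rpp c) (newCellsP rpp (ℕ.pred c) l)
newCellsP vst c (suc zero)    = newCellP vst c
newCellsP vst c (suc (suc l)) = []

stepP : Mode → ℕ → ℕ → ℕ → Poly
stepP md c       zero    a       = newCellsP md c a
stepP md (suc c) (suc b) (suc a) = stepP md c b a
stepP md zero    (suc b) a       = []
stepP md (suc c) (suc b) zero    = []

entryP : Mode → ℕ → List ℕ → List ℕ → Poly
entryP md c []       []       = 1ℤ ∷ []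
entryP md c (b ∷ bs) (a ∷ as) = mulP (stepP md c b a) (entryP md b bs as)
entryP md c _        _        = []

private
  eval-const : ∀ x → 1ℤ + x * 0ℤ ≡ 1ℤ
  eval-const = solve-∀

eval-newCellP : ∀ md c x → eval (newCellP md c) x ≡ newCell md x c
eval-newCellP md  (suc c) x = lemma x
  where
  lemma : ∀ x → 0ℤ + x * (1ℤ + x * 0ℤ) ≡ x
  lemma = solve-∀
eval-newCellP rpp zero    x = eval-const x
eval-newCellP vst zero    x = lemma x
  where
  lemma : ∀ x → 1ℤ + x * (1ℤ + x * 0ℤ) ≡ 1ℤ + x
  lemma = solve-∀

eval-newCellsP : ∀ md c l x → eval (newCellsP md c l) x ≡ newCells md x c l
eval-newCellsP md  c zero          x = eval-const x
eval-newCellsP rpp c (suc l)       x = trans (eval-mulP (newCellP rpp c) (newCellsP rpp (ℕ.pred c) l) x)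
  (cong₂ _*_ (eval-newCellP rpp c x) (eval-newCellsP rpp (ℕ.pred c) l x))
eval-newCellsP vst c (suc zero)    x = eval-newCellP vst c x
eval-newCellsP vst c (suc (suc l)) x = refl

eval-stepP : ∀ md c b a x → eval (stepP md c b a) x ≡ step md x c b a
eval-stepP md c       zero    a       x = eval-newCellsP md c a x
eval-stepP md (suc c) (suc b) (suc a) x = eval-stepP md c b a x
eval-stepP md zero    (suc b) a       x = refl
eval-stepP md (suc c) (suc b) zero    x = refl

eval-entryP : ∀ md c bs as x → eval (entryP md c bs as) x ≡ entry md x c bs as
eval-entryP md c []       []       x = eval-const x
eval-entryP md c (b ∷ bs) (a ∷ as) x = trans (eval-mulP (stepP md c b a) (entryP md b bs as) x)
  (cong₂ _*_ (eval-stepP md c b a x) (eval-entryP md b bs as x))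
eval-entryP md c []       (a ∷ as) x = refl
eval-entryP md c (b ∷ bs) []       x = refl

length-newCellP : ∀ md c → length (newCellP md c) ≤ 2
length-newCellP md  (suc c) = ℕP.≤-refl
length-newCellP rpp zero    = s≤s z≤n
length-newCellP vst zero    = ℕP.≤-refl

length-newCellsP : ∀ md c l → length (newCellsP md c l) ≤ suc l
length-newCellsP md  c zero          = ℕP.≤-refl
length-newCellsP rpp c (suc l)       = length-mulP (newCellP rpp c) (newCellsP rpp (ℕ.pred c) l) 1 l
  (length-newCellP rpp c) (length-newCellsP rpp (ℕ.pred c) l)
length-newCellsP vst c (suc zero)    = length-newCellP vst c
length-newCellsP vst c (suc (suc l)) = z≤n

length-stepP : ∀ md c b a → length (stepP md c b a) ≤ suc a
length-stepP md c       zero    a       = length-newCellsP md c a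
length-stepP md (suc c) (suc b) (suc a) = ℕP.m≤n⇒m≤1+n (length-stepP md c b a)
length-stepP md zero    (suc b) a       = z≤n
length-stepP md (suc c) (suc b) zero    = z≤n

length-entryP : ∀ md c bs as → length (entryP md c bs as) ≤ suc (size as)
length-entryP md c []       []       = ℕP.≤-refl
length-entryP md c (b ∷ bs) (a ∷ as) = length-mulP (stepP md c b a) (entryP md b bs as) a (size as)
  (length-stepP md c b a) (length-entryP md b bs as)
length-entryP md c []       (a ∷ as) = z≤n
length-entryP md c (b ∷ bs) []       = z≤n

boxes-replicate-sound : ∀ m N → All (λ τ → length τ ≡ m × All (_≤ N) τ) (boxes (replicate m N))
boxes-replicate-sound zero    N = (refl , []) ∷ []
boxes-replicate-sound (suc m) N = All-concatMap _ (upTo (suc N)) (AllP.applyUpTo⁺₁ id (suc N) (λ { (s≤s i≤N) →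
  AllP.map⁺ (All.map (λ (l , b) → cong suc l , i≤N ∷ b) (boxes-replicate-sound m N)) }))

boxes-replicate-δ : ∀ m N κ (h : List ℕ → ℤ) → length κ ≡ m → All (_≤ N) κ →
  ∑ (boxes (replicate m N)) (λ τ → ind (κ ==ₗ τ) * h τ) ≡ h κ
boxes-replicate-δ zero    N []      h l b       = ∑-single (h [])
boxes-replicate-δ (suc m) N (k ∷ κ) h l (p ∷ b) = begin
  ∑ (boxes (N ∷ replicate m N)) (λ τ → ind ((k ∷ κ) ==ₗ τ) * h τ)
    ≡⟨ ∑-boxes-∷ N (replicate m N) (λ τ → ind ((k ∷ κ) ==ₗ τ) * h τ) ⟩
  ∑ (upTo (suc N)) (λ i → ∑ (boxes (replicate m N)) (λ τ → ind ((k == i) ∧ (κ ==ₗ τ)) * h (i ∷ τ)))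
    ≡⟨ ∑-cong (upTo (suc N)) (λ i → trans
         (∑-cong (boxes (replicate m N)) (λ τ → trans (cong (_* h (i ∷ τ)) (ind-∧ (k == i) (κ ==ₗ τ)))
           (ℤP.*-assoc (ind (k == i)) (ind (κ ==ₗ τ)) (h (i ∷ τ)))))
         (∑-*ˡ (ind (k == i)) (boxes (replicate m N)) (λ τ → ind (κ ==ₗ τ) * h (i ∷ τ)))) ⟩
  ∑ (upTo (suc N)) (λ i → ind (k == i) * ∑ (boxes (replicate m N)) (λ τ → ind (κ ==ₗ τ) * h (i ∷ τ)))
    ≡⟨ ∑-ind-upTo (suc N) k (λ i → ∑ (boxes (replicate m N)) (λ τ → ind (κ ==ₗ τ) * h (i ∷ τ))) (s≤s p) ⟩
  ∑ (boxes (replicate m N)) (λ τ → ind (κ ==ₗ τ) * h (k ∷ τ))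
    ≡⟨ boxes-replicate-δ m N κ (λ τ → h (k ∷ τ)) (ℕP.suc-injective l) b ⟩
  h (k ∷ κ) ∎

decreasing-bounded : ∀ c as → Decreasing c as → All (_≤ c) as
decreasing-bounded c []       d       = []
decreasing-bounded c (a ∷ as) (p , d) = p ∷ All.map (λ q → ℕP.≤-trans q p) (decreasing-bounded a as d)

-- Coefficient matrices and their action on functions of shapes

module Path (m w : ℕ) where
  open Product w using (product; exchange₀; product-inverse)

  D : List (List ℕ)
  D = boxes (replicate m (suc w))

  D-length : All (λ b → length b ≡ m) D
  D-length = All.map proj₁ (boxes-replicate-sound m (suc w))

  record Shape (a : List ℕ) : Set where
    constructor shape
    field
      rows       : length a ≡ m
      decreasing : Decreasing w a
  open Shape

  D-δ : ∀ {a} → Shape a → (h : List ℕ → ℤ) → ∑ D (λ b → ind (a ==ₗ b) * h b) ≡ h a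
  D-δ {a} s h = boxes-replicate-δ m (suc w) a h (rows s)
    (All.map ℕP.m≤n⇒m≤1+n (decreasing-bounded w a (decreasing s)))

  M : Mode → ℕ → List ℕ → List ℕ → ℤ
  M md n b a = coef (entryP md w b a) n

  M-zero : ∀ md n b a → ¬ Decreasing w b → M md n b a ≡ 0ℤ
  M-zero md n b a ¬d = eval-zero (entryP md w b a)
    (λ k → trans (eval-entryP md w b a (ℤ.+ suc k)) (entry-¬decreasing md (ℤ.+ suc k) w b a ¬d)) n

  M-0 : ∀ md b {a} → Shape a → length b ≡ m → M md 0 b a ≡ ind (b ==ₗ a)
  M-0 md b {a} s l = trans (sym (eval-0 (entryP md w b a))) (trans (eval-entryP md w b a 0ℤ)
    (entry-0 md w b a (decreasing s) (trans l (sym (rows s)))))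

  product-∑D : ∀ md x y {a} → Shape a → ∀ c →
    product md x y w w c a ≡ ∑ D (λ b → entry vst x w c b * entry md y w b a)
  product-∑D md x y {a} s c = cong (λ k → ∑ (boxes (replicate k (suc w))) (λ b → entry vst x w c b * entry md y w b a)) (rows s)

  -- The symmetry holds at all integers x and y. First the coefficient of xⁿ is taken at fixed y
  -- (`evals`), then the coefficient of yᵏ.
  M-comm : ∀ {a} → Shape a → ∀ c → length c ≡ m → ∀ n k →
    ∑ D (λ b → M vst n c b * M vst k b a) ≡ ∑ D (λ b → M vst k c b * M vst n b a)
  M-comm {a} s c l n k = trans (sym (coef-combP D (M vst n c) (λ b → entryP vst w b a) k)) (trans
    (eval-injective (Σ₁ n) (Σ₂ n) (λ j → evals n (ℤ.+ suc j)) k)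
    (trans (coef-combP D (λ b → M vst n b a) (entryP vst w c) k) (∑-cong D (λ b → ℤP.*-comm (M vst n b a) (M vst k c b)))))
    where
    Σ₁ Σ₂ : ℕ → Poly
    Σ₁ n = combP D (M vst n c) (λ b → entryP vst w b a)
    Σ₂ n = combP D (λ b → M vst n b a) (entryP vst w c)
    evals : ∀ n y → eval (Σ₁ n) y ≡ eval (Σ₂ n) y
    evals n y = begin
      eval (Σ₁ n) y ≡⟨ eval-combP D (M vst n c) (λ b → entryP vst w b a) y ⟩
      ∑ D (λ b → M vst n c b * eval (entryP vst w b a) y)
        ≡⟨ ∑-cong D (λ b → trans (cong (M vst n c b *_) (eval-entryP vst w b a y)) (ℤP.*-comm (M vst n c b) (entry vst y w b a))) ⟩
      ∑ D (λ b → entry vst y w b a * M vst n c b) ≡⟨ sym (coef-combP D (λ b → entry vst y w b a) (entryP vst w c) n) ⟩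
      coef Π₁ n ≡⟨ eval-injective Π₁ Π₂ (λ j → inner (ℤ.+ suc j)) n ⟩
      coef Π₂ n ≡⟨ coef-combP D (entry vst y w c) (λ b → entryP vst w b a) n ⟩
      ∑ D (λ b → entry vst y w c b * M vst n b a)
        ≡⟨ ∑-cong D (λ b → sym (trans (cong (M vst n b a *_) (eval-entryP vst w c b y)) (ℤP.*-comm (M vst n b a) (entry vst y w c b)))) ⟩
      ∑ D (λ b → M vst n b a * eval (entryP vst w c b) y) ≡⟨ sym (eval-combP D (λ b → M vst n b a) (entryP vst w c) y) ⟩
      eval (Σ₂ n) y ∎
      where
      Π₁ Π₂ : Poly
      Π₁ = combP D (λ b → entry vst y w b a) (entryP vst w c)
      Π₂ = combP D (entry vst y w c) (λ b → entryP vst w b a)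
      inner : ∀ x → eval Π₁ x ≡ eval Π₂ x
      inner x = begin
        eval Π₁ x ≡⟨ eval-combP D (λ b → entry vst y w b a) (entryP vst w c) x ⟩
        ∑ D (λ b → entry vst y w b a * eval (entryP vst w c b) x)
          ≡⟨ ∑-cong D (λ b → trans (cong (entry vst y w b a *_) (eval-entryP vst w c b x)) (ℤP.*-comm (entry vst y w b a) (entry vst x w c b))) ⟩
        ∑ D (λ b → entry vst x w c b * entry vst y w b a) ≡⟨ sym (product-∑D vst x y s c) ⟩
        product vst x y w w c a ≡⟨ exchange₀ x y w c a ℕP.≤-refl (trans l (sym (rows s))) (decreasing s) ⟩
        product vst y x w w c a ≡⟨ product-∑D vst y x s c ⟩
        ∑ D (λ b → entry vst y w c b * entry vst x w b a) ≡⟨ ∑-cong D (λ b → cong (entry vst y w c b *_) (sym (eval-entryP vst w b a x))) ⟩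
        ∑ D (λ b → entry vst y w c b * eval (entryP vst w b a) x) ≡⟨ sym (eval-combP D (entry vst y w c) (λ b → entryP vst w b a) x) ⟩
        eval Π₂ x ∎

  -- The coefficient of xⁿ in J(x) G(-x)
  cauchy : ℕ → List ℕ → List ℕ → ℤ
  cauchy n c a = ∑ (upTo (suc n)) (λ i → ∑ D (λ b → M vst i c b * (sgn (n ∸ i) * M rpp (n ∸ i) b a)))

  -- By `product-inverse` the product J(x) G(-x) agrees with a constant polynomial, so its
  -- coefficients in positive degree vanish.
  M-inverse : ∀ {a} → Shape a → ∀ c → length c ≡ m → ∀ n → cauchy (suc n) c a ≡ 0ℤ
  M-inverse {a} s c l n = begin
    cauchy (suc n) c a
      ≡⟨ ∑-swap (upTo (suc (suc n))) D (λ i b → M vst i c b * (sgn (suc n ∸ i) * M rpp (suc n ∸ i) b a)) ⟩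
    ∑ D (λ b → ∑ (upTo (suc (suc n))) (λ i → M vst i c b * (sgn (suc n ∸ i) * M rpp (suc n ∸ i) b a)))
      ≡⟨ ∑-cong D (λ b → sym (trans (coef-mulP (entryP vst w c b) (negVar (entryP rpp w b a)) (suc n))
           (∑-cong (upTo (suc (suc n))) (λ i → cong (M vst i c b *_) (coef-negVar (entryP rpp w b a) (suc n ∸ i)))))) ⟩
    ∑ D (λ b → coef (mulP (entryP vst w c b) (negVar (entryP rpp w b a))) (suc n))
      ≡⟨ sym (coef-sumP D P (suc n)) ⟩
    coef (sumP D P) (suc n) ≡⟨ eval-injective (sumP D P) (entry rpp 0ℤ w c a ∷ []) (λ j → evals (ℤ.+ suc j)) (suc n) ⟩
    0ℤ ∎
    where
    P : List ℕ → Poly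
    P b = mulP (entryP vst w c b) (negVar (entryP rpp w b a))
    evals : ∀ x → eval (sumP D P) x ≡ entry rpp 0ℤ w c a + x * 0ℤ
    evals x = begin
      eval (sumP D P) x ≡⟨ eval-sumP D P x ⟩
      ∑ D (λ b → eval (P b) x)
        ≡⟨ ∑-cong D (λ b → trans (eval-mulP (entryP vst w c b) (negVar (entryP rpp w b a)) x)
             (cong₂ _*_ (eval-entryP vst w c b x) (trans (eval-negVar (entryP rpp w b a) x) (eval-entryP rpp w b a (- x))))) ⟩
      ∑ D (λ b → entry vst x w c b * entry rpp (- x) w b a) ≡⟨ sym (product-∑D rpp x (- x) s c) ⟩
      product rpp x (- x) w w c a ≡⟨ product-inverse x w w c a ℕP.≤-refl (inj₁ refl) (trans l (sym (rows s))) ⟩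
      entry rpp 0ℤ w c a ≡⟨ pad (entry rpp 0ℤ w c a) x ⟩
      entry rpp 0ℤ w c a + x * 0ℤ ∎
      where
      pad : ∀ e x → e ≡ e + x * 0ℤ
      pad = solve-∀

  act : Mode → (List ℕ → ℤ) → ℕ → List ℕ → ℤ
  act md v n a = ∑ D (λ b → v b * M md n b a)

  path : Mode → (List ℕ → ℤ) → List ℕ → List ℕ → ℤ
  path md = foldl (act md)

  -- Values outside the shapes are irrelevant, since there the matrix entry is 0. This lets
  -- identities valid only at shapes be used inside a `path`.
  act-cong : ∀ md {u v} → (∀ {b} → Shape b → u b ≡ v b) → ∀ n a → act md u n a ≡ act md v n a
  act-cong md {u} {v} h n a = ∑-congᴬ (All.map (λ {b} l → term b l) D-length)
    where
    term : ∀ b → length b ≡ m → u b * M md n b a ≡ v b * M md n b a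
    term b l with decreasing? w b
    ... | yes d = cong (_* M md n b a) (h (shape l d))
    ... | no ¬d = trans (cong (u b *_) (M-zero md n b a ¬d)) (trans (ℤP.*-zeroʳ (u b))
                    (sym (trans (cong (v b *_) (M-zero md n b a ¬d)) (ℤP.*-zeroʳ (v b)))))

  path-cong : ∀ md τ {u v} → (∀ {b} → Shape b → u b ≡ v b) → ∀ {a} → Shape a → path md u τ a ≡ path md v τ a
  path-cong md []      h s = h s
  path-cong md (n ∷ τ) h s = path-cong md τ (λ {b} _ → act-cong md h n b) s

  act-act : ∀ md md′ v n k a →
    act md′ (act md v n) k a ≡ ∑ D (λ c → v c * ∑ D (λ b → M md n c b * M md′ k b a))
  act-act md md′ v n k a = ∑-pull D D v (M md n) (λ b → M md′ k b a)

  act-comm : ∀ v n k {a} → Shape a → act vst (act vst v n) k a ≡ act vst (act vst v k) n a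
  act-comm v n k {a} s = trans (act-act vst vst v n k a) (trans
    (∑-congᴬ (All.map (λ {c} l → cong (v c *_) (M-comm s c l n k)) D-length))
    (sym (act-act vst vst v k n a)))

  -- This is the symmetry of j: the coefficient matrices of J commute, so the order of the exponents
  -- does not matter.
  path-↭ : ∀ {τ τ′} → τ ↭ τ′ → ∀ v {a} → Shape a → path vst v τ a ≡ path vst v τ′ a
  path-↭ Perm.refl         v s = refl
  path-↭ (prep x p)        v s = path-↭ p (act vst v x) s
  path-↭ (swap {xs} x y p) v s = trans
    (path-cong vst xs (λ s′ → act-comm v x y s′) s) (path-↭ p (act vst (act vst v y) x) s)
  path-↭ (Perm.trans p q)  v s = trans (path-↭ p v s) (path-↭ q v s)

  act-0 : ∀ v {a} → Shape a → act rpp v 0 a ≡ v a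
  act-0 v {a} s = trans (∑-congᴬ (All.map (λ {b} l → trans (cong (v b *_) (trans (M-0 rpp b s l)
      (cong ind (==ₗ-sym b a)))) (ℤP.*-comm (v b) (ind (a ==ₗ b)))) D-length)) (D-δ s v)

  -- J_0 is known to be the identity only towards decreasing `b`; for every other `b` the factor
  -- from G is 0.
  M-vst-0-rpp : ∀ n c a → length c ≡ m → All (_≤ suc w) c → ∑ D (λ b → M vst 0 c b * M rpp n b a) ≡ M rpp n c a
  M-vst-0-rpp n c a l bd = trans (∑-congᴬ (All.map (λ {b} l′ → term b l′) D-length))
                          (boxes-replicate-δ m (suc w) c (λ b → M rpp n b a) l bd)
    where
    term : ∀ b → length b ≡ m → M vst 0 c b * M rpp n b a ≡ ind (c ==ₗ b) * M rpp n b a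
    term b l′ with decreasing? w b
    ... | yes d = cong (_* M rpp n b a) (M-0 vst c (shape l′ d) l)
    ... | no ¬d = trans (cong (M vst 0 c b *_) (M-zero rpp n b a ¬d)) (trans (ℤP.*-zeroʳ (M vst 0 c b))
                    (sym (trans (cong (ind (c ==ₗ b) *_) (M-zero rpp n b a ¬d)) (ℤP.*-zeroʳ (ind (c ==ₗ b))))))

  -- The coefficient of degree `suc n` of v J(x) G(-x) is 0. Its term with J_0, the identity, is `Y`
  -- and moves to the right-hand side.
  act-inverse : ∀ v n {a} → Shape a →
    ∑ (upTo (suc n)) (λ i → sgn (n ∸ i) * act rpp (act vst v (suc i)) (n ∸ i) a) ≡ - (sgn (suc n) * act rpp v (suc n) a)
  act-inverse v n {a} s = begin
    X ≡⟨ isolate Y X ⟩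
    (Y + X) + - Y ≡⟨ cong (_+ - Y) (trans (sym total) (∑-≡0ᴬ (All.map (λ {c} l → vanishing c l) D-length))) ⟩
    0ℤ + - Y ≡⟨ ℤP.+-identityˡ (- Y) ⟩
    - Y ∎
    where
    X Y : ℤ
    X = ∑ (upTo (suc n)) (λ i → sgn (n ∸ i) * act rpp (act vst v (suc i)) (n ∸ i) a)
    Y = sgn (suc n) * act rpp v (suc n) a
    isolate : ∀ y x → x ≡ (y + x) + - y
    isolate = solve-∀
    Z : ℕ → List ℕ → ℤ
    Z i c = v c * ∑ D (λ b → M vst i c b * (sgn (suc n ∸ i) * M rpp (suc n ∸ i) b a))
    pull : ∀ s (f g : List ℕ → ℤ) → ∑ D (λ b → f b * (s * g b)) ≡ s * ∑ D (λ b → f b * g b)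
    pull s f g = trans (∑-cong D (λ b → *-swapˡ (f b) s (g b))) (∑-*ˡ s D (λ b → f b * g b))
    later : ∀ i → ∑ D (Z (suc i)) ≡ sgn (n ∸ i) * act rpp (act vst v (suc i)) (n ∸ i) a
    later i = begin
      ∑ D (λ c → v c * ∑ D (λ b → M vst (suc i) c b * (sgn (n ∸ i) * M rpp (n ∸ i) b a)))
        ≡⟨ ∑-cong D (λ c → cong (v c *_) (pull (sgn (n ∸ i)) (M vst (suc i) c) (λ b → M rpp (n ∸ i) b a))) ⟩
      ∑ D (λ c → v c * (sgn (n ∸ i) * ∑ D (λ b → M vst (suc i) c b * M rpp (n ∸ i) b a)))
        ≡⟨ pull (sgn (n ∸ i)) v (λ c → ∑ D (λ b → M vst (suc i) c b * M rpp (n ∸ i) b a)) ⟩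
      sgn (n ∸ i) * ∑ D (λ c → v c * ∑ D (λ b → M vst (suc i) c b * M rpp (n ∸ i) b a))
        ≡⟨ cong (sgn (n ∸ i) *_) (sym (act-act vst rpp v (suc i) (n ∸ i) a)) ⟩
      sgn (n ∸ i) * act rpp (act vst v (suc i)) (n ∸ i) a ∎
    first : ∑ D (Z 0) ≡ Y
    first = trans (∑-congᴬ (All.map (λ {c} (l , bd) → cong (v c *_) (trans
        (pull (sgn (suc n)) (M vst 0 c) (λ b → M rpp (suc n) b a))
        (cong (sgn (suc n) *_) (M-vst-0-rpp (suc n) c a l bd)))) (boxes-replicate-sound m (suc w))))
      (pull (sgn (suc n)) v (λ c → M rpp (suc n) c a))
    total : ∑ D (λ c → v c * cauchy (suc n) c a) ≡ Y + X
    total = begin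
      ∑ D (λ c → v c * cauchy (suc n) c a)
        ≡⟨ ∑-cong D (λ c → sym (∑-*ˡ (v c) (upTo (suc (suc n))) (λ i → ∑ D (λ b → M vst i c b * (sgn (suc n ∸ i) * M rpp (suc n ∸ i) b a))))) ⟩
      ∑ D (λ c → ∑ (upTo (suc (suc n))) (λ i → Z i c)) ≡⟨ ∑-swap D (upTo (suc (suc n))) (λ c i → Z i c) ⟩
      ∑ (upTo (suc (suc n))) (λ i → ∑ D (Z i)) ≡⟨ ∑-upTo-suc (suc n) (λ i → ∑ D (Z i)) ⟩
      ∑ D (Z 0) + ∑ (upTo (suc n)) (λ i → ∑ D (Z (suc i))) ≡⟨ cong₂ _+_ first (∑-cong (upTo (suc n)) later) ⟩
      Y + X ∎
    vanishing : ∀ c → length c ≡ m →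
      v c * cauchy (suc n) c a ≡ 0ℤ
    vanishing c l = trans (cong (v c *_) (M-inverse s c l n)) (ℤP.*-zeroʳ (v c))

  -- This is the expansion of J(x)⁻¹ = G(-x) as a geometric series in J(x) - 1. Splitting off the
  -- first part of a composition reduces it to `act-inverse`; `N` bounds `n` for the induction.
  ∑-comps-path : ∀ N n → n ≤ N → ∀ v {a} → Shape a →
    ∑ (comps n) (λ α → sign α * path vst v α a) ≡ sgn n * act rpp v n a
  ∑-comps-path N zero le v {a} s = trans (ℤP.+-identityʳ (1ℤ * v a)) (cong (1ℤ *_) (sym (act-0 v s)))
  ∑-comps-path (suc N) (suc n) (s≤s le) v {a} s = begin
    ∑ (comps (suc n)) (λ α → sign α * path vst v α a)
      ≡⟨ ∑-comps-suc n (λ α → sign α * path vst v α a) ⟩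
    ∑ (upTo (suc n)) (λ i → ∑ (comps (n ∸ i)) (λ α → - sign α * path vst (act vst v (suc i)) α a))
      ≡⟨ ∑-cong (upTo (suc n)) (λ i → begin
           ∑ (comps (n ∸ i)) (λ α → - sign α * path vst (act vst v (suc i)) α a)
             ≡⟨ ∑-cong (comps (n ∸ i)) (λ α → sym (ℤP.neg-distribˡ-* (sign α) (path vst (act vst v (suc i)) α a))) ⟩
           ∑ (comps (n ∸ i)) (λ α → - (sign α * path vst (act vst v (suc i)) α a))
             ≡⟨ ∑-neg (comps (n ∸ i)) (λ α → sign α * path vst (act vst v (suc i)) α a) ⟩
           - ∑ (comps (n ∸ i)) (λ α → sign α * path vst (act vst v (suc i)) α a)
             ≡⟨ cong -_ (∑-comps-path N (n ∸ i) (ℕP.≤-trans (ℕP.m∸n≤m n i) le) (act vst v (suc i)) s) ⟩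
           - (sgn (n ∸ i) * act rpp (act vst v (suc i)) (n ∸ i) a) ∎) ⟩
    ∑ (upTo (suc n)) (λ i → - (sgn (n ∸ i) * act rpp (act vst v (suc i)) (n ∸ i) a))
      ≡⟨ ∑-neg (upTo (suc n)) (λ i → sgn (n ∸ i) * act rpp (act vst v (suc i)) (n ∸ i) a) ⟩
    - ∑ (upTo (suc n)) (λ i → sgn (n ∸ i) * act rpp (act vst v (suc i)) (n ∸ i) a)
      ≡⟨ cong -_ (act-inverse v n s) ⟩
    - - (sgn (suc n) * act rpp v (suc n) a) ≡⟨ ℤP.neg-involutive (sgn (suc n) * act rpp v (suc n) a) ⟩
    sgn (suc n) * act rpp v (suc n) a ∎

  path-∑ : ∀ md τ (xs : List A) (c : A → ℤ) (u : A → List ℕ → ℤ) {a} → Shape a →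
    path md (λ b → ∑ xs (λ x → c x * u x b)) τ a ≡ ∑ xs (λ x → c x * path md (u x) τ a)
  path-∑ md []      xs c u s = refl
  path-∑ md (n ∷ τ) xs c u s = trans
    (path-cong md τ (λ {b} _ → ∑-pull xs D c u (λ b′ → M md n b′ b)) s) (path-∑ md τ xs c (λ x → act md (u x) n) s)

  sgn-+ : ∀ i j → sgn (i ℕ.+ j) ≡ sgn i * sgn j
  sgn-+ zero    j = sym (ℤP.*-identityˡ (sgn j))
  sgn-+ (suc i) j = trans (cong -_ (sgn-+ i j)) (ℤP.neg-distribˡ-* (sgn i) (sgn j))

  path-scale : ∀ md τ k u {a} → Shape a → path md (λ b → k * u b) τ a ≡ k * path md u τ a
  path-scale md τ k u {a} s = begin
    path md (λ b → k * u b) τ a ≡⟨ path-cong md τ (λ {b} _ → sym (ℤP.+-identityʳ (k * u b))) s ⟩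
    path md (λ b → k * u b + 0ℤ) τ a ≡⟨ path-∑ md τ (tt ∷ []) (λ _ → k) (λ _ → u) s ⟩
    k * path md u τ a + 0ℤ ≡⟨ ℤP.+-identityʳ (k * path md u τ a) ⟩
    k * path md u τ a ∎

  -- The later blocks are summed first, from the starting vector left by the first block. Since
  -- `path` is linear in its start, the sum over the first block can then be moved inside and
  -- evaluated.
  ∑-refinements-path : ∀ β v {a} → Shape a →
    ∑ (refinements β) (λ α → sign α * path vst v α a) ≡ sgn (size β) * path rpp v β a
  ∑-refinements-path []      v {a} s = ℤP.+-identityʳ (1ℤ * v a)
  ∑-refinements-path (b ∷ β) v {a} s = begin
    ∑ (refinements (b ∷ β)) (λ α → sign α * path vst v α a)
      ≡⟨ ∑-refinements-∷ b β (λ α → sign α * path vst v α a) ⟩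
    ∑ C (λ α → ∑ (refinements β) (λ α′ → sign (α ++ α′) * path vst v (α ++ α′) a))
      ≡⟨ ∑-cong C (λ α → trans (∑-cong (refinements β) (λ α′ → trans
           (cong₂ _*_ (sign-++ α α′) (cong (λ f → f a) (LP.foldl-++ (act vst) v α α′)))
           (ℤP.*-assoc (sign α) (sign α′) (path vst (path vst v α) α′ a))))
         (∑-*ˡ (sign α) (refinements β) (λ α′ → sign α′ * path vst (path vst v α) α′ a))) ⟩
    ∑ C (λ α → sign α * ∑ (refinements β) (λ α′ → sign α′ * path vst (path vst v α) α′ a))
      ≡⟨ ∑-cong C (λ α → cong (sign α *_) (∑-refinements-path β (path vst v α) s)) ⟩
    ∑ C (λ α → sign α * (sgn (size β) * path rpp (path vst v α) β a))
      ≡⟨ ∑-cong C (λ α → *-swapˡ (sign α) (sgn (size β)) (path rpp (path vst v α) β a)) ⟩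
    ∑ C (λ α → sgn (size β) * (sign α * path rpp (path vst v α) β a))
      ≡⟨ ∑-*ˡ (sgn (size β)) C (λ α → sign α * path rpp (path vst v α) β a) ⟩
    sgn (size β) * ∑ C (λ α → sign α * path rpp (path vst v α) β a)
      ≡⟨ cong (sgn (size β) *_) (sym (path-∑ rpp β C (λ α → sign α) (path vst v) s)) ⟩
    sgn (size β) * path rpp (λ c → ∑ C (λ α → sign α * path vst v α c)) β a
      ≡⟨ cong (sgn (size β) *_) (path-cong rpp β (λ s′ → ∑-comps-path b b ℕP.≤-refl v s′) s) ⟩
    sgn (size β) * path rpp (λ c → sgn b * act rpp v b c) β a
      ≡⟨ cong (sgn (size β) *_) (path-scale rpp β (sgn b) (act rpp v b) s) ⟩
    sgn (size β) * (sgn b * path rpp (act rpp v b) β a)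
      ≡⟨ trans (sym (ℤP.*-assoc (sgn (size β)) (sgn b) (path rpp (act rpp v b) β a)))
           (cong (_* path rpp (act rpp v b) β a) (trans (ℤP.*-comm (sgn (size β)) (sgn b)) (sym (sgn-+ b (size β))))) ⟩
    sgn (size (b ∷ β)) * path rpp v (b ∷ β) a ∎
    where
    C : List (List ℕ)
    C = comps b

sortDesc-positive : ∀ {α} → All (1 ≤_) α → sortDesc α ↭ α
sortDesc-positive []                    = ↭-refl
sortDesc-positive {suc x ∷ α} (p ∷ ps) = ↭-trans (insertDesc-↭ (suc x) (sortDesc α)) (prep (suc x) (sortDesc-positive ps))

compsF-sound : ∀ f n → All (λ α → size α ≡ n × All (1 ≤_) α) (compsF f n)
compsF-sound f       zero    = (refl , []) ∷ []
compsF-sound zero    (suc n) = []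
compsF-sound (suc f) (suc n) = All-concatMap _ (upTo (suc n)) (AllP.applyUpTo⁺₁ id (suc n) (λ { {i} (s≤s i≤n) →
  AllP.map⁺ (All.map (λ (e , p) → cong suc (trans (cong (i ℕ.+_) e) (ℕP.m+[n∸m]≡n i≤n)) , s≤s z≤n ∷ p) (compsF-sound f (n ∸ i))) }))

refinements-sound : ∀ β → All (λ α → size α ≡ size β × All (1 ≤_) α) (refinements β)
refinements-sound []      = (refl , []) ∷ []
refinements-sound (b ∷ β) = All-concatMap _ (comps b) (All.map (λ {α} (e , p) → AllP.map⁺ (All.map (λ {α′} (e′ , p′) →
  trans (size-++ α α′) (cong₂ ℕ._+_ e e′) , AllP.++⁺ p p′) (refinements-sound β))) (compsF-sound b b))

-- Removing the largest letter of a tableau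

Letter : ℕ → ℕ → Set
Letter k r = 1 ≤ r × r ≤ k

oneTo-sound : ∀ k → All (Letter k) (oneTo k)
oneTo-sound k = AllP.applyUpTo⁺₁ suc k (λ i<k → s≤s z≤n , i<k)

words-sound : ∀ k l → All (λ w → length w ≡ l × All (Letter k) w) (words k l)
words-sound k zero    = (refl , []) ∷ []
words-sound k (suc l) = All-concatMap _ (oneTo k) (All.map (λ lr →
  AllP.map⁺ (All.map (λ (e , ls) → cong suc e , lr ∷ ls) (words-sound k l))) (oneTo-sound k))

∑-oneTo-∷ʳ : ∀ k (f : ℕ → ℤ) → ∑ (oneTo (suc k)) f ≡ ∑ (oneTo k) f + f (suc k)
∑-oneTo-∷ʳ k f = begin
  ∑ (oneTo (suc k)) f ≡⟨ ∑-applyUpTo suc (suc k) f ⟩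
  ∑ (upTo (suc k)) (λ i → f (suc i)) ≡⟨ ∑-upTo-∷ʳ k (λ i → f (suc i)) ⟩
  ∑ (upTo k) (λ i → f (suc i)) + f (suc k) ≡⟨ cong (_+ f (suc k)) (sym (∑-applyUpTo suc k f)) ⟩
  ∑ (oneTo k) f + f (suc k) ∎

∑-upTo-extend : ∀ l n (f : ℕ → ℤ) → l ≤ n → (∀ b → l < b → f b ≡ 0ℤ) → ∑ (upTo (suc l)) f ≡ ∑ (upTo (suc n)) f
∑-upTo-extend zero    n       f le h = begin
  f 0 + 0ℤ ≡⟨ cong (f 0 +_) (sym (∑-≡0 (upTo n) (λ i → h (suc i) (s≤s z≤n)))) ⟩
  f 0 + ∑ (upTo n) (λ i → f (suc i)) ≡⟨ sym (∑-upTo-suc n f) ⟩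
  ∑ (upTo (suc n)) f ∎
∑-upTo-extend (suc l) (suc n) f (s≤s le) h = trans (∑-upTo-suc (suc l) f) (trans
  (cong (f 0 +_) (∑-upTo-extend l n (λ i → f (suc i)) le (λ b lt → h (suc b) (s≤s lt))))
  (sym (∑-upTo-suc (suc n) f)))

rel : Mode → ℕ → ℕ → Bool
rel rpp p r = p ≤ᵇ r
rel vst p r = p <ᵇ r

module Tableaux (md : Mode) (X : ℕ → ℤ) where

  cell : ℕ → ℕ → ℤ
  cell y r = if y == r then newCell md (X r) 0 else X r

  -- With the row above `ys` and the left neighbour `p` as parameters, both the tableau conditions
  -- and the weight become products over cells. A start at 0 and a first row above of zeros impose
  -- nothing on letters that are at least 1.
  rowWeight : List ℕ → ℕ → List ℕ → ℤ
  rowWeight ys       p []       = 1ℤ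
  rowWeight (y ∷ ys) p (r ∷ rs) = ind (rel md p r) * (ind (y ≤ᵇ r) * cell y r * rowWeight ys r rs)
  rowWeight []       p (r ∷ rs) = 0ℤ

  Z : ℕ → List ℕ → List ℕ → ℤ
  Z k ys []       = 1ℤ
  Z k ys (l ∷ ls) = ∑ (words k l) (λ w → rowWeight ys 0 w * Z k w ls)

  module Peel (k : ℕ) where

    K : ℕ
    K = suc k

    rel-K : ∀ p → p ≤ k → rel md p K ≡ true
    rel-K p p≤k = go md
      where
      go : ∀ md → rel md p K ≡ true
      go rpp = ≤ᵇ-true (ℕP.m≤n⇒m≤1+n p≤k)
      go vst = ≤ᵇ-true (s≤s p≤k)

    cell-K : ∀ {y} → y ≤ k → ind (y ≤ᵇ K) * cell y K ≡ X K
    cell-K {y} y≤k = trans (cong₂ (λ a b → ind a * (if b then newCell md (X K) 0 else X K))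
        (≤ᵇ-true (ℕP.m≤n⇒m≤1+n y≤k)) (==-false (ℕP.<⇒≢ (s≤s y≤k)))) (ℤP.*-identityˡ (X K))

    cell-KK : ind (K ≤ᵇ K) * cell K K ≡ newCell md (X K) 0
    cell-KK = trans (cong₂ (λ a b → ind a * (if b then newCell md (X K) 0 else X K))
        (≤ᵇ-true (ℕP.≤-refl {K})) (==-refl K)) (ℤP.*-identityˡ (newCell md (X K) 0))

    expand : ∀ l (f : List ℕ → ℤ) p a as r {c} → ind (rel md p r) * (ind (a ≤ᵇ r) * cell a r) ≡ c →
      ∑ (words K l) (λ w → rowWeight (a ∷ as) p (r ∷ w) * f (r ∷ w)) ≡ c * ∑ (words K l) (λ w → rowWeight as r w * f (r ∷ w))
    expand l f p a as r {c} e = trans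
      (∑-cong (words K l) (λ w → trans (lemma (ind (rel md p r)) (ind (a ≤ᵇ r) * cell a r) (rowWeight as r w) (f (r ∷ w)))
        (cong (_* (rowWeight as r w * f (r ∷ w))) e)))
      (∑-*ˡ c (words K l) (λ w → rowWeight as r w * f (r ∷ w)))
      where
      lemma : ∀ i c r f → i * (c * r) * f ≡ i * c * (r * f)
      lemma = solve-∀

    not-after-K : ∀ as r w → rel md K r ≡ false → rowWeight as K (r ∷ w) ≡ 0ℤ
    not-after-K []       r w e = refl
    not-after-K (a ∷ as) r w e = cong (λ z → ind z * (ind (a ≤ᵇ r) * cell a r * rowWeight as r w)) e

    -- After its first K a row consists of letters K only; for vst it ends there.
    first-K : ∀ ys e p l (f : List ℕ → ℤ) → All (_≤ k) ys → rel md p K ≡ true → suc l ≤ length ys ℕ.+ e →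
      ∑ (words K l) (λ w → rowWeight (ys ++ replicate e K) p (K ∷ w) * f (K ∷ w)) ≡
      newCells md (X K) (length ys) (suc l) * f (replicate (suc l) K)

    -- Here `c` describes the K just placed and `ys` the small letters that remain above its right.
    -- Either the K was under a small letter, `c` = `suc (length ys)`, or under another K, `c` = 0
    -- and `ys` is empty; `pred` covers both.
    after-K : ∀ ys e l (f : List ℕ → ℤ) → All (_≤ k) ys → l ≤ length ys ℕ.+ e → ∀ c → ℕ.pred c ≡ length ys →
      newCell md (X K) c * ∑ (words K l) (λ w → rowWeight (ys ++ replicate e K) K w * f w) ≡
      newCells md (X K) c (suc l) * f (replicate l K)

    first-K (y ∷ ys) e       p l f (q ∷ qs) rp (s≤s le) = trans
      (expand l f p y (ys ++ replicate e K) K (trans (cong₂ (λ i j → ind i * j) rp (cell-K q)) (ℤP.*-identityˡ (X K))))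
      (after-K ys e l (λ w → f (K ∷ w)) qs le (suc (length ys)) refl)
    first-K []       (suc e) p l f []       rp (s≤s le) = trans
      (expand l f p K (replicate e K) K (trans (cong₂ (λ i j → ind i * j) rp cell-KK) (ℤP.*-identityˡ (newCell md (X K) 0))))
      (after-K [] e l (λ w → f (K ∷ w)) [] le 0 refl)

    after-K ys e l f b le c eq = go md refl l le
      where
      as : List ℕ
      as = ys ++ replicate e K
      go : ∀ md′ → md ≡ md′ → ∀ l → l ≤ length ys ℕ.+ e →
        newCell md (X K) c * ∑ (words K l) (λ w → rowWeight as K w * f w) ≡ newCells md (X K) c (suc l) * f (replicate l K)
      go rpp refl zero    le = trans (cong (newCell rpp (X K) c *_) (∑-single (f [])))
        (cong (_* f []) (sym (ℤP.*-identityʳ (newCell rpp (X K) c))))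
      go rpp refl (suc l) le = begin
        newCell rpp (X K) c * ∑ (words K (suc l)) (λ w → rowWeight as K w * f w)
          ≡⟨ cong (newCell rpp (X K) c *_) (trans (∑-∷ (λ _ → words K l) (oneTo K) (λ w → rowWeight as K w * f w)) (∑-oneTo-∷ʳ k g)) ⟩
        newCell rpp (X K) c * (∑ (oneTo k) g + g K)
          ≡⟨ cong (newCell rpp (X K) c *_) (cong₂ _+_
               (∑-≡0ᴬ (All.map (λ {r} (_ , r≤k) → ∑-≡0 (words K l) (λ w →
                 cong (_* f (r ∷ w)) (not-after-K as r w (≤ᵇ-false (ℕP.<⇒≱ (s≤s r≤k)))))) (oneTo-sound k)))
               (first-K ys e K l f b (≤ᵇ-true (ℕP.≤-refl {K})) le)) ⟩
        newCell rpp (X K) c * (0ℤ + newCells rpp (X K) (length ys) (suc l) * f (replicate (suc l) K))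
          ≡⟨ cong (newCell rpp (X K) c *_) (trans (ℤP.+-identityˡ _) (cong (λ z → newCells rpp (X K) z (suc l) * f (replicate (suc l) K)) (sym eq))) ⟩
        newCell rpp (X K) c * (newCells rpp (X K) (ℕ.pred c) (suc l) * f (replicate (suc l) K))
          ≡⟨ sym (ℤP.*-assoc (newCell rpp (X K) c) (newCells rpp (X K) (ℕ.pred c) (suc l)) (f (replicate (suc l) K))) ⟩
        newCells rpp (X K) c (suc (suc l)) * f (replicate (suc l) K) ∎
        where
        g : ℕ → ℤ
        g r = ∑ (words K l) (λ w → rowWeight as K (r ∷ w) * f (r ∷ w))
      go vst refl zero    le = cong (newCell vst (X K) c *_) (∑-single (f []))
      go vst refl (suc l) le = trans (cong (newCell vst (X K) c *_) (trans
        (∑-∷ (λ _ → words K l) (oneTo K) (λ w → rowWeight as K w * f w))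
        (∑-≡0ᴬ (All.map (λ {r} (_ , r≤K) → ∑-≡0 (words K l) (λ w →
          cong (_* f (r ∷ w)) (not-after-K as r w (≤ᵇ-false (ℕP.<⇒≱ (s≤s r≤K)))))) (oneTo-sound K)))))
        (ℤP.*-zeroʳ (newCell vst (X K) c))

    -- A row consists of `b` letters up to `k` followed by letters K. The row above has the same
    -- form, with its last `e` letters equal to K, so no small letter can stand below those.
    peel-row : ∀ ys e p l (f : List ℕ → ℤ) → All (_≤ k) ys → p ≤ k → l ≤ length ys ℕ.+ e →
      ∑ (words K l) (λ w → rowWeight (ys ++ replicate e K) p w * f w) ≡
      ∑ (upTo (suc l)) (λ b → step md (X K) (length ys) b l *
        ∑ (words k b) (λ w → rowWeight ys p w * f (w ++ replicate (l ∸ b) K)))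
    peel-row ys e p zero    f b p≤k le = sym (∑-single (1ℤ * f [] + 0ℤ))
    peel-row ys e p (suc l) f b p≤k le = begin
      ∑ (words K (suc l)) (λ w → rowWeight (ys ++ replicate e K) p w * f w)
        ≡⟨ ∑-∷ (λ _ → words K l) (oneTo K) (λ w → rowWeight (ys ++ replicate e K) p w * f w) ⟩
      ∑ (oneTo K) (start ys e) ≡⟨ ∑-oneTo-∷ʳ k (start ys e) ⟩
      ∑ (oneTo k) (start ys e) + start ys e K ≡⟨ ℤP.+-comm (∑ (oneTo k) (start ys e)) (start ys e K) ⟩
      start ys e K + ∑ (oneTo k) (start ys e) ≡⟨ cong₂ _+_ (trans (first-K ys e p l f b (rel-K p p≤k) le)
           (cong (newCells md (X K) (length ys) (suc l) *_) (sym (∑-single (f (replicate (suc l) K)))))) (small ys e b le) ⟩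
      rhs ys 0 + ∑ (upTo (suc l)) (λ i → rhs ys (suc i)) ≡⟨ sym (∑-upTo-suc (suc l) (rhs ys)) ⟩
      ∑ (upTo (suc (suc l))) (rhs ys) ∎
      where
      start : List ℕ → ℕ → ℕ → ℤ
      start ys e r = ∑ (words K l) (λ w → rowWeight (ys ++ replicate e K) p (r ∷ w) * f (r ∷ w))
      rhs : List ℕ → ℕ → ℤ
      rhs ys b = step md (X K) (length ys) b (suc l) *
        ∑ (words k b) (λ w → rowWeight ys p w * f (w ++ replicate (suc l ∸ b) K))
      small : ∀ ys e → All (_≤ k) ys → suc l ≤ length ys ℕ.+ e →
              ∑ (oneTo k) (start ys e) ≡ ∑ (upTo (suc l)) (λ i → rhs ys (suc i))
      small []       (suc e) qs       le = trans
        (∑-≡0ᴬ (All.map (λ {r} (_ , r≤k) → trans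
          (expand l f p K (replicate e K) r (trans (cong (λ i → ind (rel md p r) * (ind i * cell K r)) (≤ᵇ-false (ℕP.<⇒≱ (s≤s r≤k))))
             (ℤP.*-zeroʳ (ind (rel md p r)))))
          (ℤP.*-zeroˡ (∑ (words K l) (λ w → rowWeight (replicate e K) r w * f (r ∷ w))))) (oneTo-sound k)))
        (sym (∑-≡0 (upTo (suc l)) (λ i → ℤP.*-zeroˡ (∑ (words k (suc i)) (λ w → rowWeight [] p w * f (w ++ replicate (l ∸ i) K))))))
      small (y ∷ ys) e       (q ∷ qs) (s≤s le) = begin
        ∑ (oneTo k) (start (y ∷ ys) e)
          ≡⟨ ∑-congᴬ (All.map (λ {r} (_ , r≤k) → trans (expand l f p y (ys ++ replicate e K) r refl)
               (cong (c r *_) (peel-row ys e r l (λ w → f (r ∷ w)) qs r≤k le))) (oneTo-sound k)) ⟩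
        ∑ (oneTo k) (λ r → c r * ∑ (upTo (suc l)) (λ i → s i * U r i))
          ≡⟨ ∑-cong (oneTo k) (λ r → ℤP.*-comm (c r) (∑ (upTo (suc l)) (λ i → s i * U r i))) ⟩
        ∑ (oneTo k) (λ r → ∑ (upTo (suc l)) (λ i → s i * U r i) * c r)
          ≡⟨ ∑-pull (upTo (suc l)) (oneTo k) s (λ i r → U r i) c ⟩
        ∑ (upTo (suc l)) (λ i → s i * ∑ (oneTo k) (λ r → U r i * c r))
          ≡⟨ ∑-cong (upTo (suc l)) (λ i → cong (s i *_) (trans (∑-cong (oneTo k) (λ r → ℤP.*-comm (U r i) (c r))) (gather i))) ⟩
        ∑ (upTo (suc l)) (λ i → rhs (y ∷ ys) (suc i)) ∎
        where
        c : ℕ → ℤ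
        c r = ind (rel md p r) * (ind (y ≤ᵇ r) * cell y r)
        s : ℕ → ℤ
        s i = step md (X K) (length ys) i l
        U : ℕ → ℕ → ℤ
        U r i = ∑ (words k i) (λ w → rowWeight ys r w * f (r ∷ w ++ replicate (l ∸ i) K))
        gather : ∀ i → ∑ (oneTo k) (λ r → c r * U r i) ≡
          ∑ (words k (suc i)) (λ w → rowWeight (y ∷ ys) p w * f (w ++ replicate (l ∸ i) K))
        gather i = sym (trans (∑-∷ (λ _ → words k i) (oneTo k) (λ w → rowWeight (y ∷ ys) p w * f (w ++ replicate (l ∸ i) K)))
          (∑-cong (oneTo k) (λ r → trans
            (∑-cong (words k i) (λ w → lemma (ind (rel md p r)) (ind (y ≤ᵇ r) * cell y r) (rowWeight ys r w) (f (r ∷ w ++ replicate (l ∸ i) K))))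
            (∑-*ˡ (c r) (words k i) (λ w → rowWeight ys r w * f (r ∷ w ++ replicate (l ∸ i) K))))))
          where
          lemma : ∀ i c r f → i * (c * r) * f ≡ i * c * (r * f)
          lemma = solve-∀

    -- The small letters of all rows form a tableau of shape `bs`, the preceding shape of the chain,
    -- and the cells with K contribute one matrix entry.
    peel : ∀ W ys e ls → All (_≤ k) ys → Decreasing (length ys ℕ.+ e) ls → All (_≤ W) ls →
      Z K (ys ++ replicate e K) ls ≡
      ∑ (boxes (replicate (length ls) W)) (λ bs → Z k ys bs * entry md (X K) (length ys) bs ls)
    peel W ys e []       b d       h = refl
    peel W ys e (l ∷ ls) b (l≤ , d) (l≤W ∷ h) = begin
      ∑ (words K l) (λ w → rowWeight (ys ++ replicate e K) 0 w * Z K w ls)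
        ≡⟨ peel-row ys e 0 l (λ w → Z K w ls) b z≤n l≤ ⟩
      ∑ (upTo (suc l)) (λ i → s i * ∑ (words k i) (λ w → rowWeight ys 0 w * Z K (w ++ replicate (l ∸ i) K) ls))
        ≡⟨ ∑-upTo-cong (suc l) (λ i i<l → cong (s i *_) (∑-congᴬ (All.map (λ {w} wf → cong (rowWeight ys 0 w *_) (below i i<l w wf)) (words-sound k i)))) ⟩
      ∑ (upTo (suc l)) (λ i → s i * ∑ (words k i) (λ w → rowWeight ys 0 w * ∑ Bs (λ bs → Z k w bs * entry md (X K) i bs ls)))
        ≡⟨ ∑-upTo-extend l W _ l≤W (λ i l<i → cong (_* ∑ (words k i) (λ w → rowWeight ys 0 w * ∑ Bs (λ bs → Z k w bs * entry md (X K) i bs ls)))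
             (step-shrink md (X K) (length ys) l<i)) ⟩
      ∑ (upTo (suc W)) (λ i → s i * ∑ (words k i) (λ w → rowWeight ys 0 w * ∑ Bs (λ bs → Z k w bs * entry md (X K) i bs ls)))
        ≡⟨ ∑-cong (upTo (suc W)) regroup ⟩
      ∑ (upTo (suc W)) (λ i → ∑ Bs (λ bs → Z k ys (i ∷ bs) * entry md (X K) (length ys) (i ∷ bs) (l ∷ ls)))
        ≡⟨ sym (∑-boxes-∷ W (replicate (length ls) W) (λ bs → Z k ys bs * entry md (X K) (length ys) bs (l ∷ ls))) ⟩
      ∑ (boxes (replicate (suc (length ls)) W)) (λ bs → Z k ys bs * entry md (X K) (length ys) bs (l ∷ ls)) ∎
      where
      Bs : List (List ℕ)
      Bs = boxes (replicate (length ls) W)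
      s : ℕ → ℤ
      s i = step md (X K) (length ys) i l
      below : ∀ i → i < suc l → ∀ w → length w ≡ i × All (Letter k) w →
        Z K (w ++ replicate (l ∸ i) K) ls ≡ ∑ Bs (λ bs → Z k w bs * entry md (X K) i bs ls)
      below .(length w) (s≤s i≤l) w (refl , lw) = peel W w (l ∸ length w) ls (All.map proj₂ lw)
        (subst (λ z → Decreasing z ls) (sym (ℕP.m+[n∸m]≡n i≤l)) d) h
      regroup : ∀ i → s i * ∑ (words k i) (λ w → rowWeight ys 0 w * ∑ Bs (λ bs → Z k w bs * entry md (X K) i bs ls)) ≡
        ∑ Bs (λ bs → Z k ys (i ∷ bs) * entry md (X K) (length ys) (i ∷ bs) (l ∷ ls))
      regroup i = begin
        s i * ∑ (words k i) (λ w → rowWeight ys 0 w * ∑ Bs (λ bs → Z k w bs * entry md (X K) i bs ls))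
          ≡⟨ cong (s i *_) (sym (∑-pull (words k i) Bs (rowWeight ys 0) (Z k) (λ bs → entry md (X K) i bs ls))) ⟩
        s i * ∑ Bs (λ bs → Z k ys (i ∷ bs) * entry md (X K) i bs ls)
          ≡⟨ sym (∑-*ˡ (s i) Bs (λ bs → Z k ys (i ∷ bs) * entry md (X K) i bs ls)) ⟩
        ∑ Bs (λ bs → s i * (Z k ys (i ∷ bs) * entry md (X K) i bs ls))
          ≡⟨ ∑-cong Bs (λ bs → *-swapˡ (s i) (Z k ys (i ∷ bs)) (entry md (X K) i bs ls)) ⟩
        ∑ Bs (λ bs → Z k ys (i ∷ bs) * entry md (X K) (length ys) (i ∷ bs) (l ∷ ls)) ∎

-- Polynomials in several variables

monomial : (ℕ → ℤ) → ℕ → List ℕ → ℤ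
monomial X r []      = 1ℤ
monomial X r (n ∷ τ) = X r ℤ.^ n * monomial X (suc r) τ

monomial-∷ʳ : ∀ X r τ n → monomial X r (τ ∷ʳ n) ≡ monomial X r τ * X (r ℕ.+ length τ) ℤ.^ n
monomial-∷ʳ X r []      n = trans (ℤP.*-comm (X r ℤ.^ n) 1ℤ) (cong (λ s → 1ℤ * X s ℤ.^ n) (sym (ℕP.+-identityʳ r)))
monomial-∷ʳ X r (k ∷ τ) n = trans (cong (X r ℤ.^ k *_) (monomial-∷ʳ X (suc r) τ n))
  (trans (sym (ℤP.*-assoc (X r ℤ.^ k) (monomial X (suc r) τ) (X (suc r ℕ.+ length τ) ℤ.^ n)))
         (cong (λ s → X r ℤ.^ k * monomial X (suc r) τ * X s ℤ.^ n) (sym (ℕP.+-suc r (length τ)))))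

monomial-shift : ∀ X r τ → monomial X (suc r) τ ≡ monomial (λ i → X (suc i)) r τ
monomial-shift X r []      = refl
monomial-shift X r (n ∷ τ) = cong (X (suc r) ℤ.^ n *_) (monomial-shift X (suc r) τ)

-- `boxes` recurses on the first exponent, whereas a chain is extended by its last letter.
∑-boxes-∷ʳ : ∀ k N (f : List ℕ → ℤ) →
  ∑ (boxes (replicate (suc k) N)) f ≡ ∑ (boxes (replicate k N)) (λ τ → ∑ (upTo (suc N)) (λ n → f (τ ∷ʳ n)))
∑-boxes-∷ʳ zero    N f = trans (∑-boxes-∷ N [] f) (trans
  (∑-cong (upTo (suc N)) (λ n → ℤP.+-identityʳ (f (n ∷ []))))
  (sym (ℤP.+-identityʳ (∑ (upTo (suc N)) (λ n → f (n ∷ []))))))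
∑-boxes-∷ʳ (suc k) N f = begin
  ∑ (boxes (replicate (suc (suc k)) N)) f ≡⟨ ∑-boxes-∷ N (replicate (suc k) N) f ⟩
  ∑ (upTo (suc N)) (λ i → ∑ (boxes (replicate (suc k) N)) (λ τ → f (i ∷ τ)))
    ≡⟨ ∑-cong (upTo (suc N)) (λ i → ∑-boxes-∷ʳ k N (λ τ → f (i ∷ τ))) ⟩
  ∑ (upTo (suc N)) (λ i → ∑ (boxes (replicate k N)) (λ τ → ∑ (upTo (suc N)) (λ n → f (i ∷ τ ∷ʳ n))))
    ≡⟨ sym (∑-boxes-∷ N (replicate k N) (λ τ → ∑ (upTo (suc N)) (λ n → f (τ ∷ʳ n)))) ⟩
  ∑ (boxes (replicate (suc k) N)) (λ τ → ∑ (upTo (suc N)) (λ n → f (τ ∷ʳ n))) ∎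

coef-applyUpTo : ∀ n (c : ℕ → ℤ) i → i < n → coef (applyUpTo c n) i ≡ c i
coef-applyUpTo (suc n) c zero    lt       = refl
coef-applyUpTo (suc n) c (suc i) (s≤s lt) = coef-applyUpTo n (λ i → c (suc i)) i lt

eval-applyUpTo : ∀ n (c : ℕ → ℤ) x → eval (applyUpTo c (suc n)) x ≡ ∑ (upTo (suc n)) (λ i → c i * x ℤ.^ i)
eval-applyUpTo n c x = trans
  (eval-∑ n (applyUpTo c (suc n)) x (ℕP.≤-reflexive (LP.length-applyUpTo c (suc n))))
  (∑-upTo-cong (suc n) (λ i lt → cong (_* x ℤ.^ i) (coef-applyUpTo (suc n) c i lt)))

-- Induction on the number of variables: with the other variables fixed, both sides are polynomials
-- in the first one, and their coefficients are sums of the same kind.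
monomial-injective₀ : ∀ k N (c d : List ℕ → ℤ) →
  (∀ X → ∑ (boxes (replicate k N)) (λ τ → c τ * monomial X 0 τ) ≡ ∑ (boxes (replicate k N)) (λ τ → d τ * monomial X 0 τ)) →
  ∀ τ → length τ ≡ k → All (_≤ N) τ → c τ ≡ d τ
monomial-injective₀ zero    N c d h []      l b = trans (sym (lemma (c []))) (trans (h (λ _ → 0ℤ)) (lemma (d [])))
  where
  lemma : ∀ z → z * 1ℤ + 0ℤ ≡ z
  lemma = solve-∀
monomial-injective₀ (suc k) N c d h (n ∷ τ) l (n≤N ∷ b) =
  monomial-injective₀ k N (λ τ → c (n ∷ τ)) (λ τ → d (n ∷ τ)) slice τ (ℕP.suc-injective l) b
  where
  cons : ℤ → (ℕ → ℤ) → ℕ → ℤ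
  cons x X zero    = x
  cons x X (suc i) = X i
  inner : (List ℕ → ℤ) → (ℕ → ℤ) → ℕ → ℤ
  inner e X i = ∑ (boxes (replicate k N)) (λ τ → e (i ∷ τ) * monomial X 0 τ)
  asPoly : ∀ e X x → ∑ (boxes (replicate (suc k) N)) (λ τ → e τ * monomial (cons x X) 0 τ) ≡ eval (applyUpTo (inner e X) (suc N)) x
  asPoly e X x = begin
    ∑ (boxes (replicate (suc k) N)) (λ τ → e τ * monomial (cons x X) 0 τ)
      ≡⟨ ∑-boxes-∷ N (replicate k N) (λ τ → e τ * monomial (cons x X) 0 τ) ⟩
    ∑ (upTo (suc N)) (λ i → ∑ (boxes (replicate k N)) (λ τ → e (i ∷ τ) * (x ℤ.^ i * monomial (cons x X) 1 τ)))
      ≡⟨ ∑-cong (upTo (suc N)) (λ i → trans (∑-cong (boxes (replicate k N)) (λ τ → trans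
           (cong (λ z → e (i ∷ τ) * (x ℤ.^ i * z)) (monomial-shift (cons x X) 0 τ))
           (lemma (e (i ∷ τ)) (x ℤ.^ i) (monomial X 0 τ))))
         (∑-*ʳ (x ℤ.^ i) (boxes (replicate k N)) (λ τ → e (i ∷ τ) * monomial X 0 τ))) ⟩
    ∑ (upTo (suc N)) (λ i → inner e X i * x ℤ.^ i) ≡⟨ sym (eval-applyUpTo N (inner e X) x) ⟩
    eval (applyUpTo (inner e X) (suc N)) x ∎
    where
    lemma : ∀ e p m → e * (p * m) ≡ e * m * p
    lemma = solve-∀
  slice : ∀ X → inner c X n ≡ inner d X n
  slice X = trans (sym (coef-applyUpTo (suc N) (inner c X) n (s≤s n≤N))) (trans
    (eval-injective (applyUpTo (inner c X) (suc N)) (applyUpTo (inner d X) (suc N)) (λ j →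
      trans (sym (asPoly c X (ℤ.+ suc j))) (trans (h (cons (ℤ.+ suc j) X)) (asPoly d X (ℤ.+ suc j)))) n)
    (coef-applyUpTo (suc N) (inner d X) n (s≤s n≤N)))

monomial-injective : ∀ k N (c d : List ℕ → ℤ) →
  (∀ X → ∑ (boxes (replicate k N)) (λ τ → c τ * monomial X 1 τ) ≡ ∑ (boxes (replicate k N)) (λ τ → d τ * monomial X 1 τ)) →
  ∀ τ → length τ ≡ k → All (_≤ N) τ → c τ ≡ d τ
monomial-injective k N c d h = monomial-injective₀ k N c d (λ X → trans
  (∑-cong (boxes (replicate k N)) (λ τ → cong (c τ *_) (sym (monomial-shift (λ i → X (ℕ.pred i)) 0 τ))))
  (trans (h (λ i → X (ℕ.pred i)))
  (∑-cong (boxes (replicate k N)) (λ τ → cong (d τ *_) (monomial-shift (λ i → X (ℕ.pred i)) 0 τ)))))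

Z-zero : ∀ md X ys bs → Tableaux.Z md X 0 ys bs ≡ ind (bs ==ₗ replicate (length bs) 0)
Z-zero md X ys []           = refl
Z-zero md X ys (zero ∷ bs)  = trans (∑-single (Tableaux.Z md X 0 [] bs)) (Z-zero md X [] bs)
Z-zero md X ys (suc b ∷ bs) = refl

size-bounded : ∀ {c} as → All (_≤ c) as → size as ≤ length as ℕ.* c
size-bounded []       []       = z≤n
size-bounded (a ∷ as) (p ∷ ps) = ℕP.+-mono-≤ p (size-bounded as ps)

module PathGenerating (m w N : ℕ) (bound : m ℕ.* w ≤ N) where
  open Path m w
  open Shape

  origin : List ℕ → ℤ
  origin b = ind (b ==ₗ replicate m 0)

  -- An entry has degree at most |a|, hence at most m w, so the sum up to `N` loses no coefficient.
  eval-M : ∀ md b {a} → Shape a → ∀ x → ∑ (upTo (suc N)) (λ n → M md n b a * x ℤ.^ n) ≡ entry md x w b a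
  eval-M md b {a} s x = trans (sym (eval-∑ N (entryP md w b a) x (ℕP.≤-trans (length-entryP md w b a) (s≤s
      (ℕP.≤-trans (size-bounded a (decreasing-bounded w a (decreasing s)))
        (ℕP.≤-trans (ℕP.≤-reflexive (cong (ℕ._* w) (rows s))) bound))))))
    (eval-entryP md w b a x)

  -- Induction on the number of letters: the last exponent of a chain belongs to the largest letter,
  -- which is the one that `peel` removes.
  path-Z : ∀ md X k {a} → Shape a →
    ∑ (boxes (replicate k N)) (λ τ → path md origin τ a * monomial X 1 τ) ≡ Tableaux.Z md X k (replicate w 0) a
  path-Z md X zero    {a} s = trans (lemma (origin a)) (trans
    (cong (λ l → ind (a ==ₗ replicate l 0)) (sym (rows s))) (sym (Z-zero md X (replicate w 0) a)))
    where
    lemma : ∀ z → z * 1ℤ + 0ℤ ≡ z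
    lemma = solve-∀
  path-Z md X (suc k) {a} s = begin
    ∑ (boxes (replicate (suc k) N)) (λ τ → path md origin τ a * μ τ)
      ≡⟨ ∑-boxes-∷ʳ k N (λ τ → path md origin τ a * μ τ) ⟩
    ∑ Γ (λ τ → ∑ U (λ n → path md origin (τ ∷ʳ n) a * monomial X 1 (τ ∷ʳ n)))
      ≡⟨ ∑-congᴬ (All.map (λ {τ} (l , _) → lastLetter τ l) (boxes-replicate-sound k N)) ⟩
    ∑ Γ (λ τ → ∑ D (λ b → e b * p τ b) * μ τ)
      ≡⟨ ∑-pull D Γ e (λ b τ → p τ b) μ ⟩
    ∑ D (λ b → e b * G b)
      ≡⟨ ∑-cong D (λ b → ℤP.*-comm (e b) (G b)) ⟩
    ∑ D (λ b → G b * e b)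
      ≡⟨ ∑-congᴬ (All.map (λ {b} l → restrict b l) D-length) ⟩
    ∑ D (λ b → Z k zeros b * e b)
      ≡⟨ cong₂ (λ i j → ∑ (boxes (replicate i (suc w))) (λ b → Z k zeros b * entry md x j b a))
           (sym (rows s)) (sym (LP.length-replicate w)) ⟩
    ∑ (boxes (replicate (length a) (suc w))) (λ b → Z k zeros b * entry md x (length zeros) b a)
      ≡⟨ sym (peel (suc w) zeros 0 a (AllP.replicate⁺ w z≤n)
           (subst (λ c → Decreasing c a) (sym (trans (ℕP.+-identityʳ (length zeros)) (LP.length-replicate w))) (decreasing s))
           (All.map ℕP.m≤n⇒m≤1+n (decreasing-bounded w a (decreasing s)))) ⟩
    Z (suc k) (replicate w 0 ++ []) a ≡⟨ cong (λ ys → Z (suc k) ys a) (LP.++-identityʳ zeros) ⟩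
    Z (suc k) zeros a ∎
    where
    open Tableaux md X
    open Peel k using (peel)
    Γ : List (List ℕ)
    Γ = boxes (replicate k N)
    U : List ℕ
    U = upTo (suc N)
    x : ℤ
    x = X (suc k)
    zeros : List ℕ
    zeros = replicate w 0
    p : List ℕ → List ℕ → ℤ
    p = path md origin
    e μ G : List ℕ → ℤ
    e b = entry md x w b a
    μ = monomial X 1
    G b = ∑ Γ (λ τ → p τ b * μ τ)
    restrict : ∀ b → length b ≡ m → G b * e b ≡ Z k zeros b * e b
    restrict b l with decreasing? w b
    ... | yes d = cong (_* e b) (path-Z md X k (shape l d))
    -- The induction hypothesis says nothing about such `b`, but its last matrix entry is 0.
    ... | no ¬d = trans (cong (G b *_) e≡0) (trans
                    (ℤP.*-zeroʳ (G b))
                    (sym (trans (cong (Z k zeros b *_) e≡0) (ℤP.*-zeroʳ (Z k zeros b)))))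
      where
      e≡0 : e b ≡ 0ℤ
      e≡0 = entry-¬decreasing md x w b a ¬d
    lastLetter : ∀ τ → length τ ≡ k → ∑ U (λ n → path md origin (τ ∷ʳ n) a * monomial X 1 (τ ∷ʳ n)) ≡
      ∑ D (λ b → e b * p τ b) * μ τ
    lastLetter τ l = begin
      ∑ U (λ n → path md origin (τ ∷ʳ n) a * monomial X 1 (τ ∷ʳ n))
        ≡⟨ ∑-cong U (λ n → trans (cong₂ _*_ (cong (λ f → f a) (LP.foldl-∷ʳ (act md) origin n τ))
             (trans (monomial-∷ʳ X 1 τ n) (cong (λ j → μ τ * X (suc j) ℤ.^ n) l)))
             (rearrange (act md (path md origin τ) n a) (μ τ) (x ℤ.^ n))) ⟩
      ∑ U (λ n → act md (path md origin τ) n a * x ℤ.^ n * μ τ)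
        ≡⟨ ∑-*ʳ (μ τ) U (λ n → act md (path md origin τ) n a * x ℤ.^ n) ⟩
      ∑ U (λ n → act md (path md origin τ) n a * x ℤ.^ n) * μ τ
        ≡⟨ cong (_* μ τ) (trans (∑-pull D U (path md origin τ) (λ b n → M md n b a) (x ℤ.^_))
             (∑-cong D (λ b → trans (cong (p τ b *_) (eval-M md b s x)) (ℤP.*-comm (p τ b) (e b))))) ⟩
      ∑ D (λ b → e b * p τ b) * μ τ ∎
      where
      rearrange : ∀ p y z → p * (y * z) ≡ p * z * y
      rearrange = solve-∀

-- Weights of fillings

-- The local functions of weightIs and validFlags have no name outside Defs;
-- these metavariables are solved by the refl proofs that follow them.
mutual
  weightFrom : (ℕ → ℕ) → ℕ → List ℕ → Bool
  weightFrom = _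

  weightIs-weightFrom : ∀ μ a → weightIs μ a ≡ weightFrom a 1 μ
  weightIs-weightFrom μ a with 1
  ... | r = unfold a r μ
    where
    unfold : ∀ a r μ → _ ≡ weightFrom a r μ
    unfold a r μ = refl

mutual
  joinable : List ℕ → List ℕ → List Bool → ℕ → Bool
  joinable = _

  validRow : List ℕ → List ℕ → List Bool → Bool
  validRow ys row fl = all (λ j → not (atB fl j) ∨ joinable ys row fl j) (upTo (length row))

  validFlags-two : ∀ ys row fl → validFlags (ys ∷ row ∷ []) ([] ∷ fl ∷ []) ≡ (validRow ys row fl ∧ true)
  validFlags-two ys row fl = refl

-- The empty flag row is a placeholder: it passes the first-row test, and the test of the later rows
-- ignores it. Thus `validFlags` with `[] ∷ F` expresses the local test that has no name outside.
validFlags-first : ∀ row S fl F → validFlags (row ∷ S) (fl ∷ F) ≡ (all not fl ∧ validFlags (row ∷ S) ([] ∷ F))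
validFlags-first row []        fl F        = refl
validFlags-first row (row′ ∷ S) fl []       = refl
validFlags-first row (row′ ∷ S) fl (fl′ ∷ F) = refl

validFlags-∷ : ∀ ys row S fl F → validFlags (ys ∷ row ∷ S) ([] ∷ fl ∷ F) ≡ (validRow ys row fl ∧ validFlags (row ∷ S) ([] ∷ F))
validFlags-∷ ys row []         fl F         = refl
validFlags-∷ ys row (row′ ∷ S) fl []        = refl
validFlags-∷ ys row (row′ ∷ S) fl (fl′ ∷ F) = refl

all-suc : ∀ (p : ℕ → Bool) n → all p (applyUpTo suc n) ≡ all (λ j → p (suc j)) (upTo n)
all-suc p n = cong and (trans (LP.map-applyUpTo suc p n) (sym (LP.map-upTo (λ j → p (suc j)) n)))

validRow-∷ : ∀ y ys r rs f fs → validRow (y ∷ ys) (r ∷ rs) (f ∷ fs) ≡ ((not f ∨ (y == r)) ∧ validRow ys rs fs)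
validRow-∷ y ys r rs f fs = cong ((not f ∨ (y == r)) ∧_)
  (all-suc (λ j → not (atB (f ∷ fs) j) ∨ joinable (y ∷ ys) (r ∷ rs) (f ∷ fs) j) (length rs))

bit : Bool → ℕ
bit b = if b then 1 else 0

countB-∷ : ∀ (p : A → Bool) x xs → countB p (x ∷ xs) ≡ bit (p x) ℕ.+ countB p xs
countB-∷ p x xs with p x
... | true  = refl
... | false = refl

countB-≤ : ∀ (p : A → Bool) xs → countB p xs ≤ length xs
countB-≤ p xs = LP.length-filter (λ x → T? (p x)) xs

countB-+ : ∀ (p q s : A → Bool) xs → (∀ x → bit (p x) ≡ bit (q x) ℕ.+ bit (s x)) → countB p xs ≡ countB q xs ℕ.+ countB s xs
countB-+ p q s []       h = refl
countB-+ p q s (x ∷ xs) h = begin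
  countB p (x ∷ xs) ≡⟨ countB-∷ p x xs ⟩
  bit (p x) ℕ.+ countB p xs ≡⟨ cong₂ ℕ._+_ (h x) (countB-+ p q s xs h) ⟩
  (bit (q x) ℕ.+ bit (s x)) ℕ.+ (countB q xs ℕ.+ countB s xs) ≡⟨ ℕ+-interchange (bit (q x)) (bit (s x)) (countB q xs) (countB s xs) ⟩
  (bit (q x) ℕ.+ countB q xs) ℕ.+ (bit (s x) ℕ.+ countB s xs) ≡⟨ sym (cong₂ ℕ._+_ (countB-∷ q x xs) (countB-∷ s x xs)) ⟩
  countB q (x ∷ xs) ℕ.+ countB s (x ∷ xs) ∎

countB-cong : ∀ {p q : A → Bool} xs → (∀ x → p x ≡ q x) → countB p xs ≡ countB q xs
countB-cong []       h = refl
countB-cong {p = p} {q} (x ∷ xs) h = trans (countB-∷ p x xs) (trans (cong₂ (λ a b → bit a ℕ.+ b) (h x) (countB-cong xs h)) (sym (countB-∷ q x xs)))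

countB-false : ∀ (xs : List A) → countB (λ _ → false) xs ≡ 0
countB-false []       = refl
countB-false (x ∷ xs) = countB-false xs

countB-map : ∀ (h : A → B) (p : B → Bool) xs → countB p (map h xs) ≡ countB (λ x → p (h x)) xs
countB-map h p []       = refl
countB-map h p (x ∷ xs) = trans (countB-∷ p (h x) (map h xs)) (trans (cong (bit (p (h x)) ℕ.+_) (countB-map h p xs))
  (sym (countB-∷ (λ x → p (h x)) x xs)))

countB-∑ : ∀ (p : A → Bool) xs → ℤ.+ countB p xs ≡ ∑ xs (λ x → ind (p x))
countB-∑ p []       = refl
countB-∑ p (x ∷ xs) with p x
... | true  = cong (1ℤ +_) (countB-∑ p xs)
... | false = trans (countB-∑ p xs) (sym (ℤP.+-identityˡ (∑ xs (λ x → ind (p x)))))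

sumℕ-∑ : ∀ (f : A → ℕ) xs → ℤ.+ sumℕ (map f xs) ≡ ∑ xs (λ x → ℤ.+ f x)
sumℕ-∑ f []       = refl
sumℕ-∑ f (x ∷ xs) = cong (ℤ.+ f x +_) (sumℕ-∑ f xs)

∑-filter : ∀ (p : A → Bool) xs (f : A → ℤ) → ∑ (filter (λ x → T? (p x)) xs) f ≡ ∑ xs (λ x → ind (p x) * f x)
∑-filter p []       f = refl
∑-filter p (x ∷ xs) f with p x
... | true  = cong₂ _+_ (sym (ℤP.*-identityˡ (f x))) (∑-filter p xs f)
... | false = trans (∑-filter p xs f) (sym (ℤP.+-identityˡ (∑ xs (λ x → ind (p x) * f x))))

counts : (ℕ → ℕ) → ℕ → ℕ → List ℕ
counts a r zero    = []
counts a r (suc k) = a r ∷ counts a (suc r) k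

counts-length : ∀ a r k → length (counts a r k) ≡ k
counts-length a r zero    = refl
counts-length a r (suc k) = cong suc (counts-length a (suc r) k)

counts-bounded : ∀ {N} a r k → (∀ s → a s ≤ N) → All (_≤ N) (counts a r k)
counts-bounded a r zero    h = []
counts-bounded a r (suc k) h = h r ∷ counts-bounded a (suc r) k h

counts-cong : ∀ {a b} r k → (∀ s → a (suc s) ≡ b (suc s)) → counts a (suc r) k ≡ counts b (suc r) k
counts-cong r zero    h = refl
counts-cong r (suc k) h = cong₂ _∷_ (h r) (counts-cong (suc r) k h)

weightFrom-counts : ∀ a r τ → weightFrom a r τ ≡ (counts a r (length τ) ==ₗ τ)
weightFrom-counts a r []      = refl
weightFrom-counts a r (n ∷ τ) = cong ((a r == n) ∧_) (weightFrom-counts a (suc r) τ)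

-- Exactly one exponent list records the multiplicities `a`, and the bound places it in the range of
-- summation.
∑-weightIs : ∀ X k N a → (∀ r → a r ≤ N) →
  ∑ (boxes (replicate k N)) (λ τ → ind (weightIs τ a) * monomial X 1 τ) ≡ monomial X 1 (counts a 1 k)
∑-weightIs X k N a h = trans
  (∑-congᴬ (All.map (λ {τ} (l , _) → cong (λ b → ind b * monomial X 1 τ)
    (trans (weightIs-weightFrom τ a) (trans (weightFrom-counts a 1 τ) (cong (λ j → counts a 1 j ==ₗ τ) l)))) (boxes-replicate-sound k N)))
  (boxes-replicate-δ k N (counts a 1 k) (monomial X 1) (counts-length a 1 k) (counts-bounded a 1 k h))

monomial-+ : ∀ X r k a b → monomial X r (counts (λ s → a s ℕ.+ b s) r k) ≡ monomial X r (counts a r k) * monomial X r (counts b r k)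
monomial-+ X r zero    a b = refl
monomial-+ X r (suc k) a b = trans (cong₂ _*_ (ℤP.^-distribˡ-+-* (X r) (a r) (b r)) (monomial-+ X (suc r) k a b))
  (*-interchange (X r ℤ.^ a r) (X r ℤ.^ b r) (monomial X (suc r) (counts a (suc r) k)) (monomial X (suc r) (counts b (suc r) k)))

monomial-0 : ∀ X r k a → (∀ s → r ≤ s → a s ≡ 0) → monomial X r (counts a r k) ≡ 1ℤ
monomial-0 X r zero    a h = refl
monomial-0 X r (suc k) a h = trans (cong₂ (λ n z → X r ℤ.^ n * z) (h r ℕP.≤-refl)
  (monomial-0 X (suc r) k a (λ s le → h s (ℕP.<⇒≤ le)))) refl

monomial-single : ∀ X r k e → r ≤ e → e < r ℕ.+ k → monomial X r (counts (λ s → bit (e == s)) r k) ≡ X e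
monomial-single X r zero    e le lt = ⊥-elim (ℕP.<⇒≱ lt (ℕP.≤-trans (ℕP.≤-reflexive (ℕP.+-identityʳ r)) le))
monomial-single X r (suc k) e le lt with r ℕ.≟ e
... | yes refl = trans (cong₂ (λ b z → X r ℤ.^ bit b * z) (==-refl r)
    (monomial-0 X (suc r) k (λ s → bit (r == s)) (λ s r<s → cong bit (==-false (ℕP.<⇒≢ r<s)))))
    (lemma (X r))
  where
  lemma : ∀ x → x * 1ℤ * 1ℤ ≡ x
  lemma = solve-∀
... | no  r≢e = trans (cong₂ (λ b z → X r ℤ.^ bit b * z) (==-false (λ e≡r → r≢e (sym e≡r)))
    (monomial-single X (suc r) k e (ℕP.≤∧≢⇒< le r≢e) (subst (e <_) (ℕP.+-suc r k) lt)))
    (ℤP.*-identityˡ (X e))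

Rows : (A → Set) → List ℕ → List (List A) → Set
Rows P []       []       = ⊤
Rows P (l ∷ ls) (x ∷ xs) = (length x ≡ l × All P x) × Rows P ls xs
Rows P _        _        = ⊥

choices-sound : ∀ {P : A → Set} (f : ℕ → List (List A)) → (∀ l → All (λ x → length x ≡ l × All P x) (f l)) →
                ∀ ls → All (Rows P ls) (choices (map f ls))
choices-sound f h []       = tt ∷ []
choices-sound f h (l ∷ ls) = All-concatMap _ (f l) (All.map (λ p →
  AllP.map⁺ (All.map (λ q → p , q) (choices-sound f h ls))) (h l))

fillings-sound : ∀ k ls → All (Rows (Letter k) ls) (fillings k ls)
fillings-sound k = choices-sound (words k) (words-sound k)

rowFlags : ℕ → List (List Bool)
rowFlags l = choices (applyUpTo (λ _ → true ∷ false ∷ []) l)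

rowFlags-sound : ∀ l → All (λ fl → length fl ≡ l × All (λ _ → ⊤) fl) (rowFlags l)
rowFlags-sound zero    = (refl , []) ∷ []
rowFlags-sound (suc l) = All-concatMap (λ f → map (f ∷_) (rowFlags l)) (true ∷ false ∷ []) (each true ∷ each false ∷ [])
  where
  each : ∀ f → All (λ fl → length fl ≡ suc l × All (λ _ → ⊤) fl) (map (f ∷_) (rowFlags l))
  each f = AllP.map⁺ (All.map (λ (e , a) → cong suc e , tt ∷ a) (rowFlags-sound l))

flagsets-sound : ∀ ls → All (Rows (λ _ → ⊤) ls) (flagsets ls)
flagsets-sound = choices-sound rowFlags rowFlags-sound

validRows : List ℕ → Filling → List (List Bool) → Bool
validRows ys (row ∷ S) (fl ∷ F) = validRow ys row fl ∧ validRows row S F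
validRows ys _         _        = true

validFlags-validRows : ∀ ys row S F → validFlags (ys ∷ row ∷ S) ([] ∷ F) ≡ validRows ys (row ∷ S) F
validFlags-validRows ys row []         []             = refl
validFlags-validRows ys row []         (fl ∷ F)       = validFlags-∷ ys row [] fl F
validFlags-validRows ys row (row′ ∷ S) []             = refl
validFlags-validRows ys row (row′ ∷ S) (fl ∷ F) = trans (validFlags-∷ ys row (row′ ∷ S) fl F)
  (cong (validRow ys row fl ∧_) (validFlags-validRows row row′ S F))

-- Letters are at least 1, so under a row of zeros no cell may be joined. The first row thus obeys
-- the same rule as all others.
all-not-validRow : ∀ {k} w row fl → length row ≤ w → length fl ≡ length row → All (Letter k) row →
                   all not fl ≡ validRow (replicate w 0) row fl
all-not-validRow w       []           []       le       e ls = refl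
all-not-validRow (suc w) (r ∷ row) (f ∷ fl) (s≤s le) e ((1≤r , _) ∷ ls) = begin
  not f ∧ all not fl ≡⟨ cong₂ _∧_ (sym (trans (cong (not f ∨_) (==-false (ℕP.<⇒≢ 1≤r))) (∨-identityʳ (not f))))
                                  (all-not-validRow w row fl le (ℕP.suc-injective e) ls) ⟩
  (not f ∨ (0 == r)) ∧ validRow (replicate w 0) row fl ≡⟨ sym (validRow-∷ 0 (replicate w 0) r row f fl) ⟩
  validRow (0 ∷ replicate w 0) (r ∷ row) (f ∷ fl) ∎

validFlags-origin : ∀ {k} w ls S F → Decreasing w ls → Rows (Letter k) ls S → Rows (λ _ → ⊤) ls F →
                    validFlags S F ≡ validRows (replicate w 0) S F
validFlags-origin w []       []        []       d         _                _             = refl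
validFlags-origin w (l ∷ ls) (row ∷ S) (fl ∷ F) (l≤w , d) ((e , ll) , hS) ((e′ , _) , hF) = trans (validFlags-first row S fl F)
  (cong₂ _∧_ (all-not-validRow w row fl (subst (_≤ w) (sym e) l≤w) (trans e′ (sym e)) ll) (rest ls S F hS hF))
  where
  rest : ∀ ls S F → Rows (Letter _) ls S → Rows (λ _ → ⊤) ls F → validFlags (row ∷ S) ([] ∷ F) ≡ validRows row S F
  rest []       []         []       _ _ = refl
  rest (l ∷ ls) (row′ ∷ S) (fl ∷ F) _ _ = validFlags-validRows row row′ S (fl ∷ F)

rowTops : List ℕ → List Bool → ℕ → ℕ
rowTops row fl r = countB (λ q → (proj₁ q == r) ∧ not (proj₂ q)) (zip row fl)

rowTops-≤ : ∀ row fl r → rowTops row fl r ≤ length row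
rowTops-≤ row fl r = ℕP.≤-trans (countB-≤ _ (zip row fl))
  (ℕP.≤-trans (ℕP.≤-reflexive (LP.length-zipWith _,_ row fl)) (ℕP.m⊓n≤m (length row) (length fl)))

groupCount-≤ : ∀ {P : ℕ → Set} {Q : Bool → Set} ls S F → Rows P ls S → Rows Q ls F → ∀ r → groupCount S F r ≤ size ls
groupCount-≤ []       []        []       _              _        r = z≤n
groupCount-≤ (l ∷ ls) (row ∷ S) (fl ∷ F) ((e , _) , hS) (_ , hF) r =
  ℕP.+-mono-≤ (ℕP.≤-trans (rowTops-≤ row fl r) (ℕP.≤-reflexive e)) (groupCount-≤ ls S F hS hF r)

-- Weights of fillings as products over cells

module Fillings (X : ℕ → ℤ) (k : ℕ) where

  W : (ℕ → ℕ) → ℤ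
  W a = monomial X 1 (counts a 1 k)

  W-cong : ∀ {a b} → (∀ s → a (suc s) ≡ b (suc s)) → W a ≡ W b
  W-cong h = cong (monomial X 1) (counts-cong 0 k h)

  -- A group is counted at its top cell, so a joined cell weighs 1.
  flagWeight : List ℕ → List Bool → ℤ
  flagWeight (r ∷ row) (f ∷ fl) = (if f then 1ℤ else X r) * flagWeight row fl
  flagWeight _         _        = 1ℤ

  W-rowTops : ∀ row fl → All (Letter k) row → W (rowTops row fl) ≡ flagWeight row fl
  W-rowTops []        fl       ls = monomial-0 X 1 k (λ _ → 0) (λ _ _ → refl)
  W-rowTops (r ∷ row) []       ls = monomial-0 X 1 k (λ _ → 0) (λ _ _ → refl)
  W-rowTops (r ∷ row) (f ∷ fl) ((1≤r , r≤k) ∷ ls) = trans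
    (W-cong (λ s → countB-∷ (λ q → (proj₁ q == suc s) ∧ not (proj₂ q)) (r , f) (zip row fl)))
    (trans (monomial-+ X 1 k (λ s → bit ((r == s) ∧ not f)) (rowTops row fl)) (cong₂ _*_ (top f) (W-rowTops row fl ls)))
    where
    top : ∀ f → W (λ s → bit ((r == s) ∧ not f)) ≡ (if f then 1ℤ else X r)
    top true  = monomial-0 X 1 k (λ s → bit ((r == s) ∧ false)) (λ s _ → cong bit (∧-zeroʳ (r == s)))
    top false = trans (W-cong (λ s → cong bit (∧-identityʳ (r == suc s)))) (monomial-single X 1 k r 1≤r (s≤s r≤k))

  module _ (md : Mode) where
    open Tableaux md X

    rowCells : List ℕ → List ℕ → ℤ
    rowCells (y ∷ ys) (r ∷ rs) = cell y r * rowCells ys rs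
    rowCells _        _        = 1ℤ

    cells : List ℕ → Filling → ℤ
    cells ys []        = 1ℤ
    cells ys (row ∷ S) = rowCells ys row * cells row S

    weight : List ℕ → Filling → ℤ
    weight ys []        = 1ℤ
    weight ys (row ∷ S) = rowWeight ys 0 row * weight row S

    Z-weight : ∀ ls ys → Z k ys ls ≡ ∑ (fillings k ls) (weight ys)
    Z-weight []       ys = refl
    Z-weight (l ∷ ls) ys = sym (trans (∑-∷ (λ _ → fillings k ls) (words k l) (weight ys))
      (∑-cong (words k l) (λ row → trans (∑-*ˡ (rowWeight ys 0 row) (fillings k ls) (weight row))
        (cong (rowWeight ys 0 row *_) (sym (Z-weight ls row))))))

    relFrom : ℕ → List ℕ → Bool
    relFrom p []       = true
    relFrom p (r ∷ rs) = rel md p r ∧ relFrom r rs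

    -- For `rpp` this unfolds to `rowWeak` and for `vst` to `rowStrict`.
    relRow : List ℕ → Bool
    relRow r = all (λ p → rel md (proj₁ p) (proj₂ p)) (pairs r)

    relRow-relFrom : ∀ r rs → relRow (r ∷ rs) ≡ relFrom r rs
    relRow-relFrom r []        = refl
    relRow-relFrom r (r′ ∷ rs) = cong (rel md r r′ ∧_) (relRow-relFrom r′ rs)

    relFrom-0 : ∀ row → All (Letter k) row → relFrom 0 row ≡ relRow row
    relFrom-0 []       _                = refl
    relFrom-0 (r ∷ rs) ((1≤r , _) ∷ ls) = trans (cong (_∧ relFrom r rs) (start md)) (sym (relRow-relFrom r rs))
      where
      start : ∀ md → rel md 0 r ≡ true
      start rpp = refl
      start vst = ≤ᵇ-true 1≤r

    below : List ℕ → List ℕ → Bool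
    below ys row = all (λ q → proj₁ q ≤ᵇ proj₂ q) (zip ys row)

    rowWeight-cells : ∀ ys p row → length row ≤ length ys →
      rowWeight ys p row ≡ ind (relFrom p row ∧ below ys row) * rowCells ys row
    rowWeight-cells []       p []        le       = refl
    rowWeight-cells (y ∷ ys) p []        le       = refl
    rowWeight-cells (y ∷ ys) p (r ∷ row) (s≤s le) = trans
      (cong (λ z → ind (rel md p r) * (ind (y ≤ᵇ r) * cell y r * z)) (rowWeight-cells ys r row le))
      (collect (rel md p r) (y ≤ᵇ r) (relFrom r row) (below ys row) (cell y r) (rowCells ys row))
      where
      collect : ∀ a b c d x z → ind a * (ind b * x * (ind (c ∧ d) * z)) ≡ ind ((a ∧ c) ∧ (b ∧ d)) * (x * z)
      collect false b     c     d x z = refl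
      collect true  true  c     d x z = lemma (ind (c ∧ d)) x z
        where
        lemma : ∀ i x z → 1ℤ * (1ℤ * x * (i * z)) ≡ i * (x * z)
        lemma = solve-∀
      collect true  false true  d x z = refl
      collect true  false false d x z = refl

    weight-cells : ∀ ls ys S → Decreasing (length ys) ls → Rows (Letter k) ls S →
      weight ys S ≡ ind (all relRow S ∧ colsWeak (ys ∷ S)) * cells ys S
    weight-cells []       ys []        d        _              = refl
    weight-cells (l ∷ ls) ys (row ∷ S) (le , d) ((e , ll) , h) = trans
      (cong₂ _*_ (trans (rowWeight-cells ys 0 row (subst (_≤ length ys) (sym e) le))
                    (cong (λ b → ind (b ∧ below ys row) * rowCells ys row) (relFrom-0 row ll)))
                 (weight-cells ls row S (subst (λ c → Decreasing c ls) (sym e) d) h))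
      (collect (relRow row) (below ys row) (all relRow S) (colsWeak (row ∷ S)) (rowCells ys row) (cells row S))
      where
      collect : ∀ a b c d x z → ind (a ∧ b) * x * (ind (c ∧ d) * z) ≡ ind ((a ∧ c) ∧ (b ∧ d)) * (x * z)
      collect false b     c     d x z = refl
      collect true  true  c     d x z = lemma (ind (c ∧ d)) x z
        where
        lemma : ∀ i x z → 1ℤ * x * (i * z) ≡ i * (x * z)
        lemma = solve-∀
      collect true  false true  d x z = refl
      collect true  false false d x z = refl

    below-0 : ∀ n row → below (replicate n 0) row ≡ true
    below-0 zero    row       = refl
    below-0 (suc n) []        = refl
    below-0 (suc n) (r ∷ row) = trans (cong (_∧ below (replicate n 0) row) (≤ᵇ-true (z≤n {r}))) (below-0 n row)

    colsWeak-0 : ∀ n S → colsWeak (replicate n 0 ∷ S) ≡ colsWeak S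
    colsWeak-0 n []        = refl
    colsWeak-0 n (row ∷ S) = cong (_∧ colsWeak (row ∷ S)) (below-0 n row)

  -- The flags of different cells are independent. A cell under an equal letter may be joined or
  -- not, in total 1 + X r; any other cell must stay unjoined and weighs X r.
  ∑-rowFlags : ∀ ys row → length row ≤ length ys →
    ∑ (rowFlags (length row)) (λ fl → ind (validRow ys row fl) * flagWeight row fl) ≡ rowCells vst ys row
  ∑-rowFlags []       []        le       = refl
  ∑-rowFlags (y ∷ ys) []        le       = refl
  ∑-rowFlags (y ∷ ys) (r ∷ row) (s≤s le) = begin
    ∑ (rowFlags (suc (length row))) g ≡⟨ ∑-∷ (λ _ → rowFlags (length row)) (true ∷ false ∷ []) g ⟩
    ∑ Φ (λ fl → g (true ∷ fl)) + (∑ Φ (λ fl → g (false ∷ fl)) + 0ℤ)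
      ≡⟨ cong₂ (λ a b → a + (b + 0ℤ)) (branch true) (branch false) ⟩
    ind (y == r) * 1ℤ * R + (1ℤ * X r * R + 0ℤ) ≡⟨ combine (y == r) ⟩
    Tableaux.cell vst X y r * R ≡⟨ cong (Tableaux.cell vst X y r *_) (∑-rowFlags ys row le) ⟩
    Tableaux.cell vst X y r * rowCells vst ys row ∎
    where
    Φ : List (List Bool)
    Φ = rowFlags (length row)
    g : List Bool → ℤ
    g fl = ind (validRow (y ∷ ys) (r ∷ row) fl) * flagWeight (r ∷ row) fl
    R : ℤ
    R = ∑ Φ (λ fl → ind (validRow ys row fl) * flagWeight row fl)
    branch : ∀ f → ∑ Φ (λ fl → g (f ∷ fl)) ≡ ind (not f ∨ (y == r)) * (if f then 1ℤ else X r) * R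
    branch f = trans (∑-cong Φ (λ fl → trans
        (cong (_* ((if f then 1ℤ else X r) * flagWeight row fl)) (trans (cong ind (validRow-∷ y ys r row f fl)) (ind-∧ (not f ∨ (y == r)) (validRow ys row fl))))
        (*-interchange (ind (not f ∨ (y == r))) (ind (validRow ys row fl)) (if f then 1ℤ else X r) (flagWeight row fl))))
      (∑-*ˡ (ind (not f ∨ (y == r)) * (if f then 1ℤ else X r)) Φ (λ fl → ind (validRow ys row fl) * flagWeight row fl))
    combine : ∀ b → ind b * 1ℤ * R + (1ℤ * X r * R + 0ℤ) ≡ (if b then 1ℤ + X r else X r) * R
    combine true  = lemma (X r) R
      where
      lemma : ∀ x R → 1ℤ * 1ℤ * R + (1ℤ * x * R + 0ℤ) ≡ (1ℤ + x) * R
      lemma = solve-∀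
    combine false = lemma (X r) R
      where
      lemma : ∀ x R → 0ℤ * 1ℤ * R + (1ℤ * x * R + 0ℤ) ≡ x * R
      lemma = solve-∀

  ∑-flagsets : ∀ ls ys S → Decreasing (length ys) ls → Rows (Letter k) ls S →
    ∑ (flagsets ls) (λ F → ind (validRows ys S F) * W (groupCount S F)) ≡ cells vst ys S
  ∑-flagsets []       ys []        d        _              =
    trans (cong (λ z → 1ℤ * z + 0ℤ) (monomial-0 X 1 k (λ _ → 0) (λ _ _ → refl))) refl
  ∑-flagsets (l ∷ ls) ys (row ∷ S) (le , d) ((refl , ll) , h) = begin
    ∑ (flagsets (l ∷ ls)) (λ F → ind (validRows ys (row ∷ S) F) * W (groupCount (row ∷ S) F))
      ≡⟨ ∑-∷ (λ _ → flagsets ls) (rowFlags l) (λ F → ind (validRows ys (row ∷ S) F) * W (groupCount (row ∷ S) F)) ⟩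
    ∑ (rowFlags l) (λ fl → ∑ (flagsets ls) (λ F → ind (validRow ys row fl ∧ validRows row S F) * W (λ r → rowTops row fl r ℕ.+ groupCount S F r)))
      ≡⟨ ∑-cong (rowFlags l) (λ fl → trans (∑-cong (flagsets ls) (λ F → trans
           (cong₂ _*_ (ind-∧ (validRow ys row fl) (validRows row S F))
              (trans (monomial-+ X 1 k (rowTops row fl) (groupCount S F)) (cong (_* W (groupCount S F)) (W-rowTops row fl ll))))
           (*-interchange (ind (validRow ys row fl)) (ind (validRows row S F)) (flagWeight row fl) (W (groupCount S F)))))
         (∑-*ˡ (ind (validRow ys row fl) * flagWeight row fl) (flagsets ls) (λ F → ind (validRows row S F) * W (groupCount S F)))) ⟩
    ∑ (rowFlags l) (λ fl → ind (validRow ys row fl) * flagWeight row fl * Q)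
      ≡⟨ ∑-*ʳ Q (rowFlags l) (λ fl → ind (validRow ys row fl) * flagWeight row fl) ⟩
    ∑ (rowFlags l) (λ fl → ind (validRow ys row fl) * flagWeight row fl) * Q
      ≡⟨ cong₂ _*_ (∑-rowFlags ys row le) (∑-flagsets ls row S d h) ⟩
    rowCells vst ys row * cells vst row S ∎
    where
    Q : ℤ
    Q = ∑ (flagsets ls) (λ F → ind (validRows row S F) * W (groupCount S F))

  -- In a column of a reverse plane partition, r is counted at its topmost cell.

  occurs : ℕ → Filling → ℕ → Bool
  occurs r S j = any (λ row → isJust= r (at row j)) S

  -- Leaving out the columns where the row above already has `r` makes the column count additive
  -- over rows; under a row of zeros it is `colCount` at every positive letter.
  newOccurrences : ℕ → List ℕ → Filling → ℕ → ℕ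
  newOccurrences w ys S r = countB (λ j → not (isJust= r (at ys j)) ∧ occurs r S j) (upTo w)

  -- Joining all equal vertical neighbours leaves one top cell for each letter of a weakly
  -- increasing column. Column counts thereby become counts of top cells, as for valued-set
  -- tableaux.
  joins : List ℕ → List ℕ → List Bool
  joins (y ∷ ys) (r ∷ row) = (y == r) ∷ joins ys row
  joins _        _         = []

  flagWeight-joins : ∀ ys row → flagWeight row (joins ys row) ≡ rowCells rpp ys row
  flagWeight-joins []       []        = refl
  flagWeight-joins []       (r ∷ row) = refl
  flagWeight-joins (y ∷ ys) []        = refl
  flagWeight-joins (y ∷ ys) (r ∷ row) = cong (Tableaux.cell rpp X y r *_) (flagWeight-joins ys row)

  isJust=-just : ∀ {r} m → T (isJust= r m) → m ≡ just r
  isJust=-just (just x) t = cong just (==⇒≡ t)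

  countB-upTo-suc : ∀ n (p : ℕ → Bool) → countB p (upTo (suc n)) ≡ bit (p 0) ℕ.+ countB (λ j → p (suc j)) (upTo n)
  countB-upTo-suc n p = trans (countB-∷ p 0 (applyUpTo suc n)) (cong (bit (p 0) ℕ.+_)
    (trans (cong (countB p) (sym (LP.map-upTo suc n))) (countB-map suc p (upTo n))))

  rowTops-joins : ∀ w ys row r → length row ≤ length ys → length row ≤ w →
    countB (λ j → not (isJust= r (at ys j)) ∧ isJust= r (at row j)) (upTo w) ≡ rowTops row (joins ys row) r
  rowTops-joins w       ys       []        r le       le′       = trans
    (countB-cong (upTo w) (λ j → ∧-zeroʳ (not (isJust= r (at ys j))))) (trans (countB-false (upTo w)) refl)
  rowTops-joins (suc w) (y ∷ ys) (x ∷ row) r (s≤s le) (s≤s le′) = begin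
    countB p (upTo (suc w)) ≡⟨ countB-upTo-suc w p ⟩
    bit (not (y == r) ∧ (x == r)) ℕ.+ countB (λ j → p (suc j)) (upTo w)
      ≡⟨ cong₂ ℕ._+_ (cong bit first) (rowTops-joins w ys row r le le′) ⟩
    bit ((x == r) ∧ not (y == x)) ℕ.+ rowTops row (joins ys row) r
      ≡⟨ sym (countB-∷ (λ q → (proj₁ q == r) ∧ not (proj₂ q)) (x , (y == x)) (zip row (joins ys row))) ⟩
    rowTops (x ∷ row) (joins (y ∷ ys) (x ∷ row)) r ∎
    where
    p : ℕ → Bool
    p j = not (isJust= r (at (y ∷ ys) j)) ∧ isJust= r (at (x ∷ row) j)
    first : (not (y == r) ∧ (x == r)) ≡ ((x == r) ∧ not (y == x))
    first with x ℕ.≟ r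
    ... | yes refl = ∧-identityʳ (not (y == x))
    ... | no  _    = ∧-zeroʳ (not (y == r))

  at-shorter : ∀ ys row j {x} → length row ≤ length ys → at row j ≡ just x → ∃ λ y → at ys j ≡ just y
  at-shorter (y ∷ ys) (r ∷ row) zero    (s≤s le) e = y , refl
  at-shorter (y ∷ ys) (r ∷ row) (suc j) (s≤s le) e = at-shorter ys row j le e

  below-at : ∀ ys row j {y x} → T (below rpp ys row) → at ys j ≡ just y → at row j ≡ just x → y ≤ x
  below-at (y ∷ ys) (x ∷ row) zero    t refl refl = ≤ᵇ⇒≤ (proj₁ (T-∧ {y ≤ᵇ x} t))
  below-at (y ∷ ys) (x ∷ row) (suc j) t e    e′   = below-at ys row j (proj₂ (T-∧ {y ≤ᵇ x} t)) e e′

  occurs-above : ∀ ls ys S r j → Decreasing (length ys) ls → Rows (Letter k) ls S → T (colsWeak (ys ∷ S)) →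
    T (occurs r S j) → ∃ λ y → at ys j ≡ just y × y ≤ r
  occurs-above (l ∷ ls) ys (row ∷ S) r j (le , d) ((refl , _) , h) t o with T? (isJust= r (at row j))
  ... | yes here = proj₁ q , proj₂ q , below-at ys row j (proj₁ (T-∧ {below rpp ys row} t)) (proj₂ q) (isJust=-just (at row j) here)
    where
    q : ∃ λ y → at ys j ≡ just y
    q = at-shorter ys row j le (isJust=-just (at row j) here)
  ... | no ¬here = proj₁ q , proj₂ q , ℕP.≤-trans (below-at ys row j (proj₁ tt′) (proj₂ q) (proj₁ (proj₂ rec))) (proj₂ (proj₂ rec))
    where
    tt′ : T (below rpp ys row) × T (colsWeak (row ∷ S))
    tt′ = T-∧ {below rpp ys row} t
    rec : ∃ λ x → at row j ≡ just x × x ≤ r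
    rec = occurs-above ls row S r j d h (proj₂ tt′) (subst (λ b → T (b ∨ occurs r S j)) (¬T⇒≡false ¬here) o)
    q : ∃ λ y → at ys j ≡ just y
    q = at-shorter ys row j le (proj₁ (proj₂ rec))

  -- Columns increase weakly, so an `r` above `row` and an `r` below it in the same column force an
  -- `r` in `row`; hence no column is counted wrongly when the rows are split.
  newOccurrences-∷ : ∀ w ls ys row S r → length row ≤ length ys → length row ≤ w → Decreasing (length row) ls →
    Rows (Letter k) ls S → T (colsWeak (ys ∷ row ∷ S)) →
    newOccurrences w ys (row ∷ S) r ≡ rowTops row (joins ys row) r ℕ.+ newOccurrences w row S r
  newOccurrences-∷ w ls ys row S r le le′ d h t = trans
    (countB-+ _ _ _ (upTo w) (λ j → split (isJust= r (at ys j)) (isJust= r (at row j)) (occurs r S j) (sandwich j)))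
    (cong (ℕ._+ newOccurrences w row S r) (rowTops-joins w ys row r le le′))
    where
    split : ∀ a b c → (T a → T c → T b) → bit (not a ∧ (b ∨ c)) ≡ bit (not a ∧ b) ℕ.+ bit (not b ∧ c)
    split true  true  c     f = refl
    split true  false true  f = ⊥-elim (f tt tt)
    split true  false false f = refl
    split false true  c     f = refl
    split false false c     f = refl
    sandwich : ∀ j → T (isJust= r (at ys j)) → T (occurs r S j) → T (isJust= r (at row j))
    sandwich j y≡r o = subst (λ m → T (isJust= r m)) (sym (proj₁ (proj₂ q)))
      (≡true⇒T (==-true (ℕP.≤-antisym (proj₂ (proj₂ q)) (below-at ys row j (proj₁ tt′) (isJust=-just (at ys j) y≡r) (proj₁ (proj₂ q))))))
      where
      tt′ : T (below rpp ys row) × T (colsWeak (row ∷ S))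
      tt′ = T-∧ {below rpp ys row} t
      q : ∃ λ x → at row j ≡ just x × x ≤ r
      q = occurs-above ls row S r j d h (proj₂ tt′) o

  W-newOccurrences : ∀ w ls ys S → Decreasing (length ys) ls → All (_≤ w) ls → Rows (Letter k) ls S →
    T (colsWeak (ys ∷ S)) → W (newOccurrences w ys S) ≡ cells rpp ys S
  W-newOccurrences w []       ys []        d        b       _                 t = monomial-0 X 1 k _ (λ r _ → trans
    (countB-cong (upTo w) (λ j → ∧-zeroʳ (not (isJust= r (at ys j))))) (countB-false (upTo w)))
  W-newOccurrences w (l ∷ ls) ys (row ∷ S) (le , d) (q ∷ b) ((refl , ll) , h) t = trans
    (W-cong (λ r → newOccurrences-∷ w ls ys row S (suc r) le q d h t))
    (trans (monomial-+ X 1 k (rowTops row (joins ys row)) (newOccurrences w row S))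
    (cong₂ _*_ (trans (W-rowTops row (joins ys row) ll) (flagWeight-joins ys row))
               (W-newOccurrences w ls row S d b h (proj₂ (T-∧ {below rpp ys row} t)))))

  W-colCount : ∀ ls S → Decreasing (width ls) ls → Rows (Letter k) ls S → T (colsWeak S) →
    W (colCount ls S) ≡ cells rpp (replicate (width ls) 0) S
  W-colCount ls S d h t = trans
    (W-cong (λ r → countB-cong (upTo w) (λ j → cong (λ b → not b ∧ occurs (suc r) S j) (sym (at-0 w r j)))))
    (W-newOccurrences w ls (replicate w 0) S (subst (λ c → Decreasing c ls) (sym (LP.length-replicate w)) d)
      (decreasing-bounded w ls d) h (subst T (sym (colsWeak-0 rpp w S)) t))
    where
    w : ℕ
    w = width ls
    at-0 : ∀ n r j → isJust= (suc r) (at (replicate n 0) j) ≡ false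
    at-0 zero    r j       = refl
    at-0 (suc n) r zero    = refl
    at-0 (suc n) r (suc j) = at-0 n r j

  module _ (N : ℕ) (ls : List ℕ) (d : Decreasing (width ls) ls) where

    private
      Γ : List (List ℕ)
      Γ = boxes (replicate k N)

      Σ : List Filling
      Σ = fillings k ls

      ys : List ℕ
      ys = replicate (width ls) 0

      d′ : Decreasing (length ys) ls
      d′ = subst (λ c → Decreasing c ls) (sym (LP.length-replicate (width ls))) d

    private
      μ : List ℕ → ℤ
      μ = monomial X 1

      hasWeight : List ℕ → (ℕ → ℕ) → ℤ
      hasWeight τ a = ind (weightIs τ a)

    ∑-gCoeff : width ls ≤ N → ∑ Γ (λ τ → gCoeff ls τ * μ τ) ≡ Tableaux.Z rpp X k ys ls
    ∑-gCoeff w≤N = begin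
      ∑ Γ (λ τ → gCoeff ls τ * μ τ)
        ≡⟨ ∑-congᴬ (All.map (λ {τ} (l , _) → cong (_* μ τ) (expand τ l)) (boxes-replicate-sound k N)) ⟩
      ∑ Γ (λ τ → ∑ Σ (λ S → ind (isRPP S) * hasWeight τ (colCount ls S)) * μ τ)
        ≡⟨ ∑-pull Σ Γ (λ S → ind (isRPP S)) (λ S τ → hasWeight τ (colCount ls S)) μ ⟩
      ∑ Σ (λ S → ind (isRPP S) * ∑ Γ (λ τ → hasWeight τ (colCount ls S) * μ τ))
        ≡⟨ ∑-cong Σ (λ S → cong (ind (isRPP S) *_) (∑-weightIs X k N (colCount ls S) (colCount≤N S))) ⟩
      ∑ Σ (λ S → ind (isRPP S) * W (colCount ls S))
        ≡⟨ ∑-congᴬ (All.map (λ {S} h → sym (trans (weight-cells rpp ls ys S d′ h) (trans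
             (cong (λ b → ind (all rowWeak S ∧ b) * cells rpp ys S) (colsWeak-0 rpp (width ls) S)) (onlyRPP S h)))) (fillings-sound k ls)) ⟩
      ∑ Σ (weight rpp ys) ≡⟨ sym (Z-weight rpp ls ys) ⟩
      Tableaux.Z rpp X k ys ls ∎
      where
      expand : ∀ τ → length τ ≡ k → gCoeff ls τ ≡ ∑ Σ (λ S → ind (isRPP S) * hasWeight τ (colCount ls S))
      expand τ refl = trans (countB-∑ (λ S → isRPP S ∧ weightIs τ (colCount ls S)) Σ)
        (∑-cong Σ (λ S → ind-∧ (isRPP S) (weightIs τ (colCount ls S))))
      colCount≤N : ∀ S r → colCount ls S r ≤ N
      colCount≤N S r = ℕP.≤-trans (countB-≤ _ (upTo (width ls))) (ℕP.≤-trans (ℕP.≤-reflexive (LP.length-upTo (width ls))) w≤N)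
      onlyRPP : ∀ S → Rows (Letter k) ls S → ind (isRPP S) * cells rpp ys S ≡ ind (isRPP S) * W (colCount ls S)
      onlyRPP S h with T? (colsWeak S)
      ... | yes t = cong (ind (isRPP S) *_) (sym (W-colCount ls S d h t))
      ... | no ¬t = trans (cong (_* cells rpp ys S) isRPP≡0) (sym (cong (_* W (colCount ls S)) isRPP≡0))
        where
        isRPP≡0 : ind (isRPP S) ≡ 0ℤ
        isRPP≡0 = trans (ind-∧ (all rowWeak S) (colsWeak S)) (trans
          (cong (λ b → ind (all rowWeak S) * ind b) (¬T⇒≡false ¬t)) (ℤP.*-zeroʳ (ind (all rowWeak S))))

    ∑-jCoeff : size ls ≤ N → ∑ Γ (λ τ → jCoeff ls τ * μ τ) ≡ Tableaux.Z vst X k ys ls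
    ∑-jCoeff s≤N = begin
      ∑ Γ (λ τ → jCoeff ls τ * μ τ)
        ≡⟨ ∑-congᴬ (All.map (λ {τ} (l , _) → cong (_* μ τ) (expand τ l)) (boxes-replicate-sound k N)) ⟩
      ∑ Γ (λ τ → ∑ Σ (λ S → ind (isVST S) * grouped S τ) * μ τ)
        ≡⟨ ∑-pull Σ Γ (λ S → ind (isVST S)) grouped μ ⟩
      ∑ Σ (λ S → ind (isVST S) * ∑ Γ (λ τ → grouped S τ * μ τ))
        ≡⟨ ∑-congᴬ (All.map (λ {S} h → trans (cong (ind (isVST S) *_) (flags S h)) (sym (trans (weight-cells vst ls ys S d′ h)
             (cong (λ b → ind (all rowStrict S ∧ b) * cells vst ys S) (colsWeak-0 vst (width ls) S))))) (fillings-sound k ls)) ⟩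
      ∑ Σ (weight vst ys) ≡⟨ sym (Z-weight vst ls ys) ⟩
      Tableaux.Z vst X k ys ls ∎
      where
      Φ : List (List (List Bool))
      Φ = flagsets ls
      grouped : Filling → List ℕ → ℤ
      grouped S τ = ∑ Φ (λ F → ind (validFlags S F) * hasWeight τ (groupCount S F))
      expand : ∀ τ → length τ ≡ k → jCoeff ls τ ≡ ∑ Σ (λ S → ind (isVST S) * grouped S τ)
      expand τ refl = begin
        jCoeff ls τ ≡⟨ sumℕ-∑ n (filter (λ S → T? (isVST S)) Σ) ⟩
        ∑ (filter (λ S → T? (isVST S)) Σ) (λ S → ℤ.+ n S) ≡⟨ ∑-filter isVST Σ (λ S → ℤ.+ n S) ⟩
        ∑ Σ (λ S → ind (isVST S) * ℤ.+ n S)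
          ≡⟨ ∑-cong Σ (λ S → cong (ind (isVST S) *_) (trans (countB-∑ (λ F → validFlags S F ∧ weightIs τ (groupCount S F)) Φ)
               (∑-cong Φ (λ F → ind-∧ (validFlags S F) (weightIs τ (groupCount S F)))))) ⟩
        ∑ Σ (λ S → ind (isVST S) * grouped S τ) ∎
        where
        n : Filling → ℕ
        n S = countB (λ F → validFlags S F ∧ weightIs τ (groupCount S F)) Φ
      flags : ∀ S → Rows (Letter k) ls S → ∑ Γ (λ τ → grouped S τ * μ τ) ≡ cells vst ys S
      flags S h = begin
        ∑ Γ (λ τ → grouped S τ * μ τ)
          ≡⟨ ∑-pull Φ Γ (λ F → ind (validFlags S F)) (λ F τ → hasWeight τ (groupCount S F)) μ ⟩
        ∑ Φ (λ F → ind (validFlags S F) * ∑ Γ (λ τ → hasWeight τ (groupCount S F) * μ τ))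
          ≡⟨ ∑-congᴬ (All.map (λ {F} hF → cong₂ (λ b z → ind b * z) (validFlags-origin (width ls) ls S F d h hF)
                 (∑-weightIs X k N (groupCount S F) (λ r → ℕP.≤-trans (groupCount-≤ ls S F h hF r) s≤N))) (flagsets-sound ls)) ⟩
        ∑ Φ (λ F → ind (validRows ys S F) * W (groupCount S F)) ≡⟨ ∑-flagsets ls ys S d′ h ⟩
        cells vst ys S ∎

-- Tableaux as paths

isPart-decreasing : ∀ {x} μ → IsPartition μ → width μ ≤ x → Decreasing x μ
isPart-decreasing []      p le = tt
isPart-decreasing (y ∷ μ) p le = le , isPart-decreasing μ (isPart-tail μ p) (isPart-width μ p)

≤-size : ∀ τ → All (_≤ size τ) τ
≤-size []      = []
≤-size (n ∷ τ) = ℕP.m≤m+n n (size τ) ∷ All.map (λ p → ℕP.≤-trans p (ℕP.m≤n+m (size τ) n)) (≤-size τ)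

sgn-sgn : ∀ n x → sgn n * (sgn n * x) ≡ x
sgn-sgn zero    x = trans (ℤP.*-identityˡ (1ℤ * x)) (ℤP.*-identityˡ x)
sgn-sgn (suc n) x = trans (lemma (sgn n) x) (sgn-sgn n x)
  where
  lemma : ∀ s x → - s * (- s * x) ≡ s * (s * x)
  lemma = solve-∀

module Coefficients (ls : List ℕ) (p : IsPartition ls) where

  m w : ℕ
  m = length ls
  w = width ls

  open Path m w

  d : Decreasing w ls
  d = isPart-decreasing ls p ℕP.≤-refl

  ls-shape : Shape ls
  ls-shape = shape refl d

  origin : List ℕ → ℤ
  origin b = ind (b ==ₗ replicate m 0)

  width≤size : ∀ ls → width ls ≤ size ls
  width≤size []       = z≤n
  width≤size (l ∷ ls) = ℕP.m≤m+n l (size ls)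

  module _ (τ : List ℕ) where
    private
      N : ℕ
      -- The first summand bounds the degrees of the matrix entries, the second bounds the parts of
      -- `τ`.
      N = m ℕ.* w ℕ.+ size τ

      small : All (_≤ N) τ
      small = All.map (λ q → ℕP.≤-trans q (ℕP.m≤n+m (size τ) (m ℕ.* w))) (≤-size τ)

      bounded : m ℕ.* w ≤ N
      bounded = ℕP.m≤m+n (m ℕ.* w) (size τ)

      size≤N : size ls ≤ N
      size≤N = ℕP.≤-trans (size-bounded ls (decreasing-bounded w ls d)) bounded

      open PathGenerating m w N bounded using (path-Z)

    jCoeff-path : jCoeff ls τ ≡ path vst origin τ ls
    jCoeff-path = monomial-injective (length τ) N (jCoeff ls) (λ τ → path vst origin τ ls)
      (λ X → trans (Fillings.∑-jCoeff X (length τ) N ls d size≤N) (sym (path-Z vst X (length τ) ls-shape))) τ refl small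

    gCoeff-path : gCoeff ls τ ≡ path rpp origin τ ls
    gCoeff-path = monomial-injective (length τ) N (gCoeff ls) (λ τ → path rpp origin τ ls)
      (λ X → trans (Fillings.∑-gCoeff X (length τ) N ls d (ℕP.≤-trans (width≤size ls) size≤N)) (sym (path-Z rpp X (length τ) ls-shape))) τ refl small

  jλ-refinements : ∀ β → ∑ (refinements β) (λ α → sign α * coeff (jλ ls) (sortDesc α)) ≡ sgn (size β) * coeff (gλ ls) β
  jλ-refinements β with size β ℕ.≤? size ls
  ... | yes le = begin
    ∑ (refinements β) (λ α → sign α * coeff (jλ ls) (sortDesc α))
      ≡⟨ ∑-congᴬ (All.map (λ {α} (s , pos) → cong (sign α *_) (begin
           coeff (jλ ls) (sortDesc α) ≡⟨ trunc-≤ (size ls) (jCoeff ls) (sortDesc α)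
                (subst (_≤ size ls) (sym (trans (size-sortDesc α) s)) le) ⟩
           jCoeff ls (sortDesc α) ≡⟨ jCoeff-path (sortDesc α) ⟩
           -- Refinements have positive parts, so sorting deletes nothing and is a mere permutation.
           path vst origin (sortDesc α) ls ≡⟨ path-↭ (sortDesc-positive pos) origin ls-shape ⟩
           path vst origin α ls ∎)) (refinements-sound β)) ⟩
    ∑ (refinements β) (λ α → sign α * path vst origin α ls) ≡⟨ ∑-refinements-path β origin ls-shape ⟩
    sgn (size β) * path rpp origin β ls ≡⟨ cong (sgn (size β) *_) (sym (gCoeff-path β)) ⟩
    sgn (size β) * gCoeff ls β ∎
  -- A refinement has the size of `β`, so beyond the degree |λ| both sides are cut off to 0.
  ... | no gt = trans (∑-≡0ᴬ (All.map (λ {α} (s , _) → trans (cong (sign α *_)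
      (vanish (jλ ls) (sortDesc α) (subst (size ls <_) (sym (trans (size-sortDesc α) s)) (ℕP.≰⇒> gt)))) (ℤP.*-zeroʳ (sign α)))
      (refinements-sound β))) (sym (ℤP.*-zeroʳ (sgn (size β))))

negx-coeff : ∀ f μ → coeff (negx f) μ ≡ sgn (size μ) * coeff f μ
negx-coeff f μ = trunc-≡ (bound f) _ μ (λ lt → trans (cong (sgn (size μ) *_) (vanish f μ lt)) (ℤP.*-zeroʳ (sgn (size μ))))

j̃λ-coeff : ∀ ls μ → coeff (j̃λ ls) μ ≡ sgn (size ls) * (sgn (size μ) * coeff (jλ ls) μ)
j̃λ-coeff ls μ = trunc-≡ (size ls) _ μ (λ lt → trans (cong (λ z → sgn (size ls) * (sgn (size μ) * z)) (vanish (jλ ls) μ lt))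
  (trans (cong (sgn (size ls) *_) (ℤP.*-zeroʳ (sgn (size μ)))) (ℤP.*-zeroʳ (sgn (size ls)))))

theorem8p3 : (S : Λ → Λ) → IsAntipode S → (shp : List ℕ) → IsPartition shp →
    (S (j̃λ shp) ≈ scale (sgn (size shp)) (gλ shp)) × (S (jλ shp) ≈ negx (gλ shp))
theorem8p3 S isAntipode shp p = partA , partB
  where
  open Antipode S isAntipode using (antipode-coeff)
  open Coefficients shp p using (jλ-refinements)

  partB : S (jλ shp) ≈ negx (gλ shp)
  partB β pβ = trans (antipode-coeff β pβ (jλ shp)) (trans (jλ-refinements β) (sym (negx-coeff (gλ shp) β)))

  partA : S (j̃λ shp) ≈ scale (sgn (size shp)) (gλ shp)
  partA β pβ = begin
    coeff (S (j̃λ shp)) β ≡⟨ antipode-coeff β pβ (j̃λ shp) ⟩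
    ∑ (refinements β) (λ α → sign α * coeff (j̃λ shp) (sortDesc α))
      -- The sign of the substitution depends on |α| = |β| only; it leaves the sum and later cancels
      -- against the sign in `jλ-refinements`.
      ≡⟨ ∑-congᴬ (All.map (λ {α} (s , _) → trans (cong (sign α *_) (trans (j̃λ-coeff shp (sortDesc α))
             (cong (λ n → sgn (size shp) * (sgn n * coeff (jλ shp) (sortDesc α))) (trans (size-sortDesc α) s))))
           (rearrange (sign α) (sgn (size shp)) (sgn (size β)) (coeff (jλ shp) (sortDesc α)))) (refinements-sound β)) ⟩
    ∑ (refinements β) (λ α → sgn (size shp) * sgn (size β) * (sign α * coeff (jλ shp) (sortDesc α)))
      ≡⟨ ∑-*ˡ (sgn (size shp) * sgn (size β)) (refinements β) (λ α → sign α * coeff (jλ shp) (sortDesc α)) ⟩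
    sgn (size shp) * sgn (size β) * ∑ (refinements β) (λ α → sign α * coeff (jλ shp) (sortDesc α))
      ≡⟨ cong (sgn (size shp) * sgn (size β) *_) (jλ-refinements β) ⟩
    sgn (size shp) * sgn (size β) * (sgn (size β) * coeff (gλ shp) β)
      ≡⟨ trans (ℤP.*-assoc (sgn (size shp)) (sgn (size β)) (sgn (size β) * coeff (gλ shp) β))
           (cong (sgn (size shp) *_) (sgn-sgn (size β) (coeff (gλ shp) β))) ⟩
    sgn (size shp) * coeff (gλ shp) β ≡⟨ sym (scale-coeff (sgn (size shp)) (gλ shp) β) ⟩
    coeff (scale (sgn (size shp)) (gλ shp)) β ∎
    where
    rearrange : ∀ l s t c → l * (s * (t * c)) ≡ s * t * (l * c)
    rearrange = solve-∀
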